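{- Let $G$ be a claw-free innocent graph and let $Z$ be a consistent set of safe vertices in $G$. Then $G$ has a strong stable set that contains $Z$.
   Context: All graphs are finite and simple. $N(v)$ is the set of neighbours of $v$. A graph $G$ contains $H$ if some induced subgraph of $G$ is isomorphic to $H$. Two disjoint vertex sets are complete (anticomplete) to each other if every vertex of one is adjacent (non-adjacent) to every vertex of the other. A clique is a set of pairwise adjacent vertices, a stable set is a set of pairwise non-adjacent vertices, and a stable set of $G$ is strong if it meets every maximal clique of $G$. $G$ is claw-free if it contains no induced $K_{1,3}$. A path is a sequence of distinct vertices $p_0\hbox{ - }p_1\hbox{ - }\dots\hbox{ - }p_k$ with $p_i$ adjacent to $p_j$ iff $|i-j|=1$; its length is $k$ (odd/even accordingly). For $k\ge4$ a hole of length $k$ is an induced $C_k$ and an antihole of length $k$ is an induced complement of $C_k$. A prism consists of two vertex-disjoint triangles $\{a_1,a_2,a_3\}$, $\{b_1,b_2,b_3\}$ and paths $P_1,P_2,P_3$, $P_i$ with ends $a_i,b_i$, such that for $i<j$ the only edges between $V(P_i)$ and $V(P_j)$ are $a_ia_j,b_ib_j$; it is odd if all $P_i$ have odd length. A handcuff consists of two vertex-disjoint even holes $C_1,C_2$ and a disjoint path $p_1\hbox{ - }\dots\hbox{ - }p_r$ of odd length such that $p_1$ has exactly two neighbours in $V(C_1)$, which are adjacent, $p_r$ has exactly two neighbours in $V(C_2)$, which are adjacent, and there are no other edges among these three parts. An eye mask consists of two vertex-disjoint even holes $C_1,C_2$ and edges $x_1y_1\in E(C_1)$, $x_2y_2\in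 E(C_2)$ with $\{x_1,y_1\}$ complete to $\{x_2,y_2\}$ and no other edges between $V(C_1),V(C_2)$. $G$ is innocent if it contains no odd hole, no antihole of length at least six, no odd prism, no handcuff, no eye mask. A vertex $v$ is simplicial if $N(v)$ is a clique. A clown is a graph on $\{c_0,c_1,\dots,c_k\}$ where $c_1\hbox{ - }c_2\hbox{ - }\dots\hbox{ - }c_k\hbox{ - }c_1$ is an even hole and $c_0$ is adjacent to exactly $c_1,c_2$ among $c_1,\dots,c_k$; $c_0$ is its hat $h(D)$. A vertex $v$ of $G$ is safe if it is simplicial and for every clown $D$ that is an induced subgraph of $G$, every path $P$ in $G$ with ends $v$ and $h(D)$ such that $V(P)\setminus\{h(D)\}$ is disjoint from and anticomplete to $V(D)\setminus\{h(D)\}$ has odd length. Two vertices $u,v$ form an even pair if every path with ends $u,v$ has even length (in particular $u,v$ are non-adjacent). A set of vertices is consistent if every two of its members form an even pair. -}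

module Defs where

open import Data.Nat using (ℕ; zero; suc; _≤_)
open import Data.Nat.Divisibility using (_∣_)
open import Data.Fin using (Fin; toℕ; fromℕ)
open import Data.Fin.Subset using (Subset; _∈_; _⊆_)
open import Data.Bool using (Bool; true; false)
open import Data.Product using (Σ; ∃; ∃-syntax; _×_; _,_)
open import Data.Sum using (_⊎_)
open import Relation.Nullary using (¬_)
open import Relation.Binary.PropositionalEquality using (_≡_; _≢_)
open import Function.Definitions using (Injective)

_iff_ : Set → Set → Set
A iff B = (A → B) × (B → A)

Even Odd : ℕ → Set
Even k = 2 ∣ k
Odd k = ¬ (2 ∣ k)

record Graph (n : ℕ) : Set where
  field
    adj     : Fin n → Fin n → Bool
    adj-sym : ∀ u v → adj u v ≡ adj v u
    adj-irr : ∀ v → adj v v ≡ false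

module _ {n : ℕ} (G : Graph n) where

  Adj : Fin n → Fin n → Set
  Adj u v = Graph.adj G u v ≡ true

  record Path : Set where
    field
      len  : ℕ
      vtx  : Fin (suc len) → Fin n
      inj  : Injective _≡_ _≡_ vtx
      adjP : ∀ i j → Adj (vtx i) (vtx j) iff
                     (toℕ j ≡ suc (toℕ i) ⊎ toℕ i ≡ suc (toℕ j))

  first last : Path → Fin n
  first P = Path.vtx P Fin.zero
  last  P = Path.vtx P (fromℕ (Path.len P))

  _∈P_ : Fin n → Path → Set
  v ∈P P = ∃[ i ] Path.vtx P i ≡ v

  CycAdj : (k : ℕ) → Fin k → Fin k → Set
  CycAdj k i j = toℕ j ≡ suc (toℕ i) ⊎ toℕ i ≡ suc (toℕ j)
               ⊎ (toℕ i ≡ 0 × suc (toℕ j) ≡ k) ⊎ (toℕ j ≡ 0 × suc (toℕ i) ≡ k)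

  record Hole : Set where
    field
      len  : ℕ
      len≥4 : 4 ≤ len
      vtx  : Fin len → Fin n
      inj  : Injective _≡_ _≡_ vtx
      adjH : ∀ i j → Adj (vtx i) (vtx j) iff CycAdj len i j

  _∈H_ : Fin n → Hole → Set
  v ∈H C = ∃[ i ] Hole.vtx C i ≡ v

  record Antihole6 : Set where
    field
      len  : ℕ
      len≥6 : 6 ≤ len
      vtx  : Fin len → Fin n
      inj  : Injective _≡_ _≡_ vtx
      adjA : ∀ i j → Adj (vtx i) (vtx j) iff (i ≢ j × ¬ CycAdj len i j)

  record Claw : Set where
    field
      a b c d : Fin n
      ab : Adj a b
      ac : Adj a c
      ad : Adj a d
      b≢c : b ≢ c
      b≢d : b ≢ d
      c≢d : c ≢ d
      nbc : ¬ Adj b c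
      nbd : ¬ Adj b d
      ncd : ¬ Adj c d

  ClawFree : Set
  ClawFree = ¬ Claw

  record OddPrism : Set where
    field
      P      : Fin 3 → Path
      odd    : ∀ i → Odd (Path.len (P i))
      disj   : ∀ i j → i ≢ j → ∀ v → v ∈P P i → ¬ (v ∈P P j)
      edges  : ∀ i j → i ≢ j → ∀ x y → x ∈P P i → y ∈P P j →
               Adj x y iff ((x ≡ first (P i) × y ≡ first (P j))
                          ⊎ (x ≡ last (P i) × y ≡ last (P j)))

  record Handcuff : Set where
    field
      C₁ C₂ : Hole
      even₁ : Even (Hole.len C₁)
      even₂ : Even (Hole.len C₂)
      P     : Path
      oddP  : Odd (Path.len P)
      disj₁₂ : ∀ v → v ∈H C₁ → ¬ (v ∈H C₂)
      disj₁P : ∀ v → v ∈H C₁ → ¬ (v ∈P P)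
      disj₂P : ∀ v → v ∈H C₂ → ¬ (v ∈P P)
      x₁ y₁ : Fin n
      x₁∈ : x₁ ∈H C₁
      y₁∈ : y₁ ∈H C₁
      x₁y₁ : Adj x₁ y₁
      x₂ y₂ : Fin n
      x₂∈ : x₂ ∈H C₂
      y₂∈ : y₂ ∈H C₂
      x₂y₂ : Adj x₂ y₂
      edges₁P : ∀ z w → z ∈H C₁ → w ∈P P →
                Adj w z iff (w ≡ first P × (z ≡ x₁ ⊎ z ≡ y₁))
      edges₂P : ∀ z w → z ∈H C₂ → w ∈P P →
                Adj w z iff (w ≡ last P × (z ≡ x₂ ⊎ z ≡ y₂))
      edges₁₂ : ∀ z₁ z₂ → z₁ ∈H C₁ → z₂ ∈H C₂ → ¬ Adj z₁ z₂

  record EyeMask : Set where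
    field
      C₁ C₂ : Hole
      even₁ : Even (Hole.len C₁)
      even₂ : Even (Hole.len C₂)
      disj₁₂ : ∀ v → v ∈H C₁ → ¬ (v ∈H C₂)
      x₁ y₁ : Fin n
      x₁∈ : x₁ ∈H C₁
      y₁∈ : y₁ ∈H C₁
      x₁y₁ : Adj x₁ y₁
      x₂ y₂ : Fin n
      x₂∈ : x₂ ∈H C₂
      y₂∈ : y₂ ∈H C₂
      x₂y₂ : Adj x₂ y₂
      edges : ∀ z₁ z₂ → z₁ ∈H C₁ → z₂ ∈H C₂ →
              Adj z₁ z₂ iff ((z₁ ≡ x₁ ⊎ z₁ ≡ y₁) × (z₂ ≡ x₂ ⊎ z₂ ≡ y₂))

  Innocent : Set
  Innocent = (¬ Σ Hole (λ C → Odd (Hole.len C)))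
           × (¬ Antihole6)
           × (¬ OddPrism)
           × (¬ Handcuff)
           × (¬ EyeMask)

  Simplicial : Fin n → Set
  Simplicial v = ∀ u w → Adj v u → Adj v w → u ≢ w → Adj u w

  -- Clown: even hole c_1 ... c_k (here vtx 0 ... vtx (k-1)) and hat c_0
  -- outside the hole adjacent to exactly vtx 0 and vtx 1 of the hole.
  record Clown : Set where
    field
      C    : Hole
      evenC : Even (Hole.len C)
      hat  : Fin n
      hat∉ : ¬ (hat ∈H C)
      hatAdj : ∀ i → Adj hat (Hole.vtx C i) iff (toℕ i ≡ 0 ⊎ toℕ i ≡ 1)

  Safe : Fin n → Set
  Safe v = Simplicial v ×
    (∀ (D : Clown) (P : Path) → first P ≡ v → last P ≡ Clown.hat D →
      (∀ w → w ∈P P → w ≢ Clown.hat D →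
         ¬ (w ∈H Clown.C D) × (∀ z → z ∈H Clown.C D → ¬ Adj w z)) →
      Odd (Path.len P))

  EvenPair : Fin n → Fin n → Set
  EvenPair u v = ∀ (P : Path) → first P ≡ u → last P ≡ v → Even (Path.len P)

  Consistent : Subset n → Set
  Consistent Z = ∀ u v → u ∈ Z → v ∈ Z → u ≢ v → EvenPair u v

  Clique : Subset n → Set
  Clique K = ∀ u v → u ∈ K → v ∈ K → u ≢ v → Adj u v

  -- maximal (inclusion-wise) clique; nonempty (only matters for n = 0)
  MaximalClique : Subset n → Set
  MaximalClique K = Clique K × (∃[ v ] v ∈ K) ×
                    (∀ K′ → Clique K′ → K ⊆ K′ → K′ ⊆ K)

  Stable : Subset n → Set
  Stable S = ∀ u v → u ∈ S → v ∈ S → ¬ Adj u v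

  StrongStable : Subset n → Set
  StrongStable S = Stable S ×
                   (∀ K → MaximalClique K → ∃[ v ] (v ∈ K × v ∈ S))

{-# OPTIONS --safe #-}

-- Exchange.  If S and T are strong and t ∈ T, swapping them on the component of t in S ∪ T gives a
-- strong set again, and a clique can only be lost along an odd induced path from t.  As the members
-- of Z are pairwise even, it suffices to treat |Z| ≤ 1, which is done by induction on the vertex set W.
--
-- If W has no hole, Dirac's theorem yields a simplicial vertex outside Z, which is deleted.
-- Otherwise take a shortest hole C, and call an even-indexed vertex of C alternate.  When C can be
-- chosen so that no two alternate vertices are the ends of an induced P₄, the alternate vertices meet
-- every maximal clique inside N[C].  For a 4-hole such a choice exists because the complement has no
-- long holes and therefore an edge that is not the middle of a P₄; for a longer hole, one of maximal
-- degree sum works.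
--
-- The vertices outside N[C] form the rest.  A maximal clique meeting both the rest and N[C] attaches
-- to C at a single edge cᵢcᵢ₊₁, and it is met by a set obtained by induction on the rest, the clique
-- and the marker cᵢ: the marker is safe as there is neither a handcuff nor an eye mask.  Exchange
-- merges these sets into one, since an odd path between two such cliques gives an odd hole, an odd
-- prism or an eye mask.
--
-- The conclusion is decidable, so everything is proved classically, under a double negation.
module Submission where

open import Defs
open import Level using (Level)
open import Function using (_∘_; id)
open import Data.Nat using (ℕ; zero; suc; _+_; _*_; _∸_; _≤_; _<_; z≤n; s≤s; s≤s⁻¹; _<?_; NonZero; >-nonZero)
open import Data.Nat.Properties hiding (_≟_)
open import Data.Nat.DivMod using (_%_; _mod_; _/_; m≡m%n+[m/n]*n; m%n<n; m<n⇒m%n≡m; [m+n]%n≡m%n; %-distribˡ-+; m%n%n≡m%n)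
open import Data.Nat.Divisibility using (_∣_; divides)
open import Data.Nat.Tactic.RingSolver using (solve-∀)
open import Data.Bool using (Bool; true; false; not; _∧_)
import Data.Bool.Properties as Bool
open import Data.Fin using (Fin; toℕ; fromℕ; fromℕ<; _≟_) renaming (zero to fzero; suc to fsuc)
import Data.Fin.Properties as Fin
open import Data.Fin.Subset using (Subset; _∈_; _⊆_; _∪_; ⁅_⁆)
open import Data.Fin.Subset.Properties using (_∈?_; _⊆?_; anySubset?; p⊆p∪q; x∈p∪q⁺; x∈p∪q⁻; x∈⁅x⁆; x∈⁅y⁆⇒x≡y)
open import Data.Vec using (tabulate; []; _∷_)
open import Data.Vec.Properties using (lookup∘tabulate; []=⇒lookup; lookup⇒[]=)
open import Data.List using (List; []; _∷_; _++_; length; lookup; filter; map; allFin)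
open import Data.List.Properties using (length-++; length-tabulate; filter-notAll)
open import Data.List.Membership.Propositional using () renaming (_∈_ to _∈ˡ_)
open import Data.List.Membership.Propositional.Properties using (∈-lookup; ∈-filter⁺; ∈-++⁺ˡ; ∈-++⁺ʳ; ∈-++⁻; ∈-allFin; ∈-map⁺)
open import Data.List.Relation.Unary.Any using (Any; here; there; any?)
open import Data.List.Relation.Unary.All as All using (All; []; _∷_)
import Data.List.Relation.Unary.All.Properties as All
open import Data.Product using (Σ; ∃; ∃-syntax; _×_; _,_; proj₁; proj₂)
open import Data.Sum using (_⊎_; inj₁; inj₂; [_,_]′)
open import Data.Unit using (⊤)
open import Data.Empty using (⊥; ⊥-elim)
open import Relation.Nullary using (¬_; Dec; yes; no; contradiction; does)
open import Relation.Nullary.Decidable using (¬¬-excluded-middle; decidable-stable; dec-true; dec-false; map′; _×-dec_; _⊎-dec_; _→-dec_; ¬?)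
open import Relation.Unary using (Decidable)
open import Relation.Binary.Definitions using (tri<; tri≈; tri>)
open import Relation.Binary.PropositionalEquality using (_≡_; _≢_; refl; sym; trans; cong; cong₂; subst; subst₂; ≢-sym; module ≡-Reasoning)

-- Everything takes place in one fixed graph: `W` is a predicate on its vertices and not a graph of
-- its own. A configuration found inside `W` is therefore forbidden in `G` at once, and only safety,
-- maximality and strength need versions relative to `W`. The purpose of the marker: the part of a
-- clique that lies in the rest need not be maximal there, so a strong set of the rest may miss it.
-- A stable set that contains cᵢ contains no hat of the clique and is thereby forced to meet it
-- inside the rest; leaving out cᵢ₊₁ is what makes the vertex set smaller. As the marker uses up the
-- one vertex that the induction hypothesis may prescribe, each such clique has a strong set of its
-- own, and the member of `Z` has yet another. Holes of length four and longer ones are separated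
-- because, off a shortest hole of length at least six, the neighbours of a vertex on the hole lie
-- close together, and this carries the whole argument; on a 4-hole it says nothing, hence the
-- detour through the complement.

private variable
  ℓ ℓ′ : Level
  X : Set ℓ
  Y : Set ℓ′

-- Classical reasoning under double negation, parity, and sizes of vertex sets.

infixl 1 _>>=_
_>>=_ : ¬ ¬ X → (X → ¬ ¬ Y) → ¬ ¬ Y
(m >>= f) k = m λ x → f x k

return : X → ¬ ¬ X
return x k = k x

lem : (X : Set ℓ) → ¬ ¬ Dec X
lem X = ¬¬-excluded-middle

run : ¬ ¬ ⊥ → ⊥
run f = f id

-- Double negation commutes with a finite conjunction. Applied to `lem` it makes a predicate on the
-- vertices decidable all at once.
finite-choice : ∀ {n} {P : Fin n → Set ℓ} → (∀ i → ¬ ¬ P i) → ¬ ¬ (∀ i → P i)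
finite-choice {n = zero}  f k = k λ ()
finite-choice {n = suc n} f = do
  p ← f fzero
  q ← finite-choice (f ∘ fsuc)
  return λ { fzero → p ; (fsuc i) → q i }

minimiser : {P : X → Set ℓ′} (μ : X → ℕ) {x : X} → P x → ¬ ¬ (∃[ y ] P y × (∀ {z} → P z → μ y ≤ μ z))
minimiser {X = X} {P = P} μ {x} = go (μ x) x ≤-refl
  where
  go : ∀ m x → μ x ≤ m → P x → ¬ ¬ (∃[ y ] P y × (∀ {z} → P z → μ y ≤ μ z))
  go m x le px = do
    yes (z , pz , lt) ← lem (∃[ z ] P z × μ z < μ x)
      where no none → return (x , px , λ {z} pz → ≮⇒≥ λ lt → none (z , pz , lt))
    go′ m z (<-≤-trans lt le) pz
    where
    go′ : ∀ m z → μ z < m → P z → ¬ ¬ (∃[ y ] P y × (∀ {z} → P z → μ y ≤ μ z))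
    go′ (suc m) z (s≤s le) pz = go m z le pz

-- A Boolean parity: a successor is a negation, so path lengths are compared with `cong not`.
even? : ℕ → Bool
even? zero    = true
even? (suc n) = not (even? n)

-- Only an upper bound, witnessed by a covering list. The list may contain vertices outside `W`, so
-- membership in `W` never has to be decided.
Size : ∀ {n} → (Fin n → Set) → ℕ → Set
Size W k = ∃[ l ] length l ≤ k × (∀ {v} → W v → v ∈ˡ l)

empty : ∀ {n} {W : Fin n → Set} {v} → Size W 0 → ¬ W v
empty ([] , _ , cov) wv with () ← cov wv

shrink : ∀ {n} {W W′ : Fin n → Set} {k u} → Size W (suc k) → (∀ {v} → W′ v → W v) → W u → ¬ W′ u → Size W′ k
shrink {W′ = W′} {k} {u} (l , le , cov) sub wu ¬w′u =
  l′ , s≤s⁻¹ (≤-trans (filter-notAll (λ v → ¬? (v ≟ u)) l (drop (cov wu))) le) , cov′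
  where
  l′ = filter (λ v → ¬? (v ≟ u)) l
  drop : ∀ {l} → u ∈ˡ l → Any (λ v → ¬ (v ≢ u)) l
  drop (here refl) = here λ ne → ne refl
  drop (there p)   = there (drop p)
  cov′ : ∀ {v} → W′ v → v ∈ˡ l′
  cov′ w′v = ∈-filter⁺ (λ v → ¬? (v ≟ u)) (cov (sub w′v)) λ { refl → ¬w′u w′v }

-- Induced paths, walks and cycles as lists of vertices.

module Paths {n : ℕ} (G : Graph n) where

  V : Set
  V = Fin n

  infix 4 _~_
  _~_ : V → V → Set
  _~_ = Adj G

  ~-sym : ∀ {x y} → x ~ y → y ~ x
  ~-sym {x} {y} = trans (Graph.adj-sym G y x)

  ~-irr : ∀ {x} → ¬ x ~ x
  ~-irr {x} p with () ← trans (sym p) (Graph.adj-irr G x)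

  ~⇒≢ : ∀ {x y} → x ~ y → x ≢ y
  ~⇒≢ p refl = ~-irr p

  _~?_ : ∀ x y → Dec (x ~ y)
  x ~? y = Graph.adj G x y Bool.≟ true

  Far : V → V → Set
  Far x y = x ≢ y × ¬ x ~ y

  Far-sym : ∀ {x y} → Far x y → Far y x
  Far-sym (p , q) = ≢-sym p , q ∘ ~-sym

  data InducedPath : List V → Set where
    single : ∀ {x} → InducedPath (x ∷ [])
    link   : ∀ {x y zs} → x ~ y → All (Far x) zs → InducedPath (y ∷ zs) → InducedPath (x ∷ y ∷ zs)

  lastOf : V → List V → V
  lastOf x []       = x
  lastOf x (y ∷ ys) = lastOf y ys

  last∈ : ∀ x ys → lastOf x ys ∈ˡ x ∷ ys
  last∈ x []       = here refl
  last∈ x (y ∷ ys) = there (last∈ y ys)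

  lastOf-++ : ∀ x ys z zs → lastOf x (ys ++ z ∷ zs) ≡ lastOf z zs
  lastOf-++ x []       z zs = refl
  lastOf-++ x (y ∷ ys) z zs = lastOf-++ y ys z zs

  record PathIn (U : V → Set) (u v : V) : Set where
    constructor mkPath
    field
      tail    : List V
      induced : InducedPath (u ∷ tail)
      inside  : All U (u ∷ tail)
      ends    : lastOf u tail ≡ v

  -- The vertex `u` joins the path at the last vertex that is equal or adjacent to it; whatever
  -- comes after is far from `u`, and whatever comes before is dropped.
  shortcut : ∀ {U : V → Set} {u y L} → U u → InducedPath (y ∷ L) → All U (y ∷ L) →
             Any (λ v → u ≡ v ⊎ u ~ v) (y ∷ L) → PathIn U u (lastOf y L)
  shortcut {u = u} {y} {L} uu ip us near with any? (λ v → u ≟ v ⊎-dec u ~? v) L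
  shortcut uu (link _ _ ip) (_ ∷ us) near | yes close = shortcut uu ip us close
  shortcut {u = u} {y} {L} uu ip us near | no far = stop near
    where
    all-far : All (Far u) L
    all-far = All.map (λ f → f ∘ inj₁ , f ∘ inj₂) (All.¬Any⇒All¬ L far)
    stop : Any (λ v → u ≡ v ⊎ u ~ v) (y ∷ L) → PathIn _ u (lastOf y L)
    stop (here (inj₁ refl)) = mkPath L ip us refl
    stop (here (inj₂ u~y))  = mkPath (y ∷ L) (link u~y all-far ip) (uu ∷ us) refl
    stop (there close)      = contradiction close far

  data Walk (U : V → Set) : V → V → Set where
    stay : ∀ {u} → U u → Walk U u u
    step : ∀ {u v w} → U u → u ~ v → Walk U v w → Walk U u w

  walk-start : ∀ {U u v} → Walk U u v → U u
  walk-start (stay uu)     = uu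
  walk-start (step uu _ _) = uu

  walk-end : ∀ {U u v} → Walk U u v → U v
  walk-end (stay uu)    = uu
  walk-end (step _ _ w) = walk-end w

  walk-trans : ∀ {U u v w} → Walk U u v → Walk U v w → Walk U u w
  walk-trans (stay _)      q = q
  walk-trans (step uu a p) q = step uu a (walk-trans p q)

  walk-snoc : ∀ {U u v w} → Walk U u v → v ~ w → U w → Walk U u w
  walk-snoc p a uw = walk-trans p (step (walk-end p) a (stay uw))

  walk-reverse : ∀ {U u v} → Walk U u v → Walk U v u
  walk-reverse (stay uu)     = stay uu
  walk-reverse (step uu a p) = walk-snoc (walk-reverse p) (~-sym a) uu

  walk-mono : ∀ {U U′ : V → Set} {u v} → (∀ {x} → U x → U′ x) → Walk U u v → Walk U′ u v
  walk-mono f (stay uu)     = stay (f uu)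
  walk-mono f (step uu a p) = step (f uu) a (walk-mono f p)

  -- Each vertex on the way is itself reachable. This makes the component `Walk U u` connected by
  -- walks that do not leave it.
  walk-within : ∀ {U u v} → Walk U u v → Walk (Walk U u) u v
  walk-within p = go (stay (walk-start p)) p
    where
    go : ∀ {U u v w} → Walk U u v → Walk U v w → Walk (Walk U u) v w
    go p (stay _)     = stay p
    go p (step _ a q) = step p a (go (walk-snoc p a (walk-start q)) q)

  walk⇒path : ∀ {U u v} → Walk U u v → PathIn U u v
  walk⇒path (stay uu) = mkPath [] single (uu ∷ []) refl
  walk⇒path (step uu a p) with walk⇒path p
  ... | mkPath ps ip us refl = shortcut uu ip us (here (inj₂ a))

  tail-far : ∀ {x ys v} → InducedPath (x ∷ ys) → v ∈ˡ ys → x ≢ v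
  tail-far (link a _ _)  (here refl) = ~⇒≢ a
  tail-far (link _ fs _) (there m)   = proj₁ (All.lookup fs m)

  first-nbr : ∀ {x y ys v} → InducedPath (x ∷ y ∷ ys) → v ∈ˡ x ∷ y ∷ ys → x ~ v → v ≡ y
  first-nbr _             (here refl)         a = ⊥-elim (~-irr a)
  first-nbr _             (there (here refl)) _ = refl
  first-nbr (link _ fs _) (there (there m))   a = ⊥-elim (proj₂ (All.lookup fs m) a)

  first-nbr-unique : ∀ {x ys v w} → InducedPath (x ∷ ys) → v ∈ˡ x ∷ ys → w ∈ˡ x ∷ ys → x ~ v → x ~ w → v ≡ w
  first-nbr-unique {ys = []}    _  (here refl) _ a _ = ⊥-elim (~-irr a)
  first-nbr-unique {ys = _ ∷ _} ip m m′ a b = trans (first-nbr ip m a) (sym (first-nbr ip m′ b))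

  last-nbr-unique : ∀ {x ys v w} → InducedPath (x ∷ ys) → v ∈ˡ x ∷ ys → w ∈ˡ x ∷ ys →
                    lastOf x ys ~ v → lastOf x ys ~ w → v ≡ w
  last-nbr-unique single (here refl) _ a _ = ⊥-elim (~-irr a)
  last-nbr-unique (link _ _ _)  (here refl) (here refl) _ _ = refl
  last-nbr-unique (link _ _ ip) (there m) (there m′) a b = last-nbr-unique ip m m′ a b
  last-nbr-unique (link x~y fs single) (here refl) (there (here refl)) _ b = ⊥-elim (~-irr b)
  last-nbr-unique (link x~y fs (link {zs = zs} _ _ _)) (here refl) (there _) a _ =
    ⊥-elim (proj₂ (All.lookup fs (last∈ _ zs)) (~-sym a))
  last-nbr-unique (link x~y fs single) (there (here refl)) (here refl) a _ = ⊥-elim (~-irr a)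
  last-nbr-unique (link x~y fs (link {zs = zs} _ _ _)) (there _) (here refl) _ b =
    ⊥-elim (proj₂ (All.lookup fs (last∈ _ zs)) (~-sym b))

  append : ∀ {x xs y ys} → InducedPath (x ∷ xs) → InducedPath (y ∷ ys) → lastOf x xs ~ y →
           (∀ {v w} → v ∈ˡ x ∷ xs → w ∈ˡ y ∷ ys → v ≢ w × (v ~ w → v ≡ lastOf x xs × w ≡ y)) →
           InducedPath (x ∷ xs ++ y ∷ ys)
  append {x} {[]} {y} {ys} single ip a cross =
    link a (All.tabulate λ m → proj₁ (cross (here refl) (there m)) ,
            λ e → tail-far ip m (sym (proj₂ (proj₂ (cross (here refl) (there m)) e)))) ip
  append {x} {x′ ∷ xs} {y} {ys} (link b fs ip′) ip a cross =
    link b (All.++⁺ fs (All.tabulate λ m → proj₁ (cross (here refl) m) ,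
            λ e → tail-far (link b fs ip′) (last∈ x′ xs) (proj₁ (proj₂ (cross (here refl) m) e))))
         (append ip′ ip a (cross ∘ there))

  snoc : ∀ {x xs y} → InducedPath (x ∷ xs) → lastOf x xs ~ y →
         (∀ {v} → v ∈ˡ x ∷ xs → v ≢ y × (v ~ y → v ≡ lastOf x xs)) → InducedPath (x ∷ xs ++ y ∷ [])
  snoc ip a cross = append ip single a λ { m (here refl) → proj₁ (cross m) , λ e → proj₂ (cross m) e , refl }

  lookup-injective : ∀ {L} → InducedPath L → ∀ i j → lookup L i ≡ lookup L j → i ≡ j
  lookup-injective single        fzero    fzero    _ = refl
  lookup-injective (link _ _ _)  fzero    fzero    _ = refl
  lookup-injective (link a fs p) fzero (fsuc j) e = ⊥-elim (tail-far (link a fs p) (∈-lookup j) e)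
  lookup-injective (link a fs p) (fsuc i) fzero e = ⊥-elim (tail-far (link a fs p) (∈-lookup i) (sym e))
  lookup-injective (link _ _ p) (fsuc i) (fsuc j) e = cong fsuc (lookup-injective p i j e)

  Consecutive : ℕ → ℕ → Set
  Consecutive i j = j ≡ suc i ⊎ i ≡ suc j

  lookup-adj : ∀ {L} → InducedPath L → ∀ i j → (lookup L i ~ lookup L j) iff Consecutive (toℕ i) (toℕ j)
  lookup-adj ip i j = to ip i j , from ip i j
    where
    to : ∀ {L} → InducedPath L → ∀ i j → lookup L i ~ lookup L j → Consecutive (toℕ i) (toℕ j)
    to single fzero fzero e = ⊥-elim (~-irr e)
    to (link _ _ _) fzero fzero e = ⊥-elim (~-irr e)
    to (link _ _ _) fzero (fsuc fzero) e = inj₁ refl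
    to (link _ fs _) fzero (fsuc (fsuc j)) e = ⊥-elim (proj₂ (All.lookup fs (∈-lookup j)) e)
    to (link _ _ _) (fsuc fzero) fzero e = inj₂ refl
    to (link _ fs _) (fsuc (fsuc i)) fzero e = ⊥-elim (proj₂ (All.lookup fs (∈-lookup i)) (~-sym e))
    to (link _ _ p) (fsuc i) (fsuc j) e with to p i j e
    ... | inj₁ q = inj₁ (cong suc q)
    ... | inj₂ q = inj₂ (cong suc q)
    from : ∀ {L} → InducedPath L → ∀ i j → Consecutive (toℕ i) (toℕ j) → lookup L i ~ lookup L j
    from (link a _ _) fzero (fsuc fzero) _ = a
    from (link a _ _) (fsuc fzero) fzero _ = ~-sym a
    from (link _ _ p) (fsuc i) (fsuc j) (inj₁ q) = from p i j (inj₁ (suc-injective q))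
    from (link _ _ p) (fsuc i) (fsuc j) (inj₂ q) = from p i j (inj₂ (suc-injective q))
    from (link _ _ _) fzero fzero (inj₁ ())
    from (link _ _ _) fzero fzero (inj₂ ())
    from (link _ _ _) fzero (fsuc (fsuc j)) (inj₁ ())
    from (link _ _ _) fzero (fsuc (fsuc j)) (inj₂ ())
    from (link _ _ _) (fsuc (fsuc i)) fzero (inj₁ ())
    from (link _ _ _) (fsuc (fsuc i)) fzero (inj₂ ())
    from single fzero fzero (inj₁ ())
    from single fzero fzero (inj₂ ())

  toPath : ∀ {x ps} → InducedPath (x ∷ ps) → Path G
  toPath {x} {ps} ip = record
    { len = length ps ; vtx = lookup (x ∷ ps) ; inj = λ {i} {j} → lookup-injective ip i j ; adjP = lookup-adj ip }

  toPath-last : ∀ {x ps} (ip : InducedPath (x ∷ ps)) → last G (toPath ip) ≡ lastOf x ps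
  toPath-last {x} {ps} _ = go x ps
    where
    go : ∀ x ps → lookup (x ∷ ps) (fromℕ (length ps)) ≡ lastOf x ps
    go x []       = refl
    go x (y ∷ ps) = go y ps

  toPath-∈ : ∀ {x ps v} (ip : InducedPath (x ∷ ps)) → (_∈P_ G v (toPath ip)) → v ∈ˡ x ∷ ps
  toPath-∈ {x} {ps} ip (i , refl) = ∈-lookup {xs = x ∷ ps} i

  -- A hole cut open at `hub`. Its length is `2 + length rest`, so `rest` has the parity of the
  -- hole.
  record Cycle : Set where
    field
      hub     : V
      start   : V
      rest    : List V
      path    : InducedPath (start ∷ rest)
      long    : 2 ≤ length rest
      closeˡ  : hub ~ start
      closeʳ  : hub ~ lastOf start rest
      avoid   : ∀ {v} → v ∈ˡ start ∷ rest → hub ≢ v × (hub ~ v → v ≡ start ⊎ v ≡ lastOf start rest)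

  module _ (C : Cycle) where
    open Cycle C

    cycle-hole : Hole G
    cycle-hole = record
      { len = 2 + length rest ; len≥4 = s≤s (s≤s long) ; vtx = lookup (hub ∷ start ∷ rest)
      ; inj = λ {i} {j} → inj i j ; adjH = λ i j → to i j , from i j }
      where
      inj : ∀ i j → lookup (hub ∷ start ∷ rest) i ≡ lookup (hub ∷ start ∷ rest) j → i ≡ j
      inj fzero    fzero    _ = refl
      inj fzero    (fsuc j) e = ⊥-elim (proj₁ (avoid (∈-lookup {xs = start ∷ rest} j)) e)
      inj (fsuc i) fzero    e = ⊥-elim (proj₁ (avoid (∈-lookup {xs = start ∷ rest} i)) (sym e))
      inj (fsuc i) (fsuc j) e = cong fsuc (lookup-injective path i j e)
      m = 2 + length rest
      last-lookup : ∀ x ps (j : Fin (suc (length ps))) → toℕ j ≡ length ps → lookup (x ∷ ps) j ≡ lastOf x ps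
      last-lookup x []       fzero    _ = refl
      last-lookup x (y ∷ ps) (fsuc j) e = last-lookup y ps j (suc-injective e)
      lookup-last : ∀ {x ps} → InducedPath (x ∷ ps) → (j : Fin (suc (length ps))) → lookup (x ∷ ps) j ≡ lastOf x ps → toℕ j ≡ length ps
      lookup-last {x} {ps} ip j e =
        trans (cong toℕ (lookup-injective ip j (fromℕ (length ps)) (trans e (sym (last-lookup x ps _ (Fin.toℕ-fromℕ _)))))) (Fin.toℕ-fromℕ _)
      hub-to : ∀ j → hub ~ lookup (start ∷ rest) j → toℕ j ≡ 0 ⊎ toℕ j ≡ length rest
      hub-to j e with proj₂ (avoid (∈-lookup {xs = start ∷ rest} j)) e
      ... | inj₁ q = inj₁ (cong toℕ (lookup-injective path j fzero q))
      ... | inj₂ q = inj₂ (lookup-last path j q)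
      hub-from : ∀ j → toℕ j ≡ 0 ⊎ toℕ j ≡ length rest → hub ~ lookup (start ∷ rest) j
      hub-from fzero    _        = closeˡ
      hub-from (fsuc j) (inj₂ e) = subst (hub ~_) (sym (last-lookup start rest (fsuc j) e)) closeʳ
      to : ∀ i j → lookup (hub ∷ start ∷ rest) i ~ lookup (hub ∷ start ∷ rest) j → CycAdj G m i j
      to fzero fzero e = ⊥-elim (~-irr e)
      to fzero (fsuc j) e with hub-to j e
      ... | inj₁ q = inj₁ (cong suc q)
      ... | inj₂ q = inj₂ (inj₂ (inj₁ (refl , cong (2 +_) q)))
      to (fsuc i) fzero e with hub-to i (~-sym e)
      ... | inj₁ q = inj₂ (inj₁ (cong suc q))
      ... | inj₂ q = inj₂ (inj₂ (inj₂ (refl , cong (2 +_) q)))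
      to (fsuc i) (fsuc j) e with proj₁ (lookup-adj path i j) e
      ... | inj₁ q = inj₁ (cong suc q)
      ... | inj₂ q = inj₂ (inj₁ (cong suc q))
      from : ∀ i j → CycAdj G m i j → lookup (hub ∷ start ∷ rest) i ~ lookup (hub ∷ start ∷ rest) j
      from fzero (fsuc j) (inj₁ q) = hub-from j (inj₁ (suc-injective q))
      from fzero (fsuc j) (inj₂ (inj₂ (inj₁ (_ , q)))) = hub-from j (inj₂ (suc-injective (suc-injective q)))
      from (fsuc i) fzero (inj₂ (inj₁ q)) = ~-sym (hub-from i (inj₁ (suc-injective q)))
      from (fsuc i) fzero (inj₂ (inj₂ (inj₂ (_ , q)))) = ~-sym (hub-from i (inj₂ (suc-injective (suc-injective q))))
      from (fsuc i) (fsuc j) (inj₁ q) = proj₂ (lookup-adj path i j) (inj₁ (suc-injective q))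
      from (fsuc i) (fsuc j) (inj₂ (inj₁ q)) = proj₂ (lookup-adj path i j) (inj₂ (suc-injective q))
      from (fsuc i) (fsuc j) (inj₂ (inj₂ (inj₁ ())))
      from (fsuc i) (fsuc j) (inj₂ (inj₂ (inj₂ ())))
      from fzero fzero (inj₁ ())
      from fzero fzero (inj₂ (inj₁ ()))
      from fzero fzero (inj₂ (inj₂ (inj₁ ())))
      from fzero fzero (inj₂ (inj₂ (inj₂ ())))

    cycle-∈ : ∀ {v} → _∈H_ G v cycle-hole → v ∈ˡ hub ∷ start ∷ rest
    cycle-∈ (i , refl) = ∈-lookup {xs = hub ∷ start ∷ rest} i

-- Strong stable sets and the exchange of components.

module StableSets {n : ℕ} (G : Graph n) where
  open Paths G

  IsClique : (V → Set) → Set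
  IsClique K = ∀ {u v} → K u → K v → u ≢ v → u ~ v

  record MaxClique (U K : V → Set) : Set where
    field
      within   : ∀ {v} → K v → U v
      clique   : IsClique K
      nonempty : ∃[ v ] K v
      maximal  : ∀ {u} → U u → (∀ {v} → K v → v ≢ u → u ~ v) → K u

  Meets : (V → Set) → (V → Set) → Set
  Meets S K = ¬ ¬ (∃[ v ] S v × K v)

  record Strong (U S : V → Set) : Set₁ where
    field
      within : ∀ {v} → S v → U v
      stable : ∀ {u v} → S u → S v → ¬ u ~ v
      hits   : ∀ {K} → MaxClique U K → Meets S K

  -- The obstruction to an exchange. That the ends are the only vertices in `K` and `K′` is recorded
  -- because it keeps the path induced when it is later prolonged through the two cliques.
  record OddLink (U K K′ : V → Set) : Set where
    field
      {u v} : V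
      path  : PathIn U u v
      odd   : even? (length (PathIn.tail path)) ≡ false
      source : K u
      target : K′ v
      only-source : ∀ {w} → w ∈ˡ u ∷ PathIn.tail path → K w → w ≡ u
      only-target : ∀ {w} → w ∈ˡ u ∷ PathIn.tail path → K′ w → w ≡ v

  -- Swapping S and T on a connected component of S ∪ T keeps every clique that both
  -- of them meet, because the two witnesses are equal or adjacent.
  module _ {U S T K : V → Set} (σ : Strong U S) (τ : Strong U T) (K-clique : IsClique K) where
    private
      module σ = Strong σ
      module τ = Strong τ

      Union : V → Set
      Union v = S v ⊎ T v

      Union⊆U : ∀ {v} → Union v → U v
      Union⊆U = [ σ.within , τ.within ]′

      -- Neither `S` nor `T` contains an edge, so a path in their union alternates between them, and
      -- its parity can be read off its two ends.
      alternateT : ∀ {x ps} → InducedPath (x ∷ ps) → All Union (x ∷ ps) → T x → ¬ T (lastOf x ps) → even? (length ps) ≡ false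
      alternateS : ∀ {x ps} → InducedPath (x ∷ ps) → All Union (x ∷ ps) → S x → ¬ T (lastOf x ps) → even? (length ps) ≡ true
      alternateT {ps = []} _ _ tx ¬t = contradiction tx ¬t
      alternateT {ps = _ ∷ _} (link a _ ip) (_ ∷ us@(inj₁ sy ∷ _)) tx ¬t = cong not (alternateS ip us sy ¬t)
      alternateT {ps = _ ∷ _} (link a _ ip) (_ ∷ inj₂ ty ∷ _) tx ¬t = ⊥-elim (τ.stable tx ty a)
      alternateS {ps = []} _ _ _ _ = refl
      alternateS {ps = _ ∷ _} (link a _ ip) (_ ∷ us@(inj₂ ty ∷ _)) sx ¬t = cong not (alternateT ip us ty ¬t)
      alternateS {ps = _ ∷ _} (link a _ ip) (_ ∷ inj₁ sy ∷ _) sx ¬t = ⊥-elim (σ.stable sx sy a)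

    exchange : Meets T K → ¬ ¬ (∃[ S′ ] Strong U S′ × Meets S′ K ×
               (∀ {K′} → IsClique K′ → Meets S K′ → ¬ OddLink U K K′ → Meets S′ K′))
    exchange mt = do
      no missed ← lem (∃[ v ] S v × K v)
        where yes hit → return (S , σ , return hit , λ {_} _ m _ → m)
      t , tt , kt ← mt
      let C = Walk Union t
          S′ = λ v → (S v × ¬ C v) ⊎ (T v × C v)
          both-hit : ∀ {K′ : V → Set} → IsClique K′ → Meets S K′ → Meets T K′ → Meets S′ K′
          both-hit K′-clique ms mt = do
            s , ss , ks ← ms
            t′ , tt′ , kt′ ← mt
            yes cs ← lem (C s)
              where no ¬cs → return (s , inj₁ (ss , ¬cs) , ks)
            no ¬ct ← lem (C t′)
              where yes ct → return (t′ , inj₂ (tt′ , ct) , kt′)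
            yes refl ← lem (s ≡ t′)
              where no s≢t′ → contradiction (walk-snoc cs (K′-clique ks kt′ s≢t′) (inj₂ tt′)) ¬ct
            contradiction cs ¬ct
          stable′ : ∀ {u v} → S′ u → S′ v → ¬ u ~ v
          stable′ = λ
            { (inj₁ (su , _))  (inj₁ (sv , _))  a → σ.stable su sv a
            ; (inj₂ (tu , _))  (inj₂ (tv , _))  a → τ.stable tu tv a
            ; (inj₁ (su , ¬c)) (inj₂ (tv , c))  a → ¬c (walk-snoc c (~-sym a) (inj₁ su))
            ; (inj₂ (tu , c))  (inj₁ (sv , ¬c)) a → ¬c (walk-snoc c a (inj₁ sv)) }
      return (S′
        , record
          { within = λ { (inj₁ (s , _)) → σ.within s ; (inj₂ (t , _)) → τ.within t }
          ; stable = stable′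
          ; hits = λ mc → both-hit (MaxClique.clique mc) (σ.hits mc) (τ.hits mc) }
        , return (t , inj₂ (tt , stay (inj₂ tt)) , kt)
        , λ {K′} K′-clique ms unlinked → do
            s , ss , ks ← ms
            no T-misses ← lem (∃[ v ] T v × K′ v)
              where yes hit → both-hit K′-clique ms (return hit)
            yes cs ← lem (C s)
              where no ¬cs → return (s , inj₁ (ss , ¬cs) , ks)
            -- `T` misses `K′` and the `S`-vertex `s` of `K′` is in the component of `t`: the swap
            -- would lose `K′`. A shortest connection from `t ∈ T` to `s ∉ T` then alternates and is
            -- odd.
            let path = walk⇒path cs
                open PathIn path
            ⊥-elim (unlinked record
              { path = record { tail = tail ; induced = induced ; inside = All.map Union⊆U inside ; ends = ends }
              ; odd = alternateT induced inside tt (λ ts → T-misses (s , subst T ends ts , ks))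
              ; source = kt
              ; target = ks
              ; only-source = λ {w} m kw → [ (λ sw → contradiction (w , sw , kw) missed)
                                   , (λ tw → decidable-stable (w ≟ t) λ ne → τ.stable tw tt (K-clique kw kt ne)) ]′ (All.lookup inside m)
              ; only-target = λ {w} m kw → [ (λ sw → decidable-stable (w ≟ s) λ ne → σ.stable sw ss (K′-clique kw ks ne))
                                   , (λ tw → contradiction (w , tw , kw) T-misses) ]′ (All.lookup inside m)
              }))

  -- Each target brings its own strong set, and the exchange with it keeps the earlier targets, as
  -- no odd link joins two of them. Entries that are not targets are skipped, so the list can be a
  -- plain enumeration.
  multi-exchange : {A : Set} {U : V → Set} (Target : A → Set) (K : A → V → Set) →
    (∀ {a} → Target a → IsClique (K a)) →
    (∀ {a b} → Target a → Target b → ¬ OddLink U (K a) (K b)) →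
    ∃[ S ] Strong U S → (∀ {a} → Target a → ¬ ¬ (∃[ S ] Strong U S × Meets S (K a))) →
    (as : List A) → ¬ ¬ (∃[ S ] Strong U S × (∀ {a} → a ∈ˡ as → Target a → Meets S (K a)))
  multi-exchange Target K cl unlinked (S , σ) each [] = return (S , σ , λ ())
  multi-exchange Target K cl unlinked base each (a ∷ as) = do
    S , σ , hit ← multi-exchange Target K cl unlinked base each as
    yes ta ← lem (Target a)
      where no ¬ta → return (S , σ , λ { (here refl) ta → contradiction ta ¬ta ; (there m) tb → hit m tb })
    T , τ , meet ← each ta
    S′ , σ′ , meet′ , keep ← exchange σ τ (cl ta) meet
    return (S′ , σ′ , λ { (here refl) _ → meet′ ; (there m) tb → keep (cl tb) (hit m tb) (unlinked ta tb) })

-- Parity of sums and divisibility by two.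

even?-+ : ∀ m n → even? m ≡ true → even? (m + n) ≡ even? n
even?-+ zero          n _ = refl
even?-+ (suc (suc m)) n e =
  trans (Bool.not-involutive _) (even?-+ m n (trans (sym (Bool.not-involutive _)) e))

even?-+-odd : ∀ m n → even? m ≡ false → even? (m + n) ≡ not (even? n)
even?-+-odd (suc m) n e = cong not (even?-+ m n (Bool.not-injective e))

even?-* : ∀ q m → even? m ≡ true → even? (q * m) ≡ true
even?-* zero    m e = refl
even?-* (suc q) m e = trans (even?-+ m (q * m) e) (even?-* q m e)

even⇒2∣ : ∀ k → even? k ≡ true → 2 ∣ k
even⇒2∣ zero _ = divides 0 refl
even⇒2∣ (suc (suc k)) e with even⇒2∣ k (trans (sym (Bool.not-involutive _)) e)
... | divides q eq = divides (suc q) (cong (2 +_) eq)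

2∣⇒even : ∀ k → 2 ∣ k → even? k ≡ true
2∣⇒even k (divides q refl) = even?-* q 2 refl

¬even⇒odd : ∀ {k} → ¬ even? k ≡ true → even? k ≡ false
¬even⇒odd = Bool.¬-not

odd⇒¬2∣ : ∀ k → even? k ≡ false → ¬ (2 ∣ k)
odd⇒¬2∣ k e d with () ← trans (sym e) (2∣⇒even k d)

-- Holes as periodic sequences, with their arcs.

module Rings {n : ℕ} (G : Graph n) where
  open Paths G

  -- A hole as a periodic sequence, so that every vertex can serve as the origin.
  record Ring : Set where
    field
      size     : ℕ
      size≥4   : 4 ≤ size
      c        : ℕ → V
      periodic : ∀ i → c (size + i) ≡ c i
      next     : ∀ i → c i ~ c (suc i)
      distinct : ∀ k i → 1 ≤ k → k < size → c i ≢ c (k + i)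
      chordless : ∀ k i → 2 ≤ k → 2 + k ≤ size → ¬ c i ~ c (k + i)

  module RingProperties (R : Ring) where
    open Ring R public

    On : V → Set
    On v = ∃[ i ] v ≡ c i

    periodic* : ∀ q i → c (q * size + i) ≡ c i
    periodic* zero    i = refl
    periodic* (suc q) i =
      trans (cong c (+-assoc size (q * size) i)) (trans (periodic (q * size + i)) (periodic* q i))

    private
      pred-size = size ∸ 1
      size≡ : size ≡ suc pred-size
      size≡ = sym (m+[n∸m]≡n (≤-trans (s≤s z≤n) size≥4))
      instance size-nonZero : NonZero size
      size-nonZero = >-nonZero (≤-trans (s≤s z≤n) size≥4)

    reindex : ∀ i j → ∃[ d ] d < size × (∀ m → c (m + j) ≡ c (m + (d + i))) ×
              (even? size ≡ true → even? (d + i) ≡ even? j)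
    reindex i j = d , m%n<n x size , eq , parity
      where
      -- `pred-size * i` stands for `- i` modulo `size`, so `d` is the number of steps from `c i`
      -- forward to `c j`.
      x = j + pred-size * i
      d = x % size
      q = x / size
      balance : q * size + (d + i) ≡ i * size + j
      balance = begin
        q * size + (d + i)     ≡⟨ +-comm (q * size) (d + i) ⟩
        d + i + q * size       ≡⟨ +-assoc d i _ ⟩
        d + (i + q * size)     ≡⟨ cong (d +_) (+-comm i _) ⟩
        d + (q * size + i)     ≡⟨ sym (+-assoc d _ i) ⟩
        d + q * size + i       ≡⟨ cong (_+ i) (sym (m≡m%n+[m/n]*n x size)) ⟩
        j + pred-size * i + i  ≡⟨ lemma j pred-size i ⟩
        i * suc pred-size + j  ≡⟨ cong (λ s → i * s + j) (sym size≡) ⟩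
        i * size + j           ∎
        where
        open ≡-Reasoning
        lemma : ∀ j p i → j + p * i + i ≡ i * suc p + j
        lemma = solve-∀
      shuffle : ∀ a m y → a + (m + y) ≡ m + (a + y)
      shuffle = solve-∀
      eq : ∀ m → c (m + j) ≡ c (m + (d + i))
      eq m = begin
        c (m + j)                     ≡⟨ sym (periodic* i (m + j)) ⟩
        c (i * size + (m + j))        ≡⟨ cong c (shuffle (i * size) m j) ⟩
        c (m + (i * size + j))        ≡⟨ cong (c ∘ (m +_)) (sym balance) ⟩
        c (m + (q * size + (d + i)))  ≡⟨ cong c (sym (shuffle (q * size) m (d + i))) ⟩
        c (q * size + (m + (d + i)))  ≡⟨ periodic* q _ ⟩
        c (m + (d + i))               ∎
        where open ≡-Reasoning
      parity : even? size ≡ true → even? (d + i) ≡ even? j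
      parity e = begin
        even? (d + i)               ≡⟨ sym (even?-+ (q * size) _ (even?-* q size e)) ⟩
        even? (q * size + (d + i))  ≡⟨ cong even? balance ⟩
        even? (i * size + j)        ≡⟨ even?-+ (i * size) _ (even?-* i size e) ⟩
        even? j                     ∎
        where open ≡-Reasoning

    same-index : ∀ {i j} → c j ≡ c i → ∀ m → c (m + j) ≡ c (m + i)
    same-index {i} {j} e m with reindex i j
    ... | zero  , _ , eq , _ = eq m
    ... | suc d , lt , eq , _ = ⊥-elim (distinct (suc d) i (s≤s z≤n) lt (trans (sym e) (eq 0)))

    apart : ∀ k i → 2 ≤ k → 2 + k ≤ size → Far (c i) (c (k + i))
    apart k i lo hi = distinct k i (≤-trans (s≤s z≤n) lo) (≤-trans (n≤1+n _) hi) , chordless k i lo hi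

    apart₂ : ∀ i → Far (c i) (c (2 + i))
    apart₂ i = apart 2 i ≤-refl size≥4

    gap : ∀ k i → k < size → c i ~ c (k + i) → k ≡ 1 ⊎ suc k ≡ size
    gap zero          i lt a = ⊥-elim (~-irr a)
    gap (suc zero)    i lt a = inj₁ refl
    gap (suc (suc k)) i lt a with m≤n⇒m<n∨m≡n lt
    ... | inj₁ lt′ = ⊥-elim (chordless (2 + k) i (s≤s (s≤s z≤n)) lt′ a)
    ... | inj₂ eq  = inj₂ eq

    prev : ∀ i → c i ~ c (pred-size + i)
    prev i = ~-sym (subst (c (pred-size + i) ~_) (trans (cong (λ s → c (s + i)) (sym size≡)) (periodic i)) (next (pred-size + i)))

    prev-next : ∀ i → c (suc (pred-size + i)) ≡ c i
    prev-next i = trans (cong (λ s → c (s + i)) (sym size≡)) (periodic i)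

    parity-adj : even? size ≡ true → ∀ {i j} → c i ~ c j → even? i ≢ even? j
    parity-adj e {i} {j} a p with reindex i j
    ... | d , lt , eq , par with gap d i lt (subst (c i ~_) (eq 0) a)
    ... | inj₁ refl = Bool.not-¬ {even? i} refl (trans p (sym (par e)))
    ... | inj₂ sd   = Bool.not-¬ {even? i} refl (trans p (trans (sym (par e)) (even?-+-odd d i (Bool.not-injective (trans (cong even? sd) e)))))

    no-triangle : ∀ i k → ¬ (c k ~ c i × c k ~ c (suc i))
    no-triangle i k (a , b) with reindex i k
    ... | d , lt , eq , _ with gap d i lt (~-sym (subst (_~ c i) (eq 0) a))
    ... | inj₁ refl = ~-irr (subst (_~ c (suc i)) (eq 0) b)
    ... | inj₂ sd = far d sd (eq 0)
      where
      far : ∀ d → suc d ≡ size → c k ≡ c (d + i) → ⊥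
      far zero    sd _ = contradiction (subst (4 ≤_) (sym sd) size≥4) λ { (s≤s ()) }
      far (suc d) sd e = chordless d (suc i) (s≤s⁻¹ (s≤s⁻¹ (subst (4 ≤_) (sym sd) size≥4))) (≤-reflexive sd)
                           (subst (c (suc i) ~_) (trans e (cong c (sym (+-suc d i)))) (~-sym b))

    -- The arc from `c a` up to `c (k + a)` without its first vertex, to fit the shape
    -- `InducedPath (x ∷ ps)`. `downTail` is the same for the arc run through backwards.
    upTail : ℕ → ℕ → List V
    upTail a zero    = []
    upTail a (suc k) = c (suc a) ∷ upTail (suc a) k

    upTail-∈ : ∀ a k {v} → v ∈ˡ upTail a k → ∃[ j ] 1 ≤ j × j ≤ k × v ≡ c (j + a)
    upTail-∈ a (suc k) (here refl) = 1 , s≤s z≤n , s≤s z≤n , refl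
    upTail-∈ a (suc k) (there m) with upTail-∈ (suc a) k m
    ... | j , lo , hi , refl = suc j , s≤s z≤n , s≤s hi , cong c (+-suc j a)

    up-∈ : ∀ a k {v} → v ∈ˡ c a ∷ upTail a k → ∃[ j ] j ≤ k × v ≡ c (j + a)
    up-∈ a k (here refl) = 0 , z≤n , refl
    up-∈ a k (there m) with upTail-∈ a k m
    ... | j , _ , hi , e = j , hi , e

    up-path : ∀ a k → 2 + k ≤ size → InducedPath (c a ∷ upTail a k)
    up-path a zero    _  = single
    up-path a (suc k) le = link (next a) (All.tabulate far) (up-path (suc a) k (≤-trans (n≤1+n _) le))
      where
      far : ∀ {v} → v ∈ˡ upTail (suc a) k → Far (c a) v
      far m with upTail-∈ (suc a) k m
      ... | j , lo , hi , refl =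
        (λ e → distinct (suc j) a (s≤s z≤n) (≤-trans (s≤s (s≤s hi)) (≤-trans (n≤1+n _) le)) (trans e (cong c (+-suc j a)))) ,
        (λ e → chordless (suc j) a (s≤s lo) (≤-trans (s≤s (s≤s (s≤s hi))) le) (subst (c a ~_) (cong c (+-suc j a)) e))

    up-last : ∀ a k → lastOf (c a) (upTail a k) ≡ c (k + a)
    up-last a zero    = refl
    up-last a (suc k) = trans (up-last (suc a) k) (cong c (+-suc k a))

    up-length : ∀ a k → length (upTail a k) ≡ k
    up-length a zero    = refl
    up-length a (suc k) = cong suc (up-length (suc a) k)

    downTail : ℕ → ℕ → List V
    downTail a zero    = []
    downTail a (suc k) = c (k + a) ∷ downTail a k

    downTail-∈ : ∀ a k {v} → v ∈ˡ downTail a k → ∃[ j ] j < k × v ≡ c (j + a)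
    downTail-∈ a (suc k) (here refl) = k , ≤-refl , refl
    downTail-∈ a (suc k) (there m) with downTail-∈ a k m
    ... | j , lt , e = j , m≤n⇒m≤1+n lt , e

    down-∈ : ∀ a k {v} → v ∈ˡ c (k + a) ∷ downTail a k → ∃[ j ] j ≤ k × v ≡ c (j + a)
    down-∈ a k (here refl) = k , ≤-refl , refl
    down-∈ a k (there m) with downTail-∈ a k m
    ... | j , lt , e = j , <⇒≤ lt , e

    down-path : ∀ a k → 2 + k ≤ size → InducedPath (c (k + a) ∷ downTail a k)
    down-path a zero    _  = single
    down-path a (suc k) le = link (~-sym (next (k + a))) (All.tabulate far) (down-path a k (≤-trans (n≤1+n _) le))
      where
      far : ∀ {v} → v ∈ˡ downTail a k → Far (c (suc k + a)) v
      far m with downTail-∈ a k m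
      ... | j , lt , refl =
        (λ e → distinct d (j + a) (≤-trans (s≤s z≤n) two) (≤-trans (s≤s d≤) (≤-trans (n≤1+n _) le)) (trans (sym e) ix)) ,
        (λ e → chordless d (j + a) two (≤-trans (s≤s (s≤s d≤)) le) (subst (c (j + a) ~_) ix (~-sym e)))
        where
        d = suc k ∸ j
        d≤ : d ≤ suc k
        d≤ = m∸n≤m (suc k) j
        two : 2 ≤ d
        two = m+n≤o⇒m≤o∸n 2 (s≤s lt)
        ix : c (suc k + a) ≡ c (d + (j + a))
        ix = cong c (sym (trans (sym (+-assoc d j a)) (cong (_+ a) (m∸n+n≡m (m≤n⇒m≤1+n (<⇒≤ lt))))))

    down-last : ∀ a k → lastOf (c (k + a)) (downTail a k) ≡ c a
    down-last a zero    = refl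
    down-last a (suc k) = down-last a k

    down-length : ∀ a k → length (downTail a k) ≡ k
    down-length a zero    = refl
    down-length a (suc k) = cong suc (down-length a k)

    -- The origin is a parameter because the hat of a clown has to see the vertices numbered 0 and 1
    -- of its hole.
    toHole : ℕ → Hole G
    toHole a = record
      { len = size ; len≥4 = size≥4 ; vtx = λ i → c (toℕ i + a)
      ; inj = λ {i} {j} → inj i j ; adjH = λ i j → to i j , from i j }
      where
      split : ∀ {i j} → i ≤ j → j + a ≡ (j ∸ i) + (i + a)
      split {i} {j} le = sym (trans (sym (+-assoc (j ∸ i) i a)) (cong (_+ a) (m∸n+n≡m le)))
      differ : ∀ {i j} → i < j → j < size → c (i + a) ≢ c (j + a)
      differ {i} {j} lt hi e = distinct (j ∸ i) (i + a) (m<n⇒0<n∸m lt) (≤-<-trans (m∸n≤m j i) hi)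
                                 (trans e (cong c (split (<⇒≤ lt))))
      inj : ∀ (i j : Fin size) → c (toℕ i + a) ≡ c (toℕ j + a) → i ≡ j
      inj i j e with <-cmp (toℕ i) (toℕ j)
      ... | tri< lt _ _ = ⊥-elim (differ lt (Fin.toℕ<n j) e)
      ... | tri≈ _ eq _ = Fin.toℕ-injective eq
      ... | tri> _ _ gt = ⊥-elim (differ gt (Fin.toℕ<n i) (sym e))
      ordered : ∀ {i j} → i < j → j < size → c (i + a) ~ c (j + a) → j ≡ suc i ⊎ (i ≡ 0 × suc j ≡ size)
      ordered {i} {j} lt hi e
        with gap (j ∸ i) (i + a) (≤-<-trans (m∸n≤m j i) hi) (subst (λ x → c (i + a) ~ c x) (split (<⇒≤ lt)) e)
      ... | inj₁ one = inj₁ (trans (sym (m∸n+n≡m (<⇒≤ lt))) (cong (_+ i) one))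
      ... | inj₂ eq  = inj₂ (i≡0 , trans (cong suc (sym (trans (cong (j ∸_) i≡0) refl))) eq)
        where
        i≡0 : i ≡ 0
        i≡0 = n≤0⇒n≡0 (+-cancelˡ-≤ (j ∸ i) i 0 (subst₂ _≤_ (sym (m∸n+n≡m (<⇒≤ lt))) (sym (+-identityʳ _)) (s≤s⁻¹ (subst (suc j ≤_) (sym eq) hi))))
      to : ∀ (i j : Fin size) → c (toℕ i + a) ~ c (toℕ j + a) → CycAdj G size i j
      to i j e with <-cmp (toℕ i) (toℕ j)
      to i j e | tri< lt _ _ with ordered lt (Fin.toℕ<n j) e
      ... | inj₁ p = inj₁ p
      ... | inj₂ p = inj₂ (inj₂ (inj₁ p))
      to i j e | tri≈ _ eq _ = ⊥-elim (~-irr (subst (λ x → c (toℕ i + a) ~ c (x + a)) (sym eq) e))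
      to i j e | tri> _ _ gt with ordered gt (Fin.toℕ<n i) (~-sym e)
      ... | inj₁ p = inj₂ (inj₁ p)
      ... | inj₂ p = inj₂ (inj₂ (inj₂ p))
      wrap : ∀ {i j} → i ≡ 0 → suc j ≡ size → c (i + a) ~ c (j + a)
      wrap {j = j} refl eq = ~-sym (subst (c (j + a) ~_) (trans (cong (λ s → c (s + a)) eq) (periodic a)) (next (j + a)))
      from : ∀ (i j : Fin size) → CycAdj G size i j → c (toℕ i + a) ~ c (toℕ j + a)
      from i j (inj₁ p) = subst (λ x → c (toℕ i + a) ~ c (x + a)) (sym p) (next _)
      from i j (inj₂ (inj₁ p)) = subst (λ x → c (x + a) ~ c (toℕ j + a)) (sym p) (~-sym (next _))
      from i j (inj₂ (inj₂ (inj₁ (p , q)))) = wrap p q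
      from i j (inj₂ (inj₂ (inj₂ (p , q)))) = ~-sym (wrap p q)

    toHole-On : ∀ a {v} → _∈H_ G v (toHole a) → On v
    toHole-On a (i , refl) = toℕ i + a , refl

    On-toHole : ∀ a {v} → On v → _∈H_ G v (toHole a)
    On-toHole a (i , refl) with reindex a i
    ... | d , lt , eq , _ = fromℕ< lt , trans (cong (λ x → c (x + a)) (Fin.toℕ-fromℕ< lt)) (sym (eq 0))

  module _ (H : Hole G) where
    open Hole H
    private
      instance len-nonZero : NonZero len
      len-nonZero = >-nonZero (≤-trans (s≤s z≤n) len≥4)
      c = λ i → vtx (i mod len)
      toℕ-mod : ∀ i → toℕ (i mod len) ≡ i % len
      toℕ-mod i = Fin.toℕ-fromℕ< (m%n<n i len)
      reduce : ∀ k i → (k + i) % len ≡ (k + i % len) % len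
      reduce k i = trans (%-distribˡ-+ k i len) (trans (cong (λ x → (k % len + x) % len) (sym (m%n%n≡m%n i len))) (sym (%-distribˡ-+ k (i % len) len)))
      residue : ∀ k i → k < len → toℕ ((k + i) mod len) ≡ k + toℕ (i mod len)
                                 ⊎ toℕ ((k + i) mod len) + len ≡ k + toℕ (i mod len)
      residue k i lt with k + i % len <? len
      ... | yes small = inj₁ (trans (trans (toℕ-mod (k + i)) (reduce k i)) (trans (m<n⇒m%n≡m small) (cong (k +_) (sym (toℕ-mod i)))))
      ... | no big = inj₂ (trans (cong (_+ len) (trans (toℕ-mod (k + i)) (trans (reduce k i) (trans (cong (_% len) (sym r+len)) (trans ([m+n]%n≡m%n r len) (m<n⇒m%n≡m r<)))))) (trans r+len (cong (k +_) (sym (toℕ-mod i)))))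
        where
        r = k + i % len ∸ len
        r+len : r + len ≡ k + i % len
        r+len = m∸n+n≡m (≮⇒≥ big)
        r< : r < len
        r< = +-cancelʳ-< len r len (subst (_< len + len) (sym r+len) (+-mono-< lt (m%n<n i len)))
      mod< : ∀ i → toℕ (i mod len) < len
      mod< i = Fin.toℕ<n (i mod len)

    fromHole : Ring
    fromHole = record
      { size = len ; size≥4 = len≥4 ; c = c
      ; periodic = λ i → cong vtx (Fin.toℕ-injective (trans (toℕ-mod (len + i))
          (trans (trans (cong (_% len) (+-comm len i)) ([m+n]%n≡m%n i len)) (sym (toℕ-mod i)))))
      ; next = λ i → proj₂ (adjH _ _) (next′ i)
      ; distinct = λ k i lo hi e → distinct′ k i lo hi (cong toℕ (inj e))
      ; chordless = λ k i lo hi a → chordless′ k i lo hi (proj₁ (adjH _ _) a) }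
      where
      next′ : ∀ i → CycAdj G len (i mod len) (suc i mod len)
      next′ i with residue 1 i (≤-trans (s≤s (s≤s z≤n)) len≥4)
      ... | inj₁ e = inj₁ e
      ... | inj₂ e = inj₂ (inj₂ (inj₂ (zero-res , trans (sym e) (cong (_+ len) zero-res))))
        where
        zero-res : toℕ (suc i mod len) ≡ 0
        zero-res = n≤0⇒n≡0 (+-cancelʳ-≤ len _ 0 (subst (_≤ len) (sym e) (mod< i)))
      distinct′ : ∀ k i → 1 ≤ k → k < len → toℕ (i mod len) ≢ toℕ ((k + i) mod len)
      distinct′ k i lo hi e with residue k i hi
      ... | inj₁ p = <-irrefl (sym (trans (sym p) (sym e))) (+-monoˡ-≤ (toℕ (i mod len)) lo)
      ... | inj₂ p = <-irrefl (+-cancelˡ-≡ (toℕ (i mod len)) _ _ (trans (+-comm _ k) (trans (sym p) (cong (_+ len) (sym e))))) hi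
      chordless′ : ∀ k i → 2 ≤ k → 2 + k ≤ len → ¬ CycAdj G len (i mod len) ((k + i) mod len)
      chordless′ k i lo hi adj with residue k i (≤-trans (n≤1+n _) hi)
      chordless′ k i lo hi (inj₁ q) | inj₁ p =
        <-irrefl (+-cancelʳ-≡ (toℕ (i mod len)) 1 k (trans (sym q) p)) lo
      chordless′ k i lo hi (inj₂ (inj₁ q)) | inj₁ p =
        m+1+n≢m (toℕ (i mod len)) (sym (trans q (trans (cong suc p) (trans (cong suc (+-comm k _)) (sym (+-suc _ k))))))
      chordless′ k i lo hi (inj₂ (inj₂ (inj₁ (q , r)))) | inj₁ p =
        <-irrefl (trans (cong suc (sym (trans p (trans (cong (k +_) q) (+-identityʳ k))))) r) hi
      chordless′ k i lo hi (inj₂ (inj₂ (inj₂ (q , r)))) | inj₁ p with k | lo | trans (sym q) p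
      ... | suc _ | _ | ()
      chordless′ k i lo hi (inj₁ q) | inj₂ p =
        1+n≰n (subst (_≤ len) (sym k≡) (≤-trans (m≤n+m k 2) hi))
        where
        k≡ : suc len ≡ k
        k≡ = +-cancelʳ-≡ (toℕ (i mod len)) (suc len) k (trans (cong suc (+-comm len _)) (trans (cong (_+ len) (sym q)) p))
      chordless′ k i lo hi (inj₂ (inj₁ q)) | inj₂ p =
        1+n≰n (subst (2 + k ≤_) (sym k≡) hi)
        where
        k≡ : suc k ≡ len
        k≡ = +-cancelˡ-≡ (toℕ ((k + i) mod len)) (suc k) len
               (trans (+-suc _ k) (trans (cong suc (+-comm _ k)) (trans (sym (+-suc k _)) (trans (cong (k +_) (sym q)) (sym p)))))
      chordless′ k i lo hi (inj₂ (inj₂ (inj₁ (q , r)))) | inj₂ p =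
        <⇒≱ (≤-trans (n≤1+n _) hi) (subst (len ≤_) (trans p (trans (cong (k +_) q) (+-identityʳ k))) (m≤n+m len _))
      chordless′ k i lo hi (inj₂ (inj₂ (inj₂ (q , r)))) | inj₂ p =
        <-irrefl (+-cancelʳ-≡ (toℕ (i mod len)) 1 k (trans r (trans (cong (_+ len) (sym q)) p))) lo

    fromHole-∈ : ∀ i → ∃[ j ] Ring.c fromHole i ≡ vtx j
    fromHole-∈ i = i mod len , refl

-- Simplicial vertices of hole-free sets, and their removal.

module Simplicial {n : ℕ} (G : Graph n) where
  open Paths G
  open StableSets G

  SimplicialIn : (V → Set) → V → Set
  SimplicialIn W v = ∀ u w → W u → W w → v ~ u → v ~ w → u ≢ w → u ~ w

  HoleFree : (V → Set) → Set
  HoleFree W = ¬ (Σ (Hole G) λ H → ∀ {v} → _∈H_ G v H → W v)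

  cycle-in : ∀ {W : V → Set} → HoleFree W → (C : Cycle) → ¬ All W (Cycle.hub C ∷ Cycle.start C ∷ Cycle.rest C)
  cycle-in hf C ws = hf (cycle-hole C , λ m → All.lookup ws (cycle-∈ C m))

  FarSimplicial : (V → Set) → V → Set
  FarSimplicial W z = ∃[ v ] W v × Far z v × SimplicialIn W v

  -- `A` is the component of `u` outside the closed neighbourhood of `z`, and `B` is its attachment
  -- among the neighbours of `z`. Two non-adjacent vertices of `B`, joined through `A`, would form a
  -- hole with `z`, so `B` is a clique. A vertex of `A` has all its neighbours in `W′ = A ∪ B`,
  -- which misses `z`. Induction in `W′`, if need be twice, gives two simplicial vertices far from
  -- each other or one in `A` outright, and the clique `B` cannot hold both.
  dirac : ∀ k {W z u} → Size W k → HoleFree W → W z → W u → Far z u → ¬ ¬ FarSimplicial W z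
  dirac zero sz _ wz _ _ = ⊥-elim (empty sz wz)
  dirac (suc k) {W} {z} {u} sz hf wz wu far = do
    yes (p , q , wp , wq , pq) ← lem (∃[ p ] ∃[ q ] W′ p × W′ q × Far p q)
      where no complete → return (u , wu , far , lift A-u λ x y wx wy _ _ ne →
                                  decidable-stable (x ~? y) λ ¬a → complete (x , y , wx , wy , ne , ¬a))
    v , w′v , _ , simp ← dirac k sz′ hf′ wp wq pq
    finish p v wp w′v simp
    where
    Beyond A B W′ : V → Set
    Beyond x = W x × Far z x
    A = Walk Beyond u
    B b = W b × z ~ b × ∃[ a ] A a × b ~ a
    W′ v = A v ⊎ B v
    A-u : A u
    A-u = stay (wu , far)
    A-far : ∀ {v} → A v → W v × Far z v
    A-far = walk-end
    W′⊆W : ∀ {v} → W′ v → W v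
    W′⊆W (inj₁ av) = proj₁ (A-far av)
    W′⊆W (inj₂ bv) = proj₁ bv
    sz′ : Size W′ k
    sz′ = shrink sz W′⊆W wz λ { (inj₁ az) → proj₁ (proj₂ (A-far az)) refl ; (inj₂ (_ , zz , _)) → ~-irr zz }
    hf′ : HoleFree W′
    hf′ (H , ins) = hf (H , W′⊆W ∘ ins)
    lift : ∀ {v} → A v → SimplicialIn W′ v → SimplicialIn W v
    lift {v} av simp x y wx wy vx vy = simp x y (extend wx vx) (extend wy vy) vx vy
      where
      extend : ∀ {x} → W x → v ~ x → W′ x
      extend {x} wx vx with z ~? x
      ... | yes zx = inj₂ (wx , zx , v , av , ~-sym vx)
      ... | no ¬zx = inj₁ (walk-snoc av vx (wx , (λ { refl → proj₂ (proj₂ (A-far av)) (~-sym vx) }) , ¬zx))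
    B-clique : ∀ {b b′} → B b → B b′ → b ≢ b′ → b ~ b′
    B-clique {b} {b′} (wb , zb , a , aa , ba) (wb′ , zb′ , a′ , aa′ , ba′) ne = decidable-stable (b ~? b′) λ ¬bb′ →
      let U : V → Set
          U v = A v ⊎ v ≡ b ⊎ v ≡ b′
          within : ∀ {x} → A x → Walk A u x
          within = walk-within
          walk : Walk U b b′
          walk = step (inj₂ (inj₁ refl)) ba (walk-snoc (walk-mono inj₁ (walk-trans (walk-reverse (within aa)) (within aa′))) (~-sym ba′) (inj₂ (inj₂ refl)))
      in close ¬bb′ (walk⇒path walk)
      where
      close : ¬ b ~ b′ → PathIn (λ v → A v ⊎ v ≡ b ⊎ v ≡ b′) b b′ → ⊥
      close ¬bb′ (mkPath [] _ _ e) = ne e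
      close ¬bb′ (mkPath (_ ∷ []) (link a _ _) _ refl) = ¬bb′ a
      close ¬bb′ (mkPath ps@(_ ∷ _ ∷ _) ip ins e) = cycle-in hf
        record { hub = z ; start = b ; rest = ps ; path = ip ; long = s≤s (s≤s z≤n) ; closeˡ = zb
               ; closeʳ = subst (z ~_) (sym e) zb′ ; avoid = λ m → avoid (All.lookup ins m) }
        (wz ∷ All.map inside ins)
        where
        inside : ∀ {v} → A v ⊎ v ≡ b ⊎ v ≡ b′ → W v
        inside (inj₁ av) = proj₁ (A-far av)
        inside (inj₂ (inj₁ refl)) = wb
        inside (inj₂ (inj₂ refl)) = wb′
        avoid : ∀ {v} → A v ⊎ v ≡ b ⊎ v ≡ b′ → z ≢ v × (z ~ v → v ≡ b ⊎ v ≡ lastOf b ps)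
        avoid (inj₁ av) = proj₁ (proj₂ (A-far av)) , λ zv → ⊥-elim (proj₂ (proj₂ (A-far av)) zv)
        avoid (inj₂ (inj₁ refl)) = ~⇒≢ zb , λ _ → inj₁ refl
        avoid (inj₂ (inj₂ refl)) = ~⇒≢ zb′ , λ _ → inj₂ (sym e)
    done : ∀ {v} → A v → SimplicialIn W′ v → FarSimplicial W z
    done av simp = _ , proj₁ (A-far av) , proj₂ (A-far av) , lift av simp
    finish : ∀ p v → W′ p → W′ v → SimplicialIn W′ v → ¬ ¬ FarSimplicial W z
    finish p v wp (inj₁ av) simp = return (done av simp)
    finish p v wp (inj₂ bv) simp = do
      yes (q , wq , vq) ← lem (∃[ q ] W′ q × Far v q)
        where no universal → universal-case universal
      v′ , w′v′ , vv′ , simp′ ← dirac k sz′ hf′ (inj₂ bv) wq vq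
      second v′ w′v′ vv′ simp′
      where
      second : ∀ v′ → W′ v′ → Far v v′ → SimplicialIn W′ v′ → ¬ ¬ FarSimplicial W z
      second v′ (inj₁ av′) _ simp′ = return (done av′ simp′)
      second v′ (inj₂ bv′) (ne , ¬a) _ = contradiction (B-clique bv bv′ ne) ¬a
      universal-case : ¬ (∃[ q ] W′ q × Far v q) → ¬ ¬ FarSimplicial W z
      -- A vertex that is simplicial and sees everything makes `W′` a clique, so `u` itself will do.
      universal-case universal = return (done A-u λ _ _ wx wy _ _ ne → simp-all wx wy ne)
        where
        adj-v : ∀ {x} → W′ x → v ≢ x → v ~ x
        adj-v {x} wx ne = decidable-stable (v ~? x) λ ¬a → universal (x , wx , ne , ¬a)
        simp-all : ∀ {x y} → W′ x → W′ y → x ≢ y → x ~ y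
        simp-all {x} {y} wx wy ne with v ≟ x | v ≟ y
        ... | yes refl | _ = adj-v wy ne
        ... | no _ | yes refl = ~-sym (adj-v wx (≢-sym ne))
        ... | no vx | no vy = simp x y wx wy (adj-v wx vx) (adj-v wy vy) ne

  simplicial-exists : ∀ {k W p} → Size W k → HoleFree W → W p → ¬ ¬ (∃[ v ] W v × SimplicialIn W v)
  simplicial-exists {k} {W} {p} sz hf wp = do
    yes (x , y , wx , wy , xy) ← lem (∃[ x ] ∃[ y ] W x × W y × Far x y)
      where no complete → return (p , wp , λ x y wx wy _ _ ne → decidable-stable (x ~? y) λ ¬a → complete (x , y , wx , wy , ne , ¬a))
    v , wv , _ , simp ← dirac k sz hf wx wy xy
    return (v , wv , simp)

  -- If `z` sees all of `W`, then a vertex simplicial in `W` without `z` stays simplicial when `z`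
  -- is put back.
  simplicial-avoiding : ∀ {k W z} → Size W k → HoleFree W → W z → ¬ ¬ ((∃[ v ] W v × v ≢ z × SimplicialIn W v) ⊎ (∀ {v} → W v → v ≡ z))
  simplicial-avoiding {k} {W} {z} sz hf wz = do
    no dominating ← lem (∃[ u ] W u × Far z u)
      where yes (u , wu , far) → do v , wv , (ne , _) , simp ← dirac k sz hf wz wu far
                                    return (inj₁ (v , wv , ≢-sym ne , simp))
    yes (u , wu , u≢z) ← lem (∃[ u ] W u × u ≢ z)
      where no alone → return (inj₂ λ {v} wv → decidable-stable (v ≟ z) λ ne → alone (v , wv , ne))
    let adj-z : ∀ {x} → W x → x ≢ z → z ~ x
        adj-z {x} wx ne = decidable-stable (z ~? x) λ ¬a → dominating (x , wx , ≢-sym ne , ¬a)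
        W′ = λ v → W v × v ≢ z
    v , (wv , v≢z) , simp ← simplicial-exists {k} {W′} (proj₁ sz , proj₁ (proj₂ sz) , λ w → proj₂ (proj₂ sz) (proj₁ w)) (λ { (H , ins) → hf (H , proj₁ ∘ ins) }) (wu , u≢z)
    return (inj₁ (v , wv , v≢z , λ x y wx wy vx vy ne → extended adj-z simp x y wx wy vx vy ne))
    where
    extended : ∀ {v} → (∀ {x} → W x → x ≢ z → z ~ x) → SimplicialIn (λ v → W v × v ≢ z) v → SimplicialIn W v
    extended adj-z simp x y wx wy vx vy ne with x ≟ z | y ≟ z
    ... | yes refl | _ = adj-z wy (≢-sym ne)
    ... | no _ | yes refl = ~-sym (adj-z wx ne)
    ... | no xz | no yz = simp x y (wx , xz) (wy , yz) vx vy ne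

  -- If `v` has no neighbour in `S`, it is added. If it has a neighbour `s` there, then a maximal
  -- clique through `v` lies in the closed neighbourhood of `v`, which is a clique containing `s`,
  -- so `s` belongs to it by maximality.
  restore-simplicial : ∀ {W S v} → W v → SimplicialIn W v → Strong (λ u → W u × u ≢ v) S →
                       ¬ ¬ (∃[ S′ ] Strong W S′ × (∀ u → S u → S′ u))
  restore-simplicial {W} {S} {v} wv simp σ = do
    yes (s , ss , vs) ← lem (∃[ s ] S s × v ~ s)
      where no isolated → return ((λ u → S u ⊎ u ≡ v) , record
                            { within = λ { (inj₁ su) → proj₁ (σ.within su) ; (inj₂ refl) → wv }
                            ; stable = λ { (inj₁ su) (inj₁ sw) → σ.stable su sw
                                         ; (inj₁ su) (inj₂ refl) a → isolated (_ , su , ~-sym a)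
                                         ; (inj₂ refl) (inj₁ sw) a → isolated (_ , sw , a)
                                         ; (inj₂ refl) (inj₂ refl) → ~-irr }
                            ; hits = λ {K} mc → do
                                no ¬kv ← lem (K v)
                                  where yes kv → return (v , inj₂ refl , kv)
                                u , su , ku ← σ.hits (smaller mc ¬kv)
                                return (u , inj₁ su , ku) } , λ _ → inj₁)
    return (S , record
      { within = proj₁ ∘ σ.within
      ; stable = σ.stable
      ; hits = λ {K} mc → do
          yes kv ← lem (K v)
            where no ¬kv → σ.hits (smaller mc ¬kv)
          return (s , ss , MaxClique.maximal mc (proj₁ (σ.within ss)) λ {u} ku u≢s → at mc kv ss vs ku u≢s) } , λ _ → id)
    where
    module σ = Strong σ
    at : ∀ {K s u} → MaxClique W K → K v → S s → v ~ s → K u → u ≢ s → s ~ u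
    at {u = u} mc kv ss vs ku u≢s with u ≟ v
    ... | yes refl = ~-sym vs
    ... | no u≢v = simp _ _ (proj₁ (σ.within ss)) (MaxClique.within mc ku) vs (MaxClique.clique mc kv ku (≢-sym u≢v)) (≢-sym u≢s)
    smaller : ∀ {K} → MaxClique W K → ¬ K v → MaxClique (λ u → W u × u ≢ v) K
    smaller mc ¬kv = record
      { within = λ ku → MaxClique.within mc ku , λ { refl → ¬kv ku } ; clique = MaxClique.clique mc
      ; nonempty = MaxClique.nonempty mc ; maximal = λ wu → MaxClique.maximal mc (proj₁ wu) }

-- The complement: absence of long holes, and 4-holes with a central pair.

complement : ∀ {n} → Graph n → Graph n
complement G = record
  { adj = λ u v → not (adj u v) ∧ not (does (u ≟ v))
  ; adj-sym = λ u v → cong₂ _∧_ (cong not (adj-sym u v)) (cong not (does-sym u v))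
  ; adj-irr = λ v → trans (cong (λ b → not (adj v v) ∧ not b) (dec-true (v ≟ v) refl)) (Bool.∧-zeroʳ _) }
  where
  open Graph G
  does-sym : ∀ u v → does (u ≟ v) ≡ does (v ≟ u)
  does-sym u v with v ≟ u
  ... | yes refl = dec-true (u ≟ v) refl
  ... | no ne    = dec-false (u ≟ v) (≢-sym ne)

module Antiholes {n : ℕ} (G : Graph n) (innocent : Innocent G) where
  open Paths G
  module Co = Paths (complement G)

  co-adj : ∀ {u v} → Far u v → u Co.~ v
  co-adj {u} {v} (ne , ¬a) = cong₂ _∧_ (cong not (Bool.¬-not ¬a)) (cong not (dec-false (u ≟ v) ne))

  co-far : ∀ {u v} → u Co.~ v → Far u v
  co-far e = Co.~⇒≢ e , λ a → contradiction (trans (sym e) (cong (λ b → not b ∧ _) a)) λ ()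

  co-nonadj : ∀ {u v} → Co.Far u v → u ~ v
  co-nonadj {u} {v} (ne , ¬a) = decidable-stable (u ~? v) λ ¬b → ¬a (co-adj (ne , ¬b))

  adj-co-far : ∀ {u v} → u ~ v → Co.Far u v
  adj-co-far a = ~⇒≢ a , λ e → proj₂ (co-far e) a

  hole-even : (H : Hole G) → even? (Hole.len H) ≡ true
  hole-even H = decidable-stable (even? (Hole.len H) Bool.≟ true) λ ne → proj₁ innocent (H , odd⇒¬2∣ _ (¬even⇒odd {Hole.len H} ne))

  cycle-even : (C : Cycle) → even? (length (Cycle.rest C)) ≡ true
  cycle-even C = trans (sym (Bool.not-involutive _)) (hole-even (cycle-hole C))

  -- From six vertices on this is an excluded antihole. The 5-hole is its own complement: in the
  -- order 0, 2, 4, 1, 3 it is an odd hole of `G`.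
  no-long-anticycle : (C : Co.Cycle) → ¬ 3 ≤ length (Co.Cycle.rest C)
  no-long-anticycle C 3≤ with m≤n⇒m<n∨m≡n 3≤
  ... | inj₁ 4≤ = proj₁ (proj₂ innocent) record
    { len = Hole.len H ; len≥6 = s≤s (s≤s 4≤) ; vtx = Hole.vtx H ; inj = Hole.inj H
    ; adjA = λ i j → (λ a → (λ { refl → ~-irr a }) , λ cyc → proj₂ (co-far (proj₂ (Hole.adjH H i j) cyc)) a)
                   , λ { (ne , ¬cyc) → co-nonadj ((λ e → ne (Hole.inj H e)) , λ e → ¬cyc (proj₁ (Hole.adjH H i j) e)) } }
    where H = Co.cycle-hole C
  ... | inj₂ eq = five C eq
    where
    five : (C : Co.Cycle) → 3 ≡ length (Co.Cycle.rest C) → ⊥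
    five record { hub = v₀ ; start = v₁ ; rest = v₂ ∷ v₃ ∷ v₄ ∷ [] ; closeˡ = e₀₁ ; closeʳ = e₀₄ ; avoid = avoid
                ; path = Co.link e₁₂ (f₁₃ ∷ f₁₄ ∷ []) (Co.link e₂₃ (f₂₄ ∷ []) (Co.link e₃₄ [] Co.single)) } refl =
      contradiction (cycle-even record
        { hub = v₀ ; start = v₂ ; rest = v₄ ∷ v₁ ∷ v₃ ∷ [] ; long = s≤s (s≤s z≤n)
        ; path = link (co-nonadj f₂₄) (Far-sym (co-far e₁₂) ∷ co-far e₂₃ ∷ [])
                   (link (~-sym (co-nonadj f₁₄)) (Far-sym (co-far e₃₄) ∷ []) (link (co-nonadj f₁₃) [] single))
        ; closeˡ = co-nonadj far₀₂ ; closeʳ = co-nonadj far₀₃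
        ; avoid = λ { (here refl) → proj₁ far₀₂ , λ _ → inj₁ refl
                    ; (there (here refl)) → proj₁ (co-far e₀₄) , λ a → contradiction a (proj₂ (co-far e₀₄))
                    ; (there (there (here refl))) → proj₁ (co-far e₀₁) , λ a → contradiction a (proj₂ (co-far e₀₁))
                    ; (there (there (there (here refl)))) → proj₁ far₀₃ , λ _ → inj₂ refl } }) λ ()
      where
      far₀₂ : Co.Far v₀ v₂
      far₀₂ = proj₁ (avoid (there (here refl))) , λ a →
        [ (λ { refl → Co.~-irr e₁₂ }) , (λ e → proj₁ f₂₄ e) ]′ (proj₂ (avoid (there (here refl))) a)
      far₀₃ : Co.Far v₀ v₃
      far₀₃ = proj₁ (avoid (there (there (here refl)))) , λ a →
        [ (λ e → proj₁ f₁₃ (sym e)) , (λ { refl → Co.~-irr e₃₄ }) ]′ (proj₂ (avoid (there (there (here refl)))) a)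

  -- The complement of the P₄ x, m′, m, y is the P₄ m, x, y, m′. So `no-P4` says that, in the
  -- complement, the edge `xy` is not the middle of a P₄; this is the form `Middle` below.
  record Central (U : V → Set) (x y : V) : Set where
    field
      inside₁ : U x
      inside₂ : U y
      far     : Far x y
      no-P4   : ∀ {m m′} → U m → U m′ → x ~ m′ → m′ ~ m → m ~ y → ¬ x ~ m → ¬ m′ ~ y → ⊥

  private
    Middle : (U : V → Set) → V → V → Set
    Middle U x y = ∃[ m ] ∃[ m′ ] U m × U m′ × m Co.~ x × y Co.~ m′ × Co.Far m y × Co.Far m′ x × Co.Far m m′

    CentralEdge : (U J : V → Set) → Set
    CentralEdge U J = ∃[ x ] ∃[ y ] U x × U y × x Co.~ y × (∀ v → J v → Co.Far v x × Co.Far v y) × ¬ Middle U x y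

    MissedEdge : (U J H : V → Set) → Set
    MissedEdge U J H = ∃[ i ] ∃[ p ] ∃[ q ] U i × ¬ J i × (∃[ v ] J v × v Co.~ i) × H p × H q × p Co.~ q × Co.Far i p × Co.Far i q

    Connected : (V → Set) → Set
    Connected J = ∀ {u v} → J u → J v → Co.Walk J u v

  -- In the complement, fix a connected set J and an edge pq anticomplete to it, and let H be the
  -- component of p outside the closed neighbourhood of J.  Enlarge J as long as some vertex next to J
  -- misses an edge of H; afterwards an edge that is not the middle of a P₄ in H is not the middle of
  -- any P₄, since two ends outside H would be joined through J to form a long hole.
  co-handle : ∀ k j {U J : V → Set} {j₀ p q} → Size U (suc k) → Size (λ v → U v × ¬ J v) j →
              (∀ {v} → J v → U v) → Connected J → J j₀ → U p → U q → p Co.~ q →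
              (∀ {v} → J v → Co.Far v p × Co.Far v q) → ¬ ¬ CentralEdge U J
  co-edge : ∀ k {U : V → Set} {p q} → Size U k → U p → U q → p Co.~ q → ¬ ¬ CentralEdge U (λ _ → ⊥)

  co-edge zero sz up _ _ = ⊥-elim (empty sz up)
  co-edge (suc k) {U} {p} {q} sz up uq pq = do
    yes (m , m′ , um , um′ , mp , qm′ , mq , m′p , mm′) ← lem (Middle U p q)
      where no ¬mid → return (p , q , up , uq , pq , (λ _ ()) , ¬mid)
    -- In the P₄ m, p, q, m′ of the complement the end `m′` misses the edge `mp`, so `m′` alone can
    -- start the connected set for that edge.
    x , y , ux , uy , xy , _ , ¬mid ← co-handle k (suc k) {U} {_≡ m′} sz (proj₁ sz , proj₁ (proj₂ sz) , proj₂ (proj₂ sz) ∘ proj₁)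
      (λ { refl → um′ }) (λ { refl refl → Co.stay refl }) refl um up mp (λ { refl → Co.Far-sym mm′ , m′p })
    return (x , y , ux , uy , xy , (λ _ ()) , ¬mid)

  co-handle k zero {p = p} sz szJ J⊆U conn j₀∈J up uq pq far =
    ⊥-elim (empty szJ (up , λ jp → proj₁ (proj₁ (far jp)) refl))
  co-handle k (suc j) {U} {J} {j₀} {p} {q} sz szJ J⊆U conn j₀∈J up uq pq far = do
    no none-missed ← lem (MissedEdge U J H)
      where yes (i , p′ , q′ , ui , ¬ji , (v , jv , vi) , hp , hq , p′q′ , ip , iq) → grow i p′ q′ ui ¬ji v jv vi hp hq p′q′ ip iq
    -- `H` misses `j₀`, so `k` goes down here. Enlarging `J` by `grow` keeps `k` and lowers `j`, the
    -- bound on the part of `U` outside `J`.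
    x , y , hx , hy , xy , _ , ¬mid ← co-edge k szH (Co.stay (up , λ _ → proj₁ ∘ far)) H-q pq
    return (x , y , H⊆U hx , H⊆U hy , xy , (λ _ jv → H-far hx jv , H-far hy jv) , middle none-missed hx hy xy ¬mid)
    where
    H : V → Set
    H = Co.Walk (λ x → U x × (∀ v → J v → Co.Far v x)) p
    H⊆U : ∀ {v} → H v → U v
    H⊆U h = proj₁ (Co.walk-end h)
    H-far : ∀ {v h} → H h → J v → Co.Far v h
    H-far h jv = proj₂ (Co.walk-end h) _ jv
    H-q : H q
    H-q = Co.step (up , λ _ → proj₁ ∘ far) pq (Co.stay (uq , λ _ → proj₂ ∘ far))
    szH : Size H k
    szH = shrink sz H⊆U (J⊆U j₀∈J) λ h → proj₁ (H-far h j₀∈J) refl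
    grow : ∀ i p′ q′ → U i → ¬ J i → ∀ v → J v → v Co.~ i → H p′ → H q′ → p′ Co.~ q′ → Co.Far i p′ → Co.Far i q′ → ¬ ¬ CentralEdge U J
    grow i p′ q′ ui ¬ji v jv vi hp hq p′q′ ip iq = do
      x , y , ux , uy , xy , far′ , ¬mid ← co-handle k j {U} {J′} sz
        (shrink szJ (λ { (uv , ¬j′) → uv , ¬j′ ∘ inj₁ }) (ui , ¬ji) (λ { (_ , ¬j′) → ¬j′ (inj₂ refl) }))
        (λ { (inj₁ jv) → J⊆U jv ; (inj₂ refl) → ui }) conn′ (inj₁ j₀∈J) (H⊆U hp) (H⊆U hq) p′q′
        (λ { (inj₁ jv) → H-far hp jv , H-far hq jv ; (inj₂ refl) → ip , iq })
      return (x , y , ux , uy , xy , (λ v → far′ v ∘ inj₁) , ¬mid)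
      where
      J′ : V → Set
      J′ w = J w ⊎ w ≡ i
      to-i : ∀ {u} → J u → Co.Walk J′ u i
      to-i ju = Co.walk-snoc (Co.walk-mono inj₁ (conn ju jv)) vi (inj₂ refl)
      conn′ : Connected J′
      conn′ (inj₁ ju) (inj₁ jw) = Co.walk-mono inj₁ (conn ju jw)
      conn′ (inj₁ ju) (inj₂ refl) = to-i ju
      conn′ (inj₂ refl) (inj₁ jw) = Co.walk-reverse (to-i jw)
      conn′ (inj₂ refl) (inj₂ refl) = Co.stay (inj₂ refl)
    outside : ∀ {h m} → H h → h Co.~ m → U m → ¬ H m → ¬ J m × ¬ ¬ (∃[ v ] J v × v Co.~ m)
    outside {h} {m} hh hm um ¬hm = ¬jm , λ none → ¬hm (Co.walk-snoc hh hm (um , λ v jv → (λ { refl → ¬jm jv }) , λ e → none (v , jv , e)))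
      where
      ¬jm : ¬ J m
      ¬jm jm = proj₂ (H-far hh jm) (Co.~-sym hm)
    -- When just one end of the P₄ lies outside `H`, that end is next to `J` and misses the edge
    -- formed by the other end and its neighbour, an edge of `H`; `none-missed` forbids this.
    middle : ¬ MissedEdge U J H → ∀ {x y} → H x → H y → x Co.~ y → ¬ Middle H x y → ¬ Middle U x y
    middle none-missed {x} {y} hx hy xy ¬mid (m , m′ , um , um′ , mx , ym′ , my , m′x , mm′) = run do
      yes hm ← lem (H m)
        where no ¬hm → do
                let ¬jm , near = outside hx (Co.~-sym mx) um ¬hm
                v , jv , vm ← near
                no ¬hm′ ← lem (H m′)
                  where yes hm′ → contradiction (m , y , m′ , um , ¬jm , (v , jv , vm) , hy , hm′ , ym′ , my , mm′) none-missed
                v′ , jv′ , v′m′ ← proj₂ (outside hy ym′ um′ ¬hm′)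
                return (long-hole (Co.walk⇒path (Co.step {U = λ w → J w ⊎ w ≡ m ⊎ w ≡ m′} (inj₂ (inj₁ refl)) (Co.~-sym vm)
                  (Co.walk-snoc (Co.walk-mono inj₁ (conn jv jv′)) v′m′ (inj₂ (inj₂ refl))))))
      yes hm′ ← lem (H m′)
        where no ¬hm′ → do
                let ¬jm′ , near = outside hy ym′ um′ ¬hm′
                w ← near
                contradiction (m′ , m , x , um′ , ¬jm′ , w , hm , hx , mx , Co.Far-sym mm′ , m′x) none-missed
      contradiction (m , m′ , hm , hm′ , mx , ym′ , my , m′x , mm′) ¬mid
      where
      long-hole : Co.PathIn (λ w → J w ⊎ w ≡ m ⊎ w ≡ m′) m m′ → ⊥
      long-hole (Co.mkPath [] _ _ e) = proj₁ mm′ e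
      long-hole (Co.mkPath (_ ∷ []) (Co.link a _ _) _ refl) = proj₂ mm′ a
      long-hole (Co.mkPath ps@(_ ∷ _ ∷ _) ip ins e) = no-long-anticycle record
        { hub = y ; start = x ; rest = m ∷ ps ; long = s≤s (s≤s z≤n)
        ; path = Co.link (Co.~-sym mx) (All.tabulate far-x) ip
        ; closeˡ = Co.~-sym xy ; closeʳ = subst (y Co.~_) (sym e) ym′
        ; avoid = λ { (here refl) → Co.~⇒≢ (Co.~-sym xy) , λ _ → inj₁ refl ; (there w) → avoid (All.lookup ins w) } }
        (s≤s (s≤s (s≤s z≤n)))
        where
        far-x : ∀ {w} → w ∈ˡ ps → Co.Far x w
        far-x w∈ with All.lookup ins (there w∈)
        ... | inj₁ jw = Co.Far-sym (H-far hx jw)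
        ... | inj₂ (inj₁ refl) = contradiction refl (Co.tail-far ip w∈)
        ... | inj₂ (inj₂ refl) = Co.Far-sym m′x
        avoid : ∀ {w} → J w ⊎ w ≡ m ⊎ w ≡ m′ → y ≢ w × (y Co.~ w → w ≡ x ⊎ w ≡ Co.lastOf m ps)
        avoid (inj₁ jw) = proj₁ (Co.Far-sym (H-far hy jw)) , λ a → contradiction a (proj₂ (Co.Far-sym (H-far hy jw)))
        avoid (inj₂ (inj₁ refl)) = proj₁ (Co.Far-sym my) , λ a → contradiction a (proj₂ (Co.Far-sym my))
        avoid (inj₂ (inj₂ refl)) = Co.~⇒≢ ym′ , λ _ → inj₂ (sym e)

  -- In the complement a 4-hole is a pair of anticomplete edges `ac` and `bd`. With `bd` as the
  -- connected set, the edge found is anticomplete to it, so back in `G` the vertices x, b, y, d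
  -- form a 4-hole again.
  central-square : ∀ {W a b c d} → W a → W b → W c → W d → a ~ b → b ~ c → c ~ d → d ~ a → Far a c → Far b d →
                   ¬ ¬ (∃[ x ] ∃[ y ] Central W x y × x ~ b × b ~ y × y ~ d × d ~ x)
  central-square {W} {a} {b} {c} {d} wa wb wc wd ab bc cd da ac bd = do
    x , y , wx , wy , xy , far , ¬mid ← co-handle n n {W} {J} all-size (all , ≤-reflexive all-length , λ _ → ∈-all _)
      (λ { (inj₁ refl) → wb ; (inj₂ refl) → wd })
      (λ { (inj₁ refl) (inj₁ refl) → Co.stay (inj₁ refl)
         ; (inj₁ refl) (inj₂ refl) → Co.step (inj₁ refl) (co-adj bd) (Co.stay (inj₂ refl))
         ; (inj₂ refl) (inj₁ refl) → Co.step (inj₂ refl) (co-adj (Far-sym bd)) (Co.stay (inj₁ refl))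
         ; (inj₂ refl) (inj₂ refl) → Co.stay (inj₂ refl) })
      (inj₁ refl) wa wc (co-adj ac)
      (λ { (inj₁ refl) → adj-co-far (~-sym ab) , adj-co-far bc ; (inj₂ refl) → adj-co-far da , adj-co-far (~-sym cd) })
    return (x , y , record
      { inside₁ = wx ; inside₂ = wy ; far = co-far xy
      ; no-P4 = λ {m} {m′} wm wm′ xm′ m′m my ¬xm ¬m′y → ¬mid (m , m′ , wm , wm′
          , co-adj ((λ { refl → proj₂ (co-far xy) my }) , ¬xm ∘ ~-sym)
          , co-adj ((λ { refl → proj₂ (co-far xy) xm′ }) , ¬m′y ∘ ~-sym)
          , adj-co-far my , adj-co-far (~-sym xm′) , adj-co-far (~-sym m′m)) }
      , ~-sym (co-nonadj (proj₁ (far b (inj₁ refl)))) , co-nonadj (proj₂ (far b (inj₁ refl)))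
      , ~-sym (co-nonadj (proj₂ (far d (inj₂ refl)))) , co-nonadj (proj₁ (far d (inj₂ refl))))
    where
    J : V → Set
    J v = v ≡ b ⊎ v ≡ d
    all = allFin n
    all-length : length all ≡ n
    all-length = length-tabulate id
    ∈-all : ∀ v → v ∈ˡ all
    ∈-all = ∈-allFin
    all-size : Size W (suc n)
    all-size = all , ≤-trans (≤-reflexive all-length) (n≤1+n n) , λ _ → ∈-all _

-- Shortest rings of length at least six: no P₄ between alternate vertices.

module LongRings {n : ℕ} (G : Graph n) (claw-free : ClawFree G) (innocent : Innocent G) where
  open Paths G
  open Rings G
  open Antiholes G innocent

  claw : ∀ {x a b c} → x ~ a → x ~ b → x ~ c → Far a b → Far a c → b ≢ c → b ~ c
  claw {x} {a} {b} {c} xa xb xc (a≢b , ¬ab) (a≢c , ¬ac) b≢c = decidable-stable (b ~? c) λ ¬bc → claw-free record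
    { a = x ; b = a ; c = b ; d = c ; ab = xa ; ac = xb ; ad = xc
    ; b≢c = a≢b ; b≢d = a≢c ; c≢d = b≢c ; nbc = ¬ab ; nbd = ¬ac ; ncd = ¬bc }

  Near : V → V → Set
  Near x w = w ≡ x ⊎ w ~ x

  record Tight (W : V → Set) (R : Ring) : Set where
    open Ring R
    -- dominant: replacing c (1 + i) by a twin y with a larger neighbourhood would increase the
    -- degree sum of the ring, so it holds for a ring of maximal degree sum.
    field
      inside   : ∀ i → W (c i)
      size≥6   : 6 ≤ size
      shortest : ∀ (C : Cycle) → All W (Cycle.hub C ∷ Cycle.start C ∷ Cycle.rest C) → size ≤ 2 + length (Cycle.rest C)
      dominant : ∀ i {y} → W y → (∀ j → y ≢ c j) → y ~ c i → y ~ c (1 + i) → y ~ c (2 + i) →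
                 (∀ d → 3 ≤ d → d < size → ¬ y ~ c (d + i)) →
                 (∀ {w} → W w → Near (c (1 + i)) w → Near y w) → (∀ {w} → W w → Near y w → Near (c (1 + i)) w)

  shift : ℕ → Ring → Ring
  shift a R = record
    { size = size ; size≥4 = size≥4 ; c = λ i → c (i + a)
    ; periodic = λ i → trans (cong c (+-assoc size i a)) (periodic (i + a))
    ; next = λ i → next (i + a)
    ; distinct = λ k i lo hi e → distinct k (i + a) lo hi (trans e (cong c (+-assoc k i a)))
    ; chordless = λ k i lo hi e → chordless k (i + a) lo hi (subst (c (i + a) ~_) (cong c (+-assoc k i a)) e) }
    where open Ring R

  tight-shift : ∀ {W R} a → Tight W R → Tight W (shift a R)
  tight-shift {R = R} a T = record
    { inside = λ i → inside (i + a) ; size≥6 = size≥6 ; shortest = shortest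
    ; dominant = λ i wy off y₀ y₁ y₂ far → dominant (i + a) wy
        (λ j e → let d , _ , eq , _ = RingProperties.reindex R a j in off d (trans e (eq 0))) y₀ y₁ y₂
        (λ d lo hi e → far d lo hi (subst (_ ~_) (cong (Ring.c R) (sym (+-assoc d i a))) e)) }
    where open Tight T

  module Mirror (R : Ring) (b : ℕ) where
    open RingProperties R

    p = size ∸ 1

    private
      size≡ : size ≡ suc p
      size≡ = sym (m+[n∸m]≡n (≤-trans (s≤s z≤n) size≥4))

      r : ℕ → V
      -- Multiplication by `p = size ∸ 1` is negation modulo `size`, so this is the ring run
      -- backwards from `c b`.
      r i = c (p * i + b)

      back : ∀ k x → 1 ≤ k → k ≤ size → c (p * k + x) ≡ c ((size ∸ k) + x)
      back (suc k) x _ le = trans (cong c eq) (periodic* k (s + x))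
        where
        s = size ∸ suc k
        total : size ≡ s + suc k
        total = sym (m∸n+n≡m le)
        p≡ : p ≡ s + k
        p≡ = suc-injective (trans (sym size≡) (trans total (+-suc s k)))
        ring : ∀ s k x → (s + k) * suc k + x ≡ k * (s + suc k) + (s + x)
        ring = solve-∀
        eq : p * suc k + x ≡ k * size + (s + x)
        eq = trans (cong (λ q → q * suc k + x) p≡) (trans (ring s k x) (cong (λ q → k * q + (s + x)) (sym total)))

      split : ∀ k i → p * (k + i) + b ≡ p * k + (p * i + b)
      split k i = ring p k i b
        where
        ring : ∀ p k i b → p * (k + i) + b ≡ p * k + (p * i + b)
        ring = solve-∀

      step-back : ∀ k i → 1 ≤ k → k ≤ size → r (k + i) ≡ c ((size ∸ k) + (p * i + b))
      step-back k i lo hi = trans (cong c (split k i)) (back k _ lo hi)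

    mirror-at : ∀ k → 1 ≤ k → k ≤ size → r k ≡ c ((size ∸ k) + b)
    mirror-at k lo hi = trans (cong r (sym (+-identityʳ k))) (trans (step-back k 0 lo hi) (cong (λ z → c ((size ∸ k) + (z + b))) (*-zeroʳ p)))

    mirror : Ring
    mirror = record
      { size = size ; size≥4 = size≥4 ; c = r
      ; periodic = λ i → trans (cong c (split size i)) (periodic* p _)
      ; next = λ i → subst (r i ~_) (sym (step-back 1 i ≤-refl (≤-trans (s≤s z≤n) size≥4))) (prev (p * i + b))
      ; distinct = λ k i lo hi e → distinct (size ∸ k) (p * i + b) (m<n⇒0<n∸m hi)
          (∸-monoʳ-< {o = 0} lo (<⇒≤ hi)) (trans e (step-back k i lo (<⇒≤ hi)))
      ; chordless = λ k i lo hi e → chordless (size ∸ k) (p * i + b) (m+n≤o⇒m≤o∸n 2 hi)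
          (subst (_≤ size) (+-comm (size ∸ k) 2) (≤-trans (+-monoʳ-≤ (size ∸ k) lo) (≤-reflexive (m∸n+n≡m (≤-trans (m≤n+m k 2) hi)))))
          (subst (r i ~_) (step-back k i (≤-trans (n≤1+n 1) lo) (≤-trans (m≤n+m k 2) hi)) e) }

    tight-mirror : ∀ {W} → Tight W R → Tight W mirror
    tight-mirror {W} T = record
      { inside = λ i → inside _ ; size≥6 = size≥6 ; shortest = shortest ; dominant = dominant′ }
      where
      open Tight T
      dominant′ : ∀ i {y} → W y → (∀ j → y ≢ r j) → y ~ r i → y ~ r (1 + i) → y ~ r (2 + i) →
                 (∀ d → 3 ≤ d → d < size → ¬ y ~ r (d + i)) →
                 (∀ {w} → W w → Near (r (1 + i)) w → Near y w) → (∀ {w} → W w → Near y w → Near (r (1 + i)) w)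
      dominant′ i {y} wy off y₀ y₁ y₂ far sub {w} ww near =
        subst (λ v → Near v w) (sym r₁)
          (dominant z wy off′ (subst (y ~_) r₂ y₂) (subst (y ~_) r₁ y₁) (subst (y ~_) r₀ y₀) far′
            (λ {w} ww nr → sub ww (subst (λ v → Near v w) (sym r₁) nr)) ww near)
        where
        x = p * i + b
        -- Two steps before `x`: the triple `r i`, `r (1 + i)`, `r (2 + i)` is `c (2 + z)`,
        -- `c (1 + z)`, `c z`.
        z = p + (p + x)
        r₁ : r (1 + i) ≡ c (1 + z)
        r₁ = trans (step-back 1 i ≤-refl (≤-trans (s≤s z≤n) size≥4)) (sym (prev-next (p + x)))
        r₀ : r i ≡ c (2 + z)
        r₀ = sym (trans (same-index (prev-next (p + x)) 1) (prev-next x))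
        r₂ : r (2 + i) ≡ c z
        r₂ = cong c (ring p i b)
          where
          ring : ∀ p i b → p * (2 + i) + b ≡ p + (p + (p * i + b))
          ring = solve-∀
        off′ : ∀ j → y ≢ c j
        off′ j e with reindex x j
        ... | zero , _ , eq , _ = off i (trans e (eq 0))
        ... | suc d , lt , eq , _ = off (size ∸ suc d + i) (trans e (trans (eq 0) (trans (cong (λ s → c (s + x)) (sym (m∸[m∸n]≡n (<⇒≤ lt))))
                 (sym (step-back (size ∸ suc d) i (m<n⇒0<n∸m lt) (m∸n≤m size (suc d)))))))
        far′ : ∀ d → 3 ≤ d → d < size → ¬ y ~ c (d + z)
        far′ (suc (suc m)) (s≤s (s≤s lo)) hi e = far (size ∸ m) (m+n≤o⇒m≤o∸n 3 hi) (∸-monoʳ-< {o = 0} lo m≤)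
          (subst (y ~_) eq e)
          where
          m≤ : m ≤ size
          m≤ = ≤-trans (≤-trans (n≤1+n m) (n≤1+n (suc m))) (<⇒≤ hi)
          shuffle : ∀ m z → suc (suc (m + z)) ≡ m + suc (suc z)
          shuffle = solve-∀
          eq : c (2 + m + z) ≡ r (size ∸ m + i)
          eq = trans (cong c (shuffle m z)) (trans (same-index (sym r₀) m)
                 (trans (cong (λ s → c (s + x)) (sym (m∸[m∸n]≡n m≤)))
                   (sym (step-back (size ∸ m) i (m<n⇒0<n∸m (≤-trans (s≤s (≤-trans (n≤1+n m) (n≤1+n (suc m)))) hi)) (m∸n≤m size m)))))

  module TightRing {W : V → Set} (R : Ring) (T : Tight W R) where
    open RingProperties R
    open Tight T

    size-even : even? size ≡ true
    size-even = hole-even (toHole 0)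

    Off : V → Set
    Off v = ∀ j → v ≢ c j

    ring-inside : ∀ {v} → On v → W v
    ring-inside (j , refl) = inside j

    up-inside : ∀ a k → All W (c a ∷ upTail a k)
    up-inside a k = All.tabulate λ m → let j , _ , e = up-∈ a k m in ring-inside (j + a , e)

    -- The first neighbour after the gap, at distance j from `c p`, would close with `v` a hole of
    -- length j + 2, and the bound on `e` makes that shorter than the ring.
    not-after-gap : ∀ {v} p → W v → Off v → v ~ c p → ¬ v ~ c (1 + p) → ∀ e → 3 + e ≤ size →
                    ∀ j → 1 ≤ j → j ≤ e → ¬ v ~ c (j + p)
    not-after-gap p wv off vp ¬vp′ zero le (suc j) _ ()
    not-after-gap {v} p wv off vp ¬vp′ (suc e) le j lo hi =
      [ (λ { (s≤s lt) → earlier j lo lt }) , (λ { refl → final e le earlier }) ]′ (m≤n⇒m<n∨m≡n hi)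
      where
      earlier : ∀ j → 1 ≤ j → j ≤ e → ¬ v ~ c (j + p)
      earlier = not-after-gap p wv off vp ¬vp′ e (≤-trans (n≤1+n _) le)
      final : ∀ e → 4 + e ≤ size → (∀ j → 1 ≤ j → j ≤ e → ¬ v ~ c (j + p)) → ¬ v ~ c (suc e + p)
      final zero    _  _       = ¬vp′
      final (suc e) le earlier = λ a → <⇒≱ (≤-trans (≤-reflexive (cong (4 +_) (up-length (suc p) (suc e)))) le)
        (shortest record
          { hub = v ; start = c p ; rest = upTail p (2 + e) ; path = up-path p (2 + e) (≤-trans (n≤1+n _) le)
          ; long = s≤s (s≤s z≤n) ; closeˡ = vp ; closeʳ = subst (v ~_) (sym (up-last p (2 + e))) a
          ; avoid = avoid }
          (wv ∷ up-inside p (2 + e)))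
        where
        avoid : ∀ {u} → u ∈ˡ c p ∷ upTail p (2 + e) → v ≢ u × (v ~ u → u ≡ c p ⊎ u ≡ lastOf (c p) (upTail p (2 + e)))
        avoid m with up-∈ p (2 + e) m
        ... | zero , _ , refl = off p , λ _ → inj₁ refl
        ... | suc j , hi , refl with m≤n⇒m<n∨m≡n hi
        ... | inj₁ (s≤s lt) = off (suc j + p) , λ b → ⊥-elim (earlier (suc j) (s≤s z≤n) lt b)
        ... | inj₂ refl = off (suc j + p) , λ _ → inj₂ (sym (up-last p (2 + e)))

    -- Hence the ring neighbours of an outside vertex are pairwise at distance at most two. The
    -- first gap after `c a` decides. If it follows `c a`, `c (1 + a)` or `c (2 + a)`, then
    -- `c (d + a)` comes after it; if it follows `c (3 + a)`, then going round the ring excludes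
    -- `c a` itself. Without such a gap `c a`, `c (2 + a)`, `c (4 + a)` are the leaves of a claw.
    window : ∀ {v} a d → W v → Off v → v ~ c a → 3 ≤ d → 3 + d ≤ size → ¬ v ~ c (d + a)
    window {v} a d wv off va 3≤d d≤ vd with v ~? c (1 + a) | v ~? c (2 + a) | v ~? c (3 + a) | v ~? c (4 + a)
    ... | no ¬1 | _ | _ | _ = not-after-gap a wv off va ¬1 d d≤ d (≤-trans (s≤s z≤n) 3≤d) ≤-refl vd
    ... | yes y1 | no ¬2 | _ | _ = lemma d 3≤d d≤ vd
      where
      lemma : ∀ d → 3 ≤ d → 3 + d ≤ size → ¬ v ~ c (d + a)
      lemma (suc d) (s≤s lo) hi e = not-after-gap (1 + a) wv off y1 ¬2 d (≤-trans (n≤1+n _) hi) d (≤-trans (s≤s z≤n) lo) ≤-refl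
        (subst (v ~_) (cong c (sym (+-suc d a))) e)
    ... | yes _ | yes y2 | no ¬3 | _ = lemma d 3≤d d≤ vd
      where
      shuffle : ∀ d a → suc (suc d) + a ≡ d + suc (suc a)
      shuffle = solve-∀
      lemma : ∀ d → 3 ≤ d → 3 + d ≤ size → ¬ v ~ c (d + a)
      lemma (suc (suc d)) (s≤s (s≤s lo)) hi e = not-after-gap (2 + a) wv off y2 ¬3 d (≤-trans (m≤n+m _ 2) hi) d lo ≤-refl
        (subst (v ~_) (cong c (shuffle d a)) e)
    ... | yes _ | yes y2 | yes _ | yes y4 =
      contradiction (claw va y2 y4 (apart 2 a ≤-refl (≤-trans (s≤s (s≤s (s≤s (s≤s z≤n)))) size≥4)) (apart 4 a (s≤s (s≤s z≤n)) size≥6)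
                      (distinct 2 (2 + a) (s≤s z≤n) (≤-trans (s≤s (s≤s (s≤s z≤n))) size≥4)))
                    (chordless 2 (2 + a) ≤-refl size≥4)
    ... | yes _ | yes _ | yes y3 | no ¬4 =
      not-after-gap (3 + a) wv off y3 ¬4 e (≤-reflexive 3+e) e (m+n≤o⇒m≤o∸n 1 (≤-trans (s≤s (s≤s (s≤s (s≤s z≤n)))) size≥6)) ≤-refl
        (subst (v ~_) (sym (trans (cong c eq) (periodic a))) va)
      where
      e = size ∸ 3
      3+e : 3 + e ≡ size
      3+e = m+[n∸m]≡n (≤-trans (s≤s (s≤s (s≤s z≤n))) size≥4)
      shuffle : ∀ e a → e + (3 + a) ≡ 3 + e + a
      shuffle = solve-∀
      eq : e + (3 + a) ≡ size + a
      eq = trans (shuffle e a) (cong (_+ a) 3+e)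

    no-square : ∀ {x y z w} → W x → W y → W z → W w → x ~ y → y ~ z → z ~ w → w ~ x → Far x z → Far y w → ⊥
    no-square {x} {y} {z} {w} wx wy wz ww xy yz zw wx′ xz yw = <⇒≱ (≤-trans (n≤1+n 5) size≥6) (shortest record
      { hub = x ; start = y ; rest = z ∷ w ∷ [] ; path = link yz (yw ∷ []) (link zw [] single) ; long = ≤-refl
      ; closeˡ = xy ; closeʳ = ~-sym wx′
      ; avoid = λ { (here refl) → ~⇒≢ xy , λ _ → inj₁ refl ; (there (here refl)) → proj₁ xz , λ a → ⊥-elim (proj₂ xz a)
                  ; (there (there (here refl))) → ~⇒≢ (~-sym wx′) , λ _ → inj₂ refl } }
      (wx ∷ wy ∷ wz ∷ ww ∷ []))

    -- The arc together with `y` and `x` is a hole of length `3 + e`. It is not shorter than the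
    -- ring, and `2 + e ≡ size` would make it odd.
    arc-hole : ∀ {x y} a e → W x → W y → Off x → Off y → x ~ y → x ~ c a → y ~ c (e + a) → 1 ≤ e → 2 + e ≤ size →
               (∀ j → 1 ≤ j → j ≤ e → ¬ x ~ c (j + a)) → (∀ j → j < e → ¬ y ~ c (j + a)) → 3 + e ≡ size
    arc-hole {x} {y} a e wx wy offx offy xy xa ye 1≤e e≤ ¬x ¬y = finish (m≤n⇒m<n∨m≡n e≤)
      where
      path : InducedPath (c a ∷ upTail a e ++ y ∷ [])
      path = snoc (up-path a e e≤) (subst (_~ y) (sym (up-last a e)) (~-sym ye)) cross
        where
        cross : ∀ {v} → v ∈ˡ c a ∷ upTail a e → v ≢ y × (v ~ y → v ≡ lastOf (c a) (upTail a e))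
        cross m with up-∈ a e m
        ... | j , hi , refl = (λ q → offy _ (sym q)) , λ b → [ (λ lt → ⊥-elim (¬y j lt (~-sym b))) , (λ { refl → sym (up-last a e) }) ]′ (m≤n⇒m<n∨m≡n hi)
      rest-length : length (upTail a e ++ y ∷ []) ≡ 1 + e
      rest-length = trans (length-++ (upTail a e)) (trans (cong (_+ 1) (up-length a e)) (+-comm e 1))
      C : Cycle
      C = record
        { hub = x ; start = c a ; rest = upTail a e ++ y ∷ [] ; path = path
        ; long = subst (2 ≤_) (sym rest-length) (s≤s 1≤e) ; closeˡ = xa
        ; closeʳ = subst (x ~_) (sym (lastOf-++ (c a) (upTail a e) y [])) xy
        ; avoid = λ m → avoid (∈-++⁻ (c a ∷ upTail a e) m) }
        where
        avoid : ∀ {v} → v ∈ˡ c a ∷ upTail a e ⊎ v ∈ˡ y ∷ [] → x ≢ v × (x ~ v → v ≡ c a ⊎ v ≡ lastOf (c a) (upTail a e ++ y ∷ []))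
        avoid (inj₂ (here refl)) = ~⇒≢ xy , λ _ → inj₂ (sym (lastOf-++ (c a) (upTail a e) y []))
        avoid (inj₁ m) with up-∈ a e m
        ... | zero , _ , refl = offx a , λ _ → inj₁ refl
        ... | suc j , hi , refl = offx _ , λ b → ⊥-elim (¬x (suc j) (s≤s z≤n) hi b)
      finish : 2 + e < size ⊎ 2 + e ≡ size → 3 + e ≡ size
      finish (inj₁ lt) = ≤-antisym lt (≤-trans (shortest C (wx ∷ All.++⁺ (up-inside a e) (wy ∷ []))) (≤-reflexive (cong (2 +_) rest-length)))
      finish (inj₂ eq) = contradiction (trans (sym (cycle-even C)) (trans (cong even? rest-length) (cong not e-even))) λ ()
        where
        e-even : even? e ≡ true
        e-even = trans (sym (Bool.not-involutive _)) (trans (cong even? eq) size-even)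

    at : ∀ {v i j} → i ≡ j → v ~ c i → v ~ c j
    at {v} e = subst (λ x → v ~ c x) e

    private
      p = size ∸ 1
      p≡ : suc p ≡ size
      p≡ = m+[n∸m]≡n (≤-trans (s≤s z≤n) size≥4)

      -- The number of steps on the arc from `c 3` to `c p`, the last vertex before `c 0`.
      e = size ∸ 4
      e+3 : e + 3 ≡ p
      e+3 = suc-injective (trans (sym (+-suc e 3)) (trans (m∸n+n≡m size≥4) (sym p≡)))
      bound : ∀ {j} → j ≤ e → j + 3 < size
      bound {j} hi = subst (suc (j + 3) ≤_) p≡ (s≤s (subst (j + 3 ≤_) e+3 (+-monoˡ-≤ 3 hi)))

    wrap : ∀ j → c (suc j + p) ≡ c j
    wrap j = trans (cong c (trans (sym (+-suc j p)) (trans (cong (j +_) p≡) (+-comm j size)))) (periodic j)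

    -- Every neighbour w of c 1 sees y: otherwise w, y, t and the ring contain a 4-hole, a claw or an
    -- odd hole.  Since y sees t and c 1 does not, this contradicts dominance.
    dominated : ∀ {y t} → W y → W t → Off y → Off t → y ~ c 0 → y ~ c 1 → y ~ c 2 → ¬ y ~ c 3 →
                t ~ c 2 → t ~ c 3 → ¬ t ~ c 1 → ¬ t ~ c 4 → y ~ t → ⊥
    dominated {y} {t} wy wt offy offt y0 y1 y2 ¬y3 t2 t3 ¬t1 ¬t4 yt =
      [ offt 1 , ¬t1 ]′ (dominant 0 wy offy y0 y1 y2 (λ d lo hi e → yfar d lo hi (at (+-identityʳ d) e)) smaller wt (inj₂ (~-sym yt)))
      where
      yfar : ∀ i → 3 ≤ i → i < size → ¬ y ~ c i
      yfar (suc d) (s≤s lo) hi yi with m≤n⇒m<n∨m≡n lo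
      ... | inj₂ refl = ¬y3 yi
      ... | inj₁ lo′ with m≤n⇒m<n∨m≡n hi
      ... | inj₁ hi′ = window 1 d wy offy y1 lo′ hi′ (at (+-comm 1 d) yi)
      ... | inj₂ eq = window (suc d) 3 wy offy yi ≤-refl size≥6
              (subst (y ~_) (sym (trans (cong c (trans (cong (2 +_) eq) (+-comm 2 size))) (periodic 2))) y2)
      tfar : ∀ i → 4 ≤ i → i < size → ¬ t ~ c i
      tfar (suc (suc (suc d))) (s≤s (s≤s (s≤s lo))) hi ti with m≤n⇒m<n∨m≡n lo
      ... | inj₂ refl = ¬t4 ti
      ... | inj₁ lo′ with m≤n⇒m<n∨m≡n lo′
      ... | inj₂ refl = window 2 3 wt offt t2 ≤-refl size≥6 ti
      ... | inj₁ lo″ = window 3 d wt offt t3 lo″ (<⇒≤ hi) (at (+-comm 3 d) ti)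
      smaller : ∀ {w} → W w → Near (c 1) w → Near y w
      smaller ww (inj₁ refl) = inj₂ (~-sym y1)
      smaller {w} ww (inj₂ w1) with w ≟ y | w ~? y
      ... | yes e | _ = inj₁ e
      ... | no _ | yes a = inj₂ a
      ... | no w≢y | no ¬wy = ⊥-elim contra
        where
        offw : Off w
        offw j refl with reindex 0 j
        ... | zero , _ , eq , _ = ¬wy (subst (_~ y) (sym (eq 0)) (~-sym y0))
        ... | suc zero , _ , eq , _ = ~-irr (subst (_~ c 1) (eq 0) w1)
        ... | suc (suc zero) , _ , eq , _ = ¬wy (subst (_~ y) (sym (eq 0)) (~-sym y2))
        ... | suc (suc (suc d)) , lt , eq , _ = chordless (2 + d) 1 (s≤s (s≤s z≤n)) lt
                (subst (c 1 ~_) (trans (eq 0) (cong c (trans (+-identityʳ _) (+-comm 1 (2 + d))))) (~-sym w1))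
        ¬wt : ¬ w ~ t
        ¬wt wt′ = no-square (inside 1) ww wt wy (~-sym w1) wt′ (~-sym yt) y1 ((λ e → offt 1 (sym e)) , λ a → ¬t1 (~-sym a)) (w≢y , ¬wy)
        w≢t : w ≢ t
        w≢t refl = ¬t1 w1
        contra : ⊥
        -- If `w` sees `c 2`, claws at `c 2` and `c 3` force it to see `c 3` and `c 4`, which is too
        -- far from `c 1`. Otherwise claws at `c 1` and `c 0` force it to see `c 0` and `c p`.
        contra with w ~? c 2
        ... | yes w2 = window 1 3 ww offw w1 ≤-refl size≥6 w4
          where
          w3 : w ~ c 3
          w3 = claw (~-sym y2) (~-sym w2) (next 2) (≢-sym w≢y , λ a → ¬wy (~-sym a)) (offy 3 , ¬y3) (offw 3)
          w4 : w ~ c 4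
          w4 = claw (~-sym t3) (~-sym w3) (next 3) (≢-sym w≢t , λ a → ¬wt (~-sym a)) (offt 4 , ¬t4) (offw 4)
        ... | no ¬w2 = contradiction (trans (sym (cycle-even C)) (trans (cong even? rest-length) (Bool.not-injective (trans (cong even? p≡) size-even)))) λ ()
          where
          p<size : p < size
          p<size = ≤-reflexive p≡
          w0 : w ~ c 0
          w0 = claw (next 1) (~-sym w1) (~-sym (next 0)) ((λ q → offw 2 (sym q)) , λ a → ¬w2 (~-sym a)) (Far-sym (apart 2 0 ≤-refl size≥4)) (offw 0)
          wp : w ~ c p
          wp = claw (~-sym y0) (~-sym w0) (subst (c 0 ~_) (cong c (+-identityʳ p)) (prev 0)) (≢-sym w≢y , λ a → ¬wy (~-sym a))
                 (offy p , yfar p (≤-trans (s≤s (s≤s (s≤s z≤n))) (m+n≤o⇒m≤o∸n 5 size≥6)) p<size) (offw p)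
          wfar : ∀ i → 3 ≤ i → 2 + i ≤ size → ¬ w ~ c i
          wfar (suc d) (s≤s lo) hi wi with m≤n⇒m<n∨m≡n lo
          ... | inj₂ refl = window 0 3 ww offw w0 ≤-refl size≥6 wi
          ... | inj₁ lo′ = window 1 d ww offw w1 lo′ hi (at (+-comm 1 d) wi)
          tri : InducedPath (w ∷ c 1 ∷ y ∷ [])
          tri = link w1 ((w≢y , ¬wy) ∷ []) (link (~-sym y1) [] single)
          arc : InducedPath (c 3 ∷ upTail 3 e)
          arc = up-path 3 e (subst (_≤ size) (+-comm e 2) (≤-trans (+-monoʳ-≤ e (n≤1+n 2)) (≤-trans (≤-reflexive e+3) (<⇒≤ p<size))))
          arc-last : lastOf (c 3) (upTail 3 e) ≡ c p
          arc-last = trans (up-last 3 e) (cong c e+3)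
          cross : ∀ {u v} → u ∈ˡ c 3 ∷ upTail 3 e → v ∈ˡ w ∷ c 1 ∷ y ∷ [] → u ≢ v × (u ~ v → u ≡ lastOf (c 3) (upTail 3 e) × v ≡ w)
          cross m m′ with up-∈ 3 e m
          cross m (here refl) | j , hi , refl = (λ q → offw _ (sym q)) , λ a → only-end (m≤n⇒m<n∨m≡n hi) (~-sym a) , refl
            where
            only-end : j < e ⊎ j ≡ e → w ~ c (j + 3) → c (j + 3) ≡ lastOf (c 3) (upTail 3 e)
            only-end (inj₂ refl) _ = sym (up-last 3 e)
            only-end (inj₁ lt) a = ⊥-elim (wfar (j + 3) (m≤n+m 3 j) (bound lt) a)
          cross m (there (here refl)) | j , hi , refl =
            (λ q → distinct (j + 2) 1 (≤-trans (s≤s z≤n) (m≤n+m 2 j)) (<-trans (≤-reflexive (sym (+-suc j 2))) (bound hi)) (trans (sym q) (cong c (sym (+-assoc j 2 1))))) ,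
            λ a → ⊥-elim (chordless (j + 2) 1 (m≤n+m 2 j) (subst (_≤ size) (cong suc (+-suc j 2)) (bound hi)) (subst (c 1 ~_) (cong c (sym (+-assoc j 2 1))) (~-sym a)))
          cross m (there (there (here refl))) | j , hi , refl =
            (λ q → offy _ (sym q)) , λ a → ⊥-elim (yfar (j + 3) (m≤n+m 3 j) (bound hi) (~-sym a))
          ends : lastOf (c 3) (upTail 3 e ++ w ∷ c 1 ∷ y ∷ []) ≡ y
          ends = lastOf-++ (c 3) (upTail 3 e) w (c 1 ∷ y ∷ [])
          rest-length : length (upTail 3 e ++ w ∷ c 1 ∷ y ∷ []) ≡ p
          rest-length = trans (length-++ (upTail 3 e)) (trans (cong (_+ 3) (up-length 3 e)) e+3)
          -- The hole t, c 3, ..., c p, w, c 1, y leaves out `c 0` and `c 2` and gains three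
          -- vertices: `size + 1` in all, hence odd.
          C : Cycle
          C = record
            { hub = t ; start = c 3 ; rest = upTail 3 e ++ w ∷ c 1 ∷ y ∷ []
            ; path = append arc tri (subst (_~ w) (sym arc-last) (~-sym wp)) cross
            ; long = subst (2 ≤_) (sym rest-length) (≤-trans (s≤s (s≤s z≤n)) (m+n≤o⇒m≤o∸n 3 size≥4))
            ; closeˡ = t3 ; closeʳ = subst (t ~_) (sym ends) (~-sym yt)
            ; avoid = λ m → avoid (∈-++⁻ (c 3 ∷ upTail 3 e) m) }
            where
            avoid : ∀ {v} → v ∈ˡ c 3 ∷ upTail 3 e ⊎ v ∈ˡ w ∷ c 1 ∷ y ∷ [] → t ≢ v × (t ~ v → v ≡ c 3 ⊎ v ≡ lastOf (c 3) (upTail 3 e ++ w ∷ c 1 ∷ y ∷ []))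
            avoid (inj₂ (here refl)) = ≢-sym w≢t , λ a → ⊥-elim (¬wt (~-sym a))
            avoid (inj₂ (there (here refl))) = offt 1 , λ a → ⊥-elim (¬t1 a)
            avoid (inj₂ (there (there (here refl)))) = ~⇒≢ (~-sym yt) , λ _ → inj₂ (sym ends)
            avoid (inj₁ m) with up-∈ 3 e m
            ... | zero , _ , refl = offt 3 , λ _ → inj₁ refl
            ... | suc j , hi , refl = offt _ , λ a → ⊥-elim (tfar (suc j + 3) (s≤s (m≤n+m 3 j)) (bound hi) a)

    far-after : ∀ {x} j → W x → Off x → x ~ c 0 → 3 ≤ j → 3 + j ≤ size → ¬ x ~ c j
    far-after j wx offx x0 lo hi a = window 0 j wx offx x0 lo hi (at (sym (+-identityʳ j)) a)

    far-before : ∀ {y} j k → W y → Off y → y ~ c k → 3 + j ≤ k → 3 + k ≤ size → ¬ y ~ c j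
    far-before j k wy offy yk lo hi a = window j (k ∸ j) wy offy a (m+n≤o⇒m≤o∸n 3 lo) (≤-trans (+-monoʳ-≤ 3 (m∸n≤m k j)) hi)
      (at (sym (m∸n+n≡m (≤-trans (m≤n+m j 3) lo))) yk)

    -- By `window` the neighbours of `x` on this arc are among `c 0`, `c 1`, `c 2`. `firstOn` is the
    -- counterpart at the other end of the arc.
    lastOn : ∀ {x} k → W x → Off x → x ~ c 0 → 3 + k ≤ size → ∃[ α ] α ≤ 2 × x ~ c α × (∀ j → α < j → j ≤ k → ¬ x ~ c j)
    lastOn {x} k wx offx x0 k≤ with x ~? c 2 | x ~? c 1
    ... | yes x2 | _ = 2 , ≤-refl , x2 , λ j lo hi → far-after j wx offx x0 lo (≤-trans (+-monoʳ-≤ 3 hi) k≤)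
    ... | no ¬x2 | yes x1 = 1 , s≤s z≤n , x1 , beyond
      where
      beyond : ∀ j → 2 ≤ j → j ≤ k → ¬ x ~ c j
      beyond j lo hi with m≤n⇒m<n∨m≡n lo
      ... | inj₂ refl = ¬x2
      ... | inj₁ lo′ = far-after j wx offx x0 lo′ (≤-trans (+-monoʳ-≤ 3 hi) k≤)
    ... | no ¬x2 | no ¬x1 = 0 , z≤n , x0 , beyond
      where
      beyond : ∀ j → 1 ≤ j → j ≤ k → ¬ x ~ c j
      beyond (suc zero) _ _ = ¬x1
      beyond (suc (suc zero)) _ _ = ¬x2
      beyond j@(suc (suc (suc _))) _ hi = far-after j wx offx x0 (s≤s (s≤s (s≤s z≤n))) (≤-trans (+-monoʳ-≤ 3 hi) k≤)

    firstOn : ∀ {y} k → W y → Off y → y ~ c (2 + k) → 5 + k ≤ size →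
              ∃[ β ] k ≤ β × β ≤ 2 + k × y ~ c β × (∀ j → j < β → ¬ y ~ c j)
    firstOn {y} k wy offy yk k≤ with y ~? c k | y ~? c (1 + k)
    ... | yes y0 | _ = k , ≤-refl , m≤n+m k 2 , y0 , λ j lt → far-before j (2 + k) wy offy yk (s≤s (s≤s lt)) k≤
    ... | no ¬y0 | yes y1 = 1 + k , n≤1+n k , n≤1+n _ , y1 , before
      where
      before : ∀ j → j < 1 + k → ¬ y ~ c j
      before j (s≤s le) with m≤n⇒m<n∨m≡n le
      ... | inj₂ refl = ¬y0
      ... | inj₁ lt = far-before j (2 + k) wy offy yk (s≤s (s≤s lt)) k≤
    ... | no ¬y0 | no ¬y1 = 2 + k , m≤n+m k 2 , ≤-refl , yk , before
      where
      before : ∀ j → j < 2 + k → ¬ y ~ c j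
      before j (s≤s le) with m≤n⇒m<n∨m≡n le
      ... | inj₂ refl = ¬y1
      ... | inj₁ (s≤s le′) with m≤n⇒m<n∨m≡n le′
      ... | inj₂ refl = ¬y0
      ... | inj₁ lt = far-before j (2 + k) wy offy yk (s≤s (s≤s lt)) k≤

    -- If x leaves the arc from c 0 to c (2 + k) before y enters it, the two close a hole that is too short.
    squeeze : ∀ {x y} k → W x → W y → Off x → Off y → x ~ y → x ~ c 0 → y ~ c (2 + k) → 2 ≤ k → 6 + k ≤ size → k ≡ 2 × x ~ c 2 × y ~ c 2
    squeeze {x} {y} k wx wy offx offy xy x0 yk 2≤k k≤
      with lastOn (2 + k) wx offx x0 (≤-trans (n≤1+n _) k≤) | firstOn k wy offy yk (≤-trans (n≤1+n _) k≤)
    ... | α , α≤2 , xα , ¬x | β , k≤β , β≤ , yβ , ¬y with α <? β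
    ... | no ¬lt = ≤-antisym (≤-trans k≤β (≤-trans (≮⇒≥ ¬lt) α≤2)) 2≤k
                 , at (≤-antisym α≤2 (≤-trans 2≤k (≤-trans k≤β (≮⇒≥ ¬lt)))) xα
                 , at (≤-antisym (≤-trans (≮⇒≥ ¬lt) α≤2) (≤-trans 2≤k k≤β)) yβ
    ... | yes lt = ⊥-elim (1+n≰n (≤-trans k≤ (≤-trans (≤-reflexive (sym total)) (+-monoʳ-≤ 3 δ≤))))
      where
      δ = β ∸ α
      δ≤ : δ ≤ 2 + k
      δ≤ = ≤-trans (m∸n≤m β α) β≤
      δ+α : δ + α ≡ β
      δ+α = m∸n+n≡m (<⇒≤ lt)
      total : 3 + δ ≡ size
      total = arc-hole α δ wx wy offx offy xy xα (at (sym δ+α) yβ) (m<n⇒0<n∸m lt)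
        (≤-trans (+-monoʳ-≤ 2 δ≤) (≤-trans (m≤n+m _ 2) k≤))
        (λ j lo hi → ¬x (j + α) (+-monoˡ-≤ α lo) (≤-trans (subst (j + α ≤_) δ+α (+-monoˡ-≤ α hi)) β≤))
        (λ j lt′ → ¬y (j + α) (subst (j + α <_) δ+α (+-monoˡ-< α lt′)))

    -- Every other pattern closes, through `x` and `y`, a hole of a length that `arc-hole` rules
    -- out: four or five if one of them misses `c 1`, `size - 1` along the arc from `c 3` to `c p`
    -- if both arms are present, and `size + 1` along the arc from `c 2` round to `c 0` if both are
    -- absent.
    pinch : ∀ {x y} → W x → W y → Off x → Off y → x ~ y → x ~ c 0 → ¬ x ~ c 2 → y ~ c 2 → ¬ y ~ c 0 →
            x ~ c 1 × y ~ c 1 × (x ~ c p × ¬ y ~ c 3 ⊎ y ~ c 3 × ¬ x ~ c p)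
    pinch {x} {y} wx wy offx offy xy x0 ¬x2 y2 ¬y0 = x1 , y1 , arms
      where
      size≠ : ∀ {k} → k ≤ 5 → k ≢ size
      size≠ le e = 1+n≰n (≤-trans size≥6 (≤-trans (≤-reflexive (sym e)) le))
      x1 : x ~ c 1
      x1 = decidable-stable (x ~? c 1) λ ¬x1 → case-y1 ¬x1
             λ { zero () _ ; (suc zero) _ _ → ¬x1 ; (suc (suc zero)) _ _ → ¬x2 ; (suc (suc (suc _))) _ (s≤s (s≤s ())) }
        where
        case-y1 : ¬ x ~ c 1 → (∀ j → 1 ≤ j → j ≤ 2 → ¬ x ~ c j) → ⊥
        case-y1 ¬x1 ¬x with y ~? c 1
        ... | yes y1 = size≠ (n≤1+n 4) (arc-hole 0 1 wx wy offx offy xy x0 y1 ≤-refl (≤-trans (n≤1+n 3) size≥4)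
                        (λ { (suc zero) _ _ → ¬x1 ; zero () _ ; (suc (suc _)) _ (s≤s ()) }) (λ { zero _ → ¬y0 ; (suc _) (s≤s ()) }))
        ... | no ¬y1 = size≠ ≤-refl (arc-hole 0 2 wx wy offx offy xy x0 y2 (s≤s z≤n) size≥4
                        (λ j lo hi → ¬x (j + 0) (≤-trans lo (≤-reflexive (sym (+-identityʳ j)))) (≤-trans (≤-reflexive (+-identityʳ j)) hi))
                        (λ { zero _ → ¬y0 ; (suc zero) _ → ¬y1 ; (suc (suc _)) (s≤s (s≤s ())) }))
      y1 : y ~ c 1
      y1 = decidable-stable (y ~? c 1) λ ¬y1 → size≠ (n≤1+n 4) (arc-hole 1 1 wx wy offx offy xy x1 y2 ≤-refl (≤-trans (n≤1+n 3) size≥4)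
             (λ { (suc zero) _ _ → ¬x2 ; zero () _ ; (suc (suc _)) _ (s≤s ()) }) (λ { zero _ → ¬y1 ; (suc _) (s≤s ()) }))
      yfar : ∀ i → 4 ≤ i → i < size → ¬ y ~ c i
      yfar (suc (suc d)) (s≤s (s≤s lo)) hi yi with m≤n⇒m<n∨m≡n lo
      ... | inj₂ refl = window 1 3 wy offy y1 ≤-refl size≥6 yi
      ... | inj₁ lo′ = window 2 d wy offy y2 lo′ hi (at (+-comm 2 d) yi)
      xfar : ∀ i → 2 ≤ i → 2 + i ≤ size → ¬ x ~ c i
      xfar i lo hi xi with m≤n⇒m<n∨m≡n lo
      ... | inj₂ refl = ¬x2 xi
      ... | inj₁ lo′ with m≤n⇒m<n∨m≡n hi
      ... | inj₁ hi′ = window 0 i wx offx x0 lo′ hi′ (at (sym (+-identityʳ i)) xi)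
      ... | inj₂ eq = window i 3 wx offx xi ≤-refl size≥6 (subst (x ~_) (sym (trans (cong c (trans (cong suc eq) (+-comm 1 size))) (periodic 1))) x1)
      arms : x ~ c p × ¬ y ~ c 3 ⊎ y ~ c 3 × ¬ x ~ c p
      arms with x ~? c p | y ~? c 3
      ... | yes xp | no ¬y3 = inj₁ (xp , ¬y3)
      ... | no ¬xp | yes y3 = inj₂ (y3 , ¬xp)
      ... | yes xp | yes y3 = ⊥-elim (1+n≰n (≤-reflexive (trans (cong suc e+3) (trans p≡ (trans (sym total) (+-comm 3 e))))))
        where
        total : 3 + e ≡ size
        total = arc-hole 3 e wy wx offy offx (~-sym xy) y3 (at (sym e+3) xp) (m+n≤o⇒m≤o∸n 1 (≤-trans (n≤1+n 5) size≥6))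
          (subst (_≤ size) (+-comm e 2) (≤-trans (+-monoʳ-≤ e (n≤1+n 2)) (≤-trans (≤-reflexive e+3) (≤-trans (n≤1+n p) (≤-reflexive p≡)))))
          (λ j lo hi → yfar (j + 3) (+-monoˡ-≤ 3 lo) (bound hi))
          (λ j lt → xfar (j + 3) (≤-trans (n≤1+n 2) (m≤n+m 3 j)) (bound lt))
      ... | no ¬xp | no ¬y3 = ⊥-elim (1+n≰n (≤-reflexive (trans total (sym 2+ε))))
        where
        ε = size ∸ 2
        2+ε : 2 + ε ≡ size
        2+ε = m+[n∸m]≡n (≤-trans (s≤s (s≤s z≤n)) size≥4)
        y-beyond : ∀ j → 1 ≤ j → j ≤ ε → ¬ y ~ c (j + 2)
        y-beyond (suc zero) _ _ = ¬y3
        y-beyond (suc (suc j)) _ hi a with m≤n⇒m<n∨m≡n hi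
        ... | inj₁ lt = yfar (2 + j + 2) (s≤s (s≤s (m≤n+m 2 j))) (subst (2 + j + 2 <_) (trans (+-comm ε 2) 2+ε) (+-monoˡ-< 2 lt)) a
        ... | inj₂ eq = ¬y0 (subst (y ~_) (trans (cong c (trans (cong (_+ 2) eq) (trans (+-comm ε 2) (trans 2+ε (sym (+-identityʳ size)))))) (periodic 0)) a)
        x-before : ∀ j → j < ε → ¬ x ~ c (j + 2)
        x-before j lt a with m≤n⇒m<n∨m≡n lt
        ... | inj₁ lt′ = xfar (j + 2) (m≤n+m 2 j) (subst (2 + (j + 2) ≤_) (trans (+-comm ε 2) 2+ε) (+-monoˡ-≤ 2 lt′)) a
        ... | inj₂ eq = ¬xp (at (suc-injective (trans (cong (_+ 2) eq) (trans (+-comm ε 2) (trans 2+ε (sym p≡))))) a)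
        total : 3 + ε ≡ size
        total = arc-hole 2 ε wy wx offy offx (~-sym xy) y2
          (subst (x ~_) (sym (trans (cong c (trans (+-comm ε 2) (trans 2+ε (sym (+-identityʳ size))))) (periodic 0))) x0)
          (m+n≤o⇒m≤o∸n 1 (≤-trans (n≤1+n 3) size≥4)) (≤-reflexive 2+ε) y-beyond x-before

    -- The vertex `c j` precedes or follows `c 0`. As `k` and `size` are even, being non-adjacent to
    -- `c k` puts it at distance at least three from `c k` both ways, and `window` applies.
    ring-end : ∀ {y} j k → even? k ≡ true → 2 ≤ k → 2 + k ≤ size → W y → Off y →
               c j ~ c 0 → ¬ c j ~ c k → y ~ c k → ¬ y ~ c j
    ring-end {y} j k ek 2≤k k≤ wy offy j0 ¬jk yk yj with reindex 0 j
    ... | d , lt , eq , _ = neighbour d lt (trans (eq 0) (cong c (+-identityʳ d)))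
      where
      neighbour : ∀ d → d < size → c j ≡ c d → ⊥
      neighbour d lt e with gap d 0 lt (subst (c 0 ~_) (trans e (cong c (sym (+-identityʳ d)))) (~-sym j0))
      ... | inj₁ refl = above k ek 2≤k k≤ ¬jk yk
        where
        above : ∀ k → even? k ≡ true → 2 ≤ k → 2 + k ≤ size → ¬ c j ~ c k → y ~ c k → ⊥
        above (suc (suc zero)) _ _ _ ¬jk _ = ¬jk (subst (_~ c 2) (sym e) (next 1))
        above (suc (suc (suc zero))) () _ _ _ _
        above (suc (suc (suc (suc k)))) _ _ k≤ _ yk = window 1 (3 + k) wy offy (subst (y ~_) e yj) (s≤s (s≤s (s≤s z≤n))) k≤ (at (+-comm 1 (3 + k)) yk)
        above (suc zero) _ (s≤s ()) _ _ _
      ... | inj₂ sd = below (m≤n⇒m<n∨m≡n k≤)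
        where
        yp : y ~ c p
        yp = subst (y ~_) (trans e (cong c (suc-injective (trans sd (sym p≡))))) yj
        below : 2 + k < size ⊎ 2 + k ≡ size → ⊥
        below (inj₂ eq) = ¬jk (subst (_~ c k) (sym (trans e (cong c (suc-injective (trans sd (sym eq)))))) (~-sym (next k)))
        below (inj₁ lt) with m≤n⇒m<n∨m≡n lt
        ... | inj₂ eq′ = contradiction (trans (sym (trans (cong even? eq′) size-even)) (cong (not ∘ not ∘ not) ek)) λ ()
        ... | inj₁ lt′ = window k (p ∸ k) wy offy yk (m+n≤o⇒m≤o∸n 3 (s≤s⁻¹ (subst (4 + k ≤_) (sym p≡) lt′)))
                (subst (3 + (p ∸ k) ≤_) p≡ (s≤s (≤-trans (+-monoˡ-≤ (p ∸ k) 2≤k) (≤-reflexive (m+[n∸m]≡n k≤p)))))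
                (at (sym (m∸n+n≡m k≤p)) yp)
          where
          k≤p : k ≤ p
          k≤p = s≤s⁻¹ (subst (suc k ≤_) (sym p≡) (≤-trans (n≤1+n _) k≤))

  module _ {W : V → Set} where

    -- The two outcomes of `pinch` are mirror images. In either, one vertex sees three consecutive
    -- ring vertices and the other sees the third of them and the next one. Rotating the ring so
    -- that it starts at `c p`, or reversing it from `c 3`, brings this into the form refuted by
    -- `dominated`.
    no-P4-step : ∀ {x y} R → Tight W R → (let open Ring R) → W x → W y → (∀ j → x ≢ c j) → (∀ j → y ≢ c j) → x ~ y →
                 x ~ c 0 → ¬ x ~ c 2 → y ~ c 2 → ¬ y ~ c 0 → ⊥
    no-P4-step {x} {y} R T wx wy offx offy xy x0 ¬x2 y2 ¬y0 with TightRing.pinch R T wx wy offx offy xy x0 ¬x2 y2 ¬y0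
    ... | x1 , y1 , inj₁ (xp , ¬y3) = TightRing.dominated (shift p R) (tight-shift p T) wx wy (λ j → offx _) (λ j → offy _)
      xp (to 0 x0) (to 1 x1) (¬x2 ∘ from 2) (to 1 y1) (to 2 y2) (¬y0 ∘ from 0) (¬y3 ∘ from 3) xy
      where
      open Ring R
      p = size ∸ 1
      to : ∀ {v} j → v ~ c j → v ~ c (suc j + p)
      to {v} j = subst (v ~_) (sym (TightRing.wrap R T j))
      from : ∀ {v} j → v ~ c (suc j + p) → v ~ c j
      from {v} j = subst (v ~_) (TightRing.wrap R T j)
    ... | x1 , y1 , inj₂ (y3 , ¬xp) = TightRing.dominated (M.mirror) (M.tight-mirror T) wy wx (λ j → offy _) (λ j → offx _)
      (subst (y ~_) (sym r0) y3) (subst (y ~_) (sym r1) y2) (subst (y ~_) (sym r2) y1) (¬y0 ∘ subst (y ~_) r3)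
      (subst (x ~_) (sym r2) x1) (subst (x ~_) (sym r3) x0) (¬x2 ∘ subst (x ~_) r1) (¬xp ∘ subst (x ~_) r4) (~-sym xy)
      where
      open Ring R
      module M = Mirror R 3
      p = size ∸ 1
      r0 : Ring.c M.mirror 0 ≡ c 3
      r0 = cong (λ z → c (z + 3)) (*-zeroʳ p)
      back : ∀ k i → k ≤ size → k + i ≡ 3 → c ((size ∸ k) + 3) ≡ c i
      back k i le eq = trans (cong c (trans (cong ((size ∸ k) +_) (sym eq)) (trans (sym (+-assoc (size ∸ k) k i)) (cong (_+ i) (m∸n+n≡m le))))) (periodic i)
      le1 : 1 ≤ size
      le1 = ≤-trans (s≤s z≤n) size≥4
      le2 : 2 ≤ size
      le2 = ≤-trans (s≤s (s≤s z≤n)) size≥4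
      le3 : 3 ≤ size
      le3 = ≤-trans (n≤1+n 3) size≥4
      r1 : Ring.c M.mirror 1 ≡ c 2
      r1 = trans (M.mirror-at 1 ≤-refl le1) (back 1 2 le1 refl)
      r2 : Ring.c M.mirror 2 ≡ c 1
      r2 = trans (M.mirror-at 2 (s≤s z≤n) le2) (back 2 1 le2 refl)
      r3 : Ring.c M.mirror 3 ≡ c 0
      r3 = trans (M.mirror-at 3 (s≤s z≤n) le3) (back 3 0 le3 refl)
      r4 : Ring.c M.mirror 4 ≡ c p
      r4 = trans (M.mirror-at 4 (s≤s z≤n) size≥4) (cong c (suc-injective (trans (sym (+-suc (size ∸ 4) 3)) (trans (m∸n+n≡m size≥4) (sym (m+[n∸m]≡n le1))))))

    -- One of `x`, `y` on the ring is excluded by `ring-end`, both by parity. If both are off the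
    -- ring, the extreme values `2` and `size - 2` of `k` reduce to `no-P4-step`. In between,
    -- `squeeze` on one side forces `k = 4` and `y ~ c 2`, on the other side `y ~ c 6`, and `window`
    -- separates these two.
    no-P4-ring : ∀ {x y} R → Tight W R → (let open Ring R) → ∀ k → even? k ≡ true → 2 ≤ k → 2 + k ≤ size → W x → W y → x ~ y →
                 x ~ c 0 → ¬ x ~ c k → y ~ c k → ¬ y ~ c 0 → ⊥
    no-P4-ring {x} {y} R T k ek 2≤k k≤ wx wy xy x0 ¬xk yk ¬y0 = run do
      no offx ← lem (∃[ j ] x ≡ c j)
        where yes (i , xi) → do
                no offy ← lem (∃[ j ] y ≡ c j)
                  where yes (j , yj) → return (both-on xi yj)
                contradiction (subst (y ~_) xi (~-sym xy)) (ring-end i k ek 2≤k k≤ wy (λ j e → offy (j , e)) (subst (_~ c 0) xi x0) (λ a → ¬xk (subst (_~ c k) (sym xi) a)) yk)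
      no offy ← lem (∃[ j ] y ≡ c j)
        where yes (j , yj) → do
                let d , _ , eq , _ = reindex k j
                    y≡ = trans yj (eq 0)
                contradiction (subst (x ~_) y≡ xy) (TightRing.ring-end (shift k R) (tight-shift k T) d (size ∸ k) even-rest rest≥2 (subst (_≤ size) (+-comm (size ∸ k) 2) (≤-trans (+-monoʳ-≤ (size ∸ k) 2≤k) (≤-reflexive rest))) wx (λ j e → offx (j + k , e))
                  (subst (_~ c k) y≡ yk) (λ a → ¬y0 (subst (_~ c 0) (sym y≡) (subst (c (d + k) ~_) c-rest a))) (subst (x ~_) (sym c-rest) x0))
      return (off k ek 2≤k k≤ (λ j e → offx (j , e)) (λ j e → offy (j , e)) ¬xk yk)
      where
      open TightRing R T
      open RingProperties R
      rest : (size ∸ k) + k ≡ size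
      rest = m∸n+n≡m (≤-trans (m≤n+m k 2) k≤)
      c-rest : c ((size ∸ k) + k) ≡ c 0
      c-rest = trans (cong c (trans rest (sym (+-identityʳ size)))) (periodic 0)
      rest≥2 : 2 ≤ size ∸ k
      rest≥2 = m+n≤o⇒m≤o∸n 2 k≤
      even-rest : even? (size ∸ k) ≡ true
      even-rest = trans (sym (even?-+ k (size ∸ k) ek)) (trans (cong even? (trans (+-comm k _) rest)) size-even)
      both-on : ∀ {i j} → x ≡ c i → y ≡ c j → ⊥
      both-on {i} {j} refl refl = parity-adj size-even xy (trans (¬even⇒odd {i} (λ e → parity-adj size-even x0 e)) (sym (¬even⇒odd {j} (λ e → parity-adj size-even yk (trans e (sym ek))))))
      off : ∀ k → even? k ≡ true → 2 ≤ k → 2 + k ≤ size → Off x → Off y → ¬ x ~ c k → y ~ c k → ⊥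
      off (suc zero) _ (s≤s ()) _ _ _ _ _
      off (suc (suc zero)) ek 2≤k k≤ offx offy ¬xk yk = no-P4-step R T wx wy offx offy xy x0 ¬xk yk ¬y0
      off (suc (suc (suc zero))) () _ _ _ _ _ _
      off K@(suc (suc k@(suc (suc _)))) ek 2≤k k≤ offx offy ¬xk yk with m≤n⇒m<n∨m≡n k≤
      ... | inj₂ eq = no-P4-step (shift K R) (tight-shift K T) wy wx (λ j → offy _) (λ j → offx _) (~-sym xy) yk
              (λ a → ¬y0 (subst (y ~_) c2 a)) (subst (x ~_) (sym c2) x0) ¬xk
        where
        c2 : c (2 + K) ≡ c 0
        c2 = trans (cong c (trans eq (sym (+-identityʳ size)))) (periodic 0)
      ... | inj₁ lt with m≤n⇒m<n∨m≡n lt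
      ... | inj₂ eq = contradiction (trans (sym (trans (cong even? eq) size-even)) (cong (not ∘ not ∘ not) ek)) λ ()
      ... | inj₁ lt′ with squeeze k wx wy offx offy xy x0 yk (s≤s (s≤s z≤n)) lt′
      ... | refl , _ , y2 = window 2 4 wy offy y2 (n≤1+n 3) (≤-trans (n≤1+n 7) lt′) y6
        where
        s = size ∸ 6
        6+s : 6 + s ≡ size
        6+s = m+[n∸m]≡n (≤-trans (m≤n+m 6 2) lt′)
        shuffle : ∀ s → 2 + s + 4 ≡ 6 + s
        shuffle = solve-∀
        y6 : y ~ c 6
        y6 = proj₁ (proj₂ (TightRing.squeeze (shift 4 R) (tight-shift 4 T) s wy wx (λ j → offy _) (λ j → offx _) (~-sym xy) yk
          (subst (x ~_) (sym (trans (cong c (trans (shuffle s) (trans 6+s (sym (+-identityʳ size))))) (periodic 0))) x0)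
          (m+n≤o⇒m≤o∸n 2 lt′) (≤-reflexive 6+s)))

-- Monotonicity of counts and sums, for comparing degree sums.

filter-≤ : {A : Set} {P Q : A → Set} (P? : Decidable P) (Q? : Decidable Q) → (∀ {x} → P x → Q x) →
           ∀ xs → length (filter P? xs) ≤ length (filter Q? xs)
filter-≤ P? Q? sub [] = z≤n
filter-≤ P? Q? sub (x ∷ xs) with P? x | Q? x
... | yes _  | yes _ = s≤s (filter-≤ P? Q? sub xs)
... | yes px | no ¬q = contradiction (sub px) ¬q
... | no _   | yes _ = m≤n⇒m≤1+n (filter-≤ P? Q? sub xs)
... | no _   | no _  = filter-≤ P? Q? sub xs

filter-< : {A : Set} {P Q : A → Set} (P? : Decidable P) (Q? : Decidable Q) → (∀ {x} → P x → Q x) →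
           ∀ {x xs} → x ∈ˡ xs → ¬ P x → Q x → length (filter P? xs) < length (filter Q? xs)
filter-< P? Q? sub {x} {_ ∷ xs} (here refl) ¬p q with P? x | Q? x
... | yes p | _    = contradiction p ¬p
... | no _ | no ¬q = contradiction q ¬q
... | no _ | yes _ = s≤s (filter-≤ P? Q? sub xs)
filter-< P? Q? sub {x} {y ∷ xs} (there m) ¬p q with P? y | Q? y
... | yes _  | yes _ = s≤s (filter-< P? Q? sub m ¬p q)
... | yes py | no ¬q = contradiction (sub py) ¬q
... | no _   | yes _ = m≤n⇒m≤1+n (filter-< P? Q? sub m ¬p q)
... | no _   | no _  = filter-< P? Q? sub m ¬p q

sumTo : ℕ → (ℕ → ℕ) → ℕ
sumTo zero    f = 0
sumTo (suc k) f = f k + sumTo k f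

sumTo-≤ : ∀ k {f g} → (∀ i → f i ≤ g i) → sumTo k f ≤ sumTo k g
sumTo-≤ zero    le = z≤n
sumTo-≤ (suc k) le = +-mono-≤ (le k) (sumTo-≤ k le)

sumTo-< : ∀ k {f g j} → (∀ i → f i ≤ g i) → j < k → f j < g j → sumTo k f < sumTo k g
sumTo-< (suc k) {f} {g} {j} le lt strict with m≤n⇒m<n∨m≡n lt
... | inj₁ (s≤s lt′) = +-mono-≤-< (le k) (sumTo-< k le lt′ strict)
... | inj₂ refl = +-mono-<-≤ strict (sumTo-≤ k le)

-- The choice of the ring.

module GoodRings {n : ℕ} (G : Graph n) (claw-free : ClawFree G) (innocent : Innocent G) where
  open Paths G
  open Rings G
  open Antiholes G innocent
  open LongRings G claw-free innocent

  NoP4 : (V → Set) → V → V → Set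
  NoP4 W x y = ∀ {m m′} → W m → W m′ → x ~ m′ → m′ ~ m → m ~ y → ¬ x ~ m → ¬ m′ ~ y → ⊥

  NoP4-sym : ∀ {W x y} → NoP4 W x y → NoP4 W y x
  NoP4-sym noP4 wm wm′ ym′ m′m mx ¬ym ¬m′x = noP4 wm′ wm (~-sym mx) (~-sym m′m) (~-sym ym′) (¬m′x ∘ ~-sym) (¬ym ∘ ~-sym)

  module Replace (R : Ring) (i : ℕ) {y : V} (off : ∀ j → y ≢ Ring.c R j) (yi : y ~ Ring.c R i) (yi₂ : y ~ Ring.c R (2 + i))
                 (far : ∀ d → 3 ≤ d → d < Ring.size R → ¬ y ~ Ring.c R (d + i)) where
    open RingProperties R

    -- The substitution acts on vertices and not on indices, which keeps the sequence periodic.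
    replace : V → V
    replace v with v ≟ c (1 + i)
    ... | yes _ = y
    ... | no _  = v

    ring : Ring
    ring = record
      { size = size ; size≥4 = size≥4 ; c = replace ∘ c ; periodic = λ j → cong replace (periodic j)
      ; next = next′ ; distinct = distinct′ ; chordless = chordless′ }
      where
      p = size ∸ 1
      p≡ : suc p ≡ size
      p≡ = m+[n∸m]≡n (≤-trans (s≤s z≤n) size≥4)
      before : ∀ {j} → c (suc j) ≡ c (suc i) → c j ≡ c i
      before {j} e = trans (sym (wrap j)) (trans (same-index e p) (wrap i))
        where
        wrap : ∀ j → c (p + suc j) ≡ c j
        wrap j = trans (cong c (trans (+-suc p j) (cong (_+ j) p≡))) (periodic j)
      next′ : ∀ j → replace (c j) ~ replace (c (suc j))
      next′ j with c j ≟ c (1 + i) | c (suc j) ≟ c (1 + i)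
      ... | yes e | yes e′ = ⊥-elim (~-irr (subst₂ _~_ e e′ (next j)))
      ... | yes e | no _ = subst (y ~_) (sym (same-index e 1)) yi₂
      ... | no _ | yes e′ = subst (_~ y) (sym (before e′)) (~-sym yi)
      ... | no _ | no _ = next j
      distinct′ : ∀ k j → 1 ≤ k → k < size → replace (c j) ≢ replace (c (k + j))
      distinct′ k j lo hi with c j ≟ c (1 + i) | c (k + j) ≟ c (1 + i)
      ... | yes e | yes e′ = λ _ → distinct k j lo hi (trans e (sym e′))
      ... | yes _ | no _ = off (k + j)
      ... | no _ | yes _ = off j ∘ sym
      ... | no _ | no _ = distinct k j lo hi
      chordless′ : ∀ k j → 2 ≤ k → 2 + k ≤ size → ¬ replace (c j) ~ replace (c (k + j))
      chordless′ k j lo hi with c j ≟ c (1 + i) | c (k + j) ≟ c (1 + i)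
      ... | yes _ | yes _ = ~-irr
      ... | no _ | no _ = chordless k j lo hi
      ... | yes e | no _ = λ a → far (k + 1) (subst (3 ≤_) (+-comm 1 k) (s≤s lo)) (≤-trans (≤-reflexive (cong suc (+-comm k 1))) hi)
                                  (subst (y ~_) (trans (same-index e k) (cong c (sym (+-assoc k 1 i)))) a)
      ... | no ¬e | yes e′ = λ a → at-index (reindex i j) (~-sym a)
        where
        at-index : ∃[ d ] d < size × (∀ m → c (m + j) ≡ c (m + (d + i))) × (even? size ≡ true → even? (d + i) ≡ even? j) → ¬ y ~ c j
        at-index (zero , _ , eq , _) _ = same k lo hi e′ eq
          where
          same : ∀ k → 2 ≤ k → 2 + k ≤ size → c (k + j) ≡ c (1 + i) → (∀ m → c (m + j) ≡ c (m + i)) → ⊥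
          same (suc k) (s≤s lo) hi e′ eq = distinct k (1 + i) lo (≤-trans (n≤1+n _) (≤-trans (n≤1+n _) hi))
            (trans (sym e′) (trans (eq (suc k)) (cong c (sym (+-suc k i)))))
        at-index (suc zero , _ , eq , _) _ = ¬e (eq 0)
        at-index (suc (suc zero) , _ , eq , _) _ = distinct (k + 1) (1 + i) (subst (1 ≤_) (+-comm 1 k) (s≤s z≤n)) (≤-trans (≤-reflexive (cong suc (+-comm k 1))) hi)
          (trans (sym e′) (trans (eq k) (cong c (sym (+-assoc k 1 (suc i))))))
        at-index (suc (suc (suc d)) , lt , eq , _) a = far (3 + d) (s≤s (s≤s (s≤s z≤n))) lt (subst (y ~_) (eq 0) a)

  GoodRing : (V → Set) → Set
  GoodRing W = Σ Ring λ R → let open Ring R in (∀ i → W (c i)) ×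
               (∀ i j → even? i ≡ true → even? j ≡ true → c i ≢ c j → NoP4 W (c i) (c j))

  -- The opposite vertices `c 0` and `c 2` are traded for a central pair, which then supplies all
  -- alternate vertices of the new ring.
  square-ring : ∀ {W} (R : Ring) → (let open Ring R) → (∀ i → W (c i)) → size ≡ 4 → ¬ ¬ GoodRing W
  square-ring {W} R ins s4 = do
    x , y , cen , x1 , 1y , y3 , 3x ← central-square (ins 0) (ins 1) (ins 2) (ins 3) (next 0) (next 1) (next 2)
      (subst (c 3 ~_) (trans (cong c (trans (sym s4) (sym (+-identityʳ size)))) (periodic 0)) (next 3))
      (apart₂ 0) (apart₂ 1)
    return (good x y cen x1 1y y3 3x)
    where
    open RingProperties R
    good : ∀ x y → Central W x y → x ~ c 1 → c 1 ~ y → y ~ c 3 → c 3 ~ x → GoodRing W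
    good x y cen x1 1y y3 3x = fromHole H , inside , noP4
      where
      open Central cen
      C : Cycle
      C = record
        { hub = x ; start = c 1 ; rest = y ∷ c 3 ∷ [] ; path = link 1y (apart₂ 1 ∷ []) (link y3 [] single) ; long = ≤-refl
        ; closeˡ = x1 ; closeʳ = ~-sym 3x
        ; avoid = λ { (here refl) → ~⇒≢ x1 , λ _ → inj₁ refl ; (there (here refl)) → proj₁ far , λ a → ⊥-elim (proj₂ far a)
                    ; (there (there (here refl))) → ~⇒≢ (~-sym 3x) , λ _ → inj₂ refl } }
      H = cycle-hole C
      module F = RingProperties (fromHole H)
      inside : ∀ i → W (F.c i)
      inside i = All.lookup (inside₁ ∷ ins 1 ∷ inside₂ ∷ ins 3 ∷ []) (cycle-∈ C (let j , e = fromHole-∈ H i in j , sym e))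
      ends : ∀ i → even? i ≡ true → F.c i ≡ x ⊎ F.c i ≡ y
      ends i ev with F.reindex 0 i
      ... | zero , _ , eq , _ = inj₁ (eq 0)
      ... | suc zero , _ , eq , par = contradiction (trans (par refl) ev) λ ()
      ... | suc (suc zero) , _ , eq , _ = inj₂ (eq 0)
      ... | suc (suc (suc zero)) , _ , eq , par = contradiction (trans (par refl) ev) λ ()
      ... | suc (suc (suc (suc d))) , s≤s (s≤s (s≤s (s≤s ()))) , _
      noP4 : ∀ i j → even? i ≡ true → even? j ≡ true → F.c i ≢ F.c j → NoP4 W (F.c i) (F.c j)
      noP4 i j ei ej ne with ends i ei | ends j ej
      ... | inj₁ p | inj₁ q = contradiction (trans p (sym q)) ne
      ... | inj₂ p | inj₂ q = contradiction (trans p (sym q)) ne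
      ... | inj₁ p | inj₂ q = subst₂ (λ a b → NoP4 W a b) (sym p) (sym q) no-P4
      ... | inj₂ p | inj₁ q = subst₂ (λ a b → NoP4 W a b) (sym p) (sym q) (NoP4-sym {W} no-P4)

  long-ring : ∀ {W} (R₀ : Ring) → (∀ i → W (Ring.c R₀ i)) → 6 ≤ Ring.size R₀ →
              (∀ (C : Cycle) → All W (Cycle.hub C ∷ Cycle.start C ∷ Cycle.rest C) → Ring.size R₀ ≤ 2 + length (Cycle.rest C)) → ¬ ¬ GoodRing W
  long-ring {W} R₀ ins₀ six shortest = do
    W? ← finite-choice (λ v → lem (W v))
    R , (size≡ , ins) , best ← minimiser {P = λ R → Ring.size R ≡ Ring.size R₀ × (∀ i → W (Ring.c R i))} (weight W?) {x = R₀} (refl , ins₀)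
    return (R , ins , noP4 R (tight W? R size≡ ins (λ {R′} → best {R′})))
    where
    module _ (W? : ∀ v → Dec (W v)) where
      Close : V → V → Set
      Close v w = W w × Near v w
      close? : ∀ v → Decidable (¬_ ∘ Close v)
      close? v w = ¬? (W? w ×-dec (w ≟ v ⊎-dec w ~? v))
      -- Counting the vertices outside the closed neighbourhood in `W` turns the maximal degree sum
      -- into a minimum: a twin with a properly larger neighbourhood would lower `weight`.
      codegree : V → ℕ
      codegree v = length (filter (close? v) (allFin n))
      weight : Ring → ℕ
      weight R = sumTo (Ring.size R₀) (codegree ∘ Ring.c R)

      tight : ∀ R → Ring.size R ≡ Ring.size R₀ → (∀ i → W (Ring.c R i)) →
              (∀ {R′} → Ring.size R′ ≡ Ring.size R₀ × (∀ i → W (Ring.c R′ i)) → weight R ≤ weight R′) → Tight W R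
      tight R size≡ ins best = record
        { inside = ins ; size≥6 = subst (6 ≤_) (sym size≡) six ; shortest = λ C ws → subst (_≤ _) (sym size≡) (shortest C ws)
        ; dominant = λ i {y} wy off y₀ y₁ y₂ far sub {w} ww near → decidable-stable (w ≟ c (1 + i) ⊎-dec w ~? c (1 + i)) λ ¬near →
            let module Rep = Replace R i off y₀ y₂ far
                d , lt , eq , _ = reindex 0 (1 + i)
                at-d : c d ≡ c (1 + i)
                at-d = trans (cong c (sym (+-identityʳ d))) (sym (eq 0))
            in <⇒≱ (sumTo-< (Ring.size R₀) (λ j → lighter i y sub Rep.replace (c j) (Rep-spec i off y₀ y₂ far (c j)))
                     (subst (d <_) size≡ lt) (strictly i y sub ww near ¬near d at-d Rep.replace (Rep-spec i off y₀ y₂ far (c d))))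
                 (best {Rep.ring} (size≡ , λ j → inside′ i wy Rep.replace (c j) (ins j) (Rep-spec i off y₀ y₂ far (c j)))) }
        where
        open RingProperties R
        Spec : ℕ → V → V → V → Set
        Spec i y v v′ = (v ≡ c (1 + i) × v′ ≡ y) ⊎ (v ≢ c (1 + i) × v′ ≡ v)
        Rep-spec : ∀ i {y} (off : ∀ j → y ≢ c j) y₀ y₂ far v → Spec i y v (Replace.replace R i {y} off y₀ y₂ far v)
        Rep-spec i off y₀ y₂ far v with v ≟ c (1 + i)
        ... | yes e = inj₁ (e , refl)
        ... | no ne = inj₂ (ne , refl)
        inside′ : ∀ i {y} → W y → (f : V → V) → ∀ v → W v → Spec i y v (f v) → W (f v)
        inside′ i wy f v wv (inj₁ (_ , e)) = subst W (sym e) wy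
        inside′ i wy f v wv (inj₂ (_ , e)) = subst W (sym e) wv
        lighter : ∀ i y → (∀ {w} → W w → Near (c (1 + i)) w → Near y w) → (f : V → V) → ∀ v → Spec i y v (f v) → codegree (f v) ≤ codegree v
        lighter i y sub f v (inj₂ (_ , e)) = ≤-reflexive (cong codegree e)
        lighter i y sub f v (inj₁ (refl , e)) = subst (λ u → codegree u ≤ codegree v) (sym e)
          (filter-≤ (close? y) (close? v) (λ ¬cy (ww , nr) → ¬cy (ww , sub ww nr)) (allFin n))
        strictly : ∀ i y → (∀ {w} → W w → Near (c (1 + i)) w → Near y w) → ∀ {w} → W w → Near y w → ¬ Near (c (1 + i)) w →
                   ∀ d → c d ≡ c (1 + i) → (f : V → V) → Spec i y (c d) (f (c d)) → codegree (f (c d)) < codegree (c d)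
        strictly i y sub ww near ¬near d at-d f (inj₂ (ne , _)) = contradiction at-d ne
        strictly i y sub {w} ww near ¬near d at-d f (inj₁ (_ , e)) = subst₂ (λ u v → codegree u < codegree v) (sym e) (sym at-d)
          (filter-< (close? y) (close? (c (1 + i))) (λ ¬cy (ww , nr) → ¬cy (ww , sub ww nr)) (∈-allFin w) (λ ¬c → ¬c (ww , near)) (λ cl → ¬near (proj₂ cl)))

    noP4 : ∀ R → Tight W R → (let open Ring R) → ∀ i j → even? i ≡ true → even? j ≡ true → c i ≢ c j → NoP4 W (c i) (c j)
    noP4 R T i j ei ej ne {m} {m′} wm wm′ im′ m′m mj ¬im ¬m′j with RingProperties.reindex R i j
    ... | zero , _ , eq , _ = ne (sym (eq 0))
    ... | suc zero , _ , eq , par = contradiction (trans (trans (cong not (sym ei)) (par (TightRing.size-even R T))) ej) λ ()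
    ... | d@(suc (suc _)) , lt , eq , par = no-P4-ring (shift i R) (tight-shift i T) d even-d (s≤s (s≤s z≤n)) (bound (m≤n⇒m<n∨m≡n lt))
            wm′ wm m′m (~-sym im′) (subst (λ v → ¬ m′ ~ v) (eq 0) ¬m′j) (subst (m ~_) (eq 0) mj) (¬im ∘ ~-sym)
      where
      even-d : even? d ≡ true
      even-d = trans (sym (even?-+ i d ei)) (trans (cong even? (+-comm i d)) (trans (par (TightRing.size-even R T)) ej))
      bound : suc d < Ring.size R ⊎ suc d ≡ Ring.size R → 2 + d ≤ Ring.size R
      bound (inj₁ lt′) = lt′
      bound (inj₂ e) = contradiction (trans (sym (TightRing.size-even R T)) (trans (cong even? (sym e)) (cong not even-d))) λ ()

  good-ring : ∀ {W} (H : Hole G) → (∀ {v} → _∈H_ G v H → W v) → ¬ ¬ GoodRing W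
  good-ring {W} H₀ ins₀ = do
    H , ins , shortest ← minimiser {P = λ H → ∀ v → _∈H_ G v H → W v} Hole.len {x = H₀} (λ _ → ins₀)
    let ring-inside = λ i → let j , e = fromHole-∈ H i in ins (Ring.c (fromHole H) i) (j , sym e)
    by-size H ring-inside (λ C ws → shortest {cycle-hole C} λ v v∈ → All.lookup ws (cycle-∈ C v∈)) (Hole.len H) refl (Hole.len≥4 H)
    where
    by-size : ∀ H → (∀ i → W (Ring.c (fromHole H) i)) → (∀ (C : Cycle) → All W (Cycle.hub C ∷ Cycle.start C ∷ Cycle.rest C) → Hole.len H ≤ 2 + length (Cycle.rest C)) →
              ∀ k → Hole.len H ≡ k → 4 ≤ k → ¬ ¬ GoodRing W
    by-size H ins shortest 4 eq le = square-ring (fromHole H) ins eq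
    by-size H ins shortest 5 eq le = contradiction (trans (sym (hole-even H)) (cong even? eq)) λ ()
    by-size H ins shortest k@(suc (suc (suc (suc (suc (suc _)))))) eq le =
      long-ring (fromHole H) ins (subst (6 ≤_) (sym eq) (s≤s (s≤s (s≤s (s≤s (s≤s (s≤s z≤n))))))) shortest
    by-size H ins shortest 0 eq ()
    by-size H ins shortest 1 eq (s≤s ())
    by-size H ins shortest 2 eq (s≤s (s≤s ()))
    by-size H ins shortest 3 eq (s≤s (s≤s (s≤s ())))

-- Hats of the ring, odd links through the rest, and markers.

module Hats {n : ℕ} (G : Graph n) (claw-free : ClawFree G) (innocent : Innocent G) where
  open Paths G
  open StableSets G
  open Simplicial G
  open Rings G
  open Antiholes G innocent
  open LongRings G claw-free innocent using (claw)

  -- Only clowns and paths inside `W` count. The relative notion passes to subsets, and it can hold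
  -- for a marker, which as a vertex of a hole is not even simplicial in `G`.
  OddToHats : (V → Set) → V → Set
  OddToHats W z = ∀ (D : Clown G) (P : Path G) → (∀ v → _∈H_ G v (Clown.C D) → W v) → (∀ v → _∈P_ G v P → W v) →
    first G P ≡ z → last G P ≡ Clown.hat D →
    (∀ w → _∈P_ G w P → w ≢ Clown.hat D → ¬ (_∈H_ G w (Clown.C D)) × (∀ z → _∈H_ G z (Clown.C D) → ¬ w ~ z)) →
    Odd (Path.len P)

  record SafeIn (W : V → Set) (z : V) : Set where
    field
      inside     : W z
      simplicial : SimplicialIn W z
      odd        : OddToHats W z

  AtEnds : Path G → Path G → V → V → Set
  AtEnds P Q x y = (x ≡ first G P × y ≡ first G Q) ⊎ (x ≡ last G P × y ≡ last G Q)

  Separated : Path G → Path G → Set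
  Separated P Q = ∀ x y → _∈P_ G x P → _∈P_ G y Q →
    x ≢ y × ((x ~ y) iff AtEnds P Q x y)

  no-odd-prism : ∀ P Q R → Odd (Path.len P) → Odd (Path.len Q) → Odd (Path.len R) →
                 Separated P Q → Separated P R → Separated Q R → ⊥
  no-odd-prism P Q R oP oQ oR PQ PR QR = proj₁ (proj₂ (proj₂ innocent)) record
    { P = paths ; odd = odd ; disj = λ i j ne v vi vj → proj₁ (separated i j ne v v vi vj) refl
    ; edges = λ i j ne x y xi yj → proj₂ (separated i j ne x y xi yj) }
    where
    paths : Fin 3 → Path G
    paths fzero = P
    paths (fsuc fzero) = Q
    paths (fsuc (fsuc fzero)) = R
    odd : ∀ i → Odd (Path.len (paths i))
    odd fzero = oP
    odd (fsuc fzero) = oQ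
    odd (fsuc (fsuc fzero)) = oR
    flip : ∀ P Q → Separated P Q → Separated Q P
    flip P Q s y x yQ xP with s x y xP yQ
    ... | ne , to , from = ≢-sym ne , (swap ∘ to ∘ ~-sym) , λ e → ~-sym (from (swap e))
      where
      swap : ∀ {A B C D : Set} → (A × B) ⊎ (C × D) → (B × A) ⊎ (D × C)
      swap (inj₁ (a , b)) = inj₁ (b , a)
      swap (inj₂ (c , d)) = inj₂ (d , c)
    separated : ∀ i j → i ≢ j → Separated (paths i) (paths j)
    separated fzero fzero ne = contradiction refl ne
    separated fzero (fsuc fzero) _ = PQ
    separated fzero (fsuc (fsuc fzero)) _ = PR
    separated (fsuc fzero) fzero _ = flip P Q PQ
    separated (fsuc fzero) (fsuc fzero) ne = contradiction refl ne
    separated (fsuc fzero) (fsuc (fsuc fzero)) _ = QR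
    separated (fsuc (fsuc fzero)) fzero _ = flip P R PR
    separated (fsuc (fsuc fzero)) (fsuc fzero) _ = flip Q R QR
    separated (fsuc (fsuc fzero)) (fsuc (fsuc fzero)) ne = contradiction refl ne

  module Attachment (D : Clown G) where
    open Clown D
    open Hole C

    private
      at₀ at₁ : Fin len
      at₀ = fromℕ< {0} (≤-trans (s≤s z≤n) len≥4)
      at₁ = fromℕ< {1} (≤-trans (s≤s (s≤s z≤n)) len≥4)
      toℕ₀ : toℕ at₀ ≡ 0
      toℕ₀ = Fin.toℕ-fromℕ< _
      toℕ₁ : toℕ at₁ ≡ 1
      toℕ₁ = Fin.toℕ-fromℕ< _

    x y : V
    x = vtx at₀
    y = vtx at₁

    x∈ : _∈H_ G x C
    x∈ = at₀ , refl

    y∈ : _∈H_ G y C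
    y∈ = at₁ , refl

    hat~x : hat ~ x
    hat~x = proj₂ (hatAdj at₀) (inj₁ toℕ₀)

    hat~y : hat ~ y
    hat~y = proj₂ (hatAdj at₁) (inj₂ toℕ₁)

    x~y : x ~ y
    x~y = proj₂ (adjH at₀ at₁) (inj₁ (trans toℕ₁ (cong suc (sym toℕ₀))))

    hat-only : ∀ {v} → _∈H_ G v C → hat ~ v → v ≡ x ⊎ v ≡ y
    hat-only (k , refl) a with proj₁ (hatAdj k) a
    ... | inj₁ k≡0 = inj₁ (cong vtx (Fin.toℕ-injective (trans k≡0 (sym toℕ₀))))
    ... | inj₂ k≡1 = inj₂ (cong vtx (Fin.toℕ-injective (trans k≡1 (sym toℕ₁))))

  module OnRing {W : V → Set} (R : Ring) (ring⊆W : ∀ i → W (Ring.c R i)) where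
    open RingProperties R

    Rest : V → Set
    Rest v = W v × (∀ i → Far v (c i))

    record Hat (i : ℕ) (x : V) : Set where
      field
        inside : W x
        off    : ∀ j → x ≢ c j
        adj₀   : x ~ c i
        adj₁   : x ~ c (1 + i)
        only   : ∀ j → x ~ c j → c j ≡ c i ⊎ c j ≡ c (1 + i)

    private
      p = size ∸ 1
      p≡ : suc p ≡ size
      p≡ = m+[n∸m]≡n (≤-trans (s≤s z≤n) size≥4)

    size-even : even? size ≡ true
    size-even = hole-even (toHole 0)

    ends-apart : ∀ i → Far (c (p + i)) (c (1 + i))
    ends-apart i = subst (Far (c (p + i))) (same-index (prev-next i) 1) (apart₂ (p + i))

    rest-stable : ∀ {v} → W v → ¬ ¬ Rest v → Rest v
    rest-stable wv ¬¬r = wv , λ i → (λ e → ¬¬r λ r → proj₁ (proj₂ r i) e) , (λ a → ¬¬r λ r → proj₂ (proj₂ r i) a)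

    rest-hat : ∀ {i v} → Rest v → ¬ Hat i v
    rest-hat (_ , far) h = proj₂ (far _) (Hat.adj₀ h)

    two-nbrs : ∀ {x j} → (∀ i → x ≢ c i) → x ~ c j → x ~ c (p + j) ⊎ x ~ c (1 + j)
    two-nbrs {x} {j} off xj with x ~? c (p + j)
    ... | yes a = inj₁ a
    ... | no ¬a = inj₂ (claw (prev j) (~-sym xj) (next j) ((λ e → off _ (sym e)) , λ a → ¬a (~-sym a)) (ends-apart j) (off _))

    hat-of : ∀ {x j} → W x → (∀ i → x ≢ c i) → (∀ j k → x ~ c j → x ~ c k → c j ≢ c k → c j ~ c k) → x ~ c j → ∃[ i ] Hat i x
    hat-of {x} {j} wx off clique xj = [ (λ a → p + j , hat a (subst (x ~_) (sym (prev-next j)) xj)) , (λ a → j , hat xj a) ]′ (two-nbrs off xj)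
      where
      hat : ∀ {i} → x ~ c i → x ~ c (1 + i) → Hat i x
      hat {i} x0 x1 = record { inside = wx ; off = off ; adj₀ = x0 ; adj₁ = x1 ; only = only }
        where
        only : ∀ k → x ~ c k → c k ≡ c i ⊎ c k ≡ c (1 + i)
        only k xk with c k ≟ c i | c k ≟ c (1 + i)
        ... | yes e | _ = inj₁ e
        ... | no _ | yes e = inj₂ e
        ... | no ne | no ne′ = ⊥-elim (no-triangle i k (clique k i xk x0 ne , clique k (suc i) xk x1 ne′))

    -- The neighbour `y` is far from the ring, so claw-freeness at `x` makes the ring neighbours of
    -- `x` pairwise adjacent.
    hat-of-rest : ∀ {x y j} → W x → Rest y → x ~ y → x ~ c j → ∃[ i ] Hat i x
    hat-of-rest {x} {y} wx (_ , far) xy = hat-of wx (λ i e → proj₂ (far i) (subst (y ~_) e (~-sym xy)))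
      λ j k xj xk ne → claw xy xj xk (far j) (far k) ne

    hat-move : ∀ {i j x} → (∀ m → c (m + j) ≡ c (m + i)) → Hat j x → Hat i x
    hat-move {x = x} eq h = record
      { inside = inside ; off = off ; adj₀ = subst (x ~_) (eq 0) adj₀ ; adj₁ = subst (x ~_) (eq 1) adj₁
      ; only = λ k a → [ (λ e → inj₁ (trans e (eq 0))) , (λ e → inj₂ (trans e (eq 1))) ]′ (only k a) }
      where open Hat h

    -- Otherwise the ring vertex before `c i` would complete a claw at `c i`.
    hats-adj : ∀ {i x x′} → Hat i x → Hat i x′ → x ≢ x′ → x ~ x′
    hats-adj {i} h h′ ne = claw (prev i) (~-sym (Hat.adj₀ h)) (~-sym (Hat.adj₀ h′)) (misses h) (misses h′) ne
      where
      misses : ∀ {x} → Hat i x → Far (c (p + i)) x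
      misses h = (λ e → Hat.off h _ (sym e)) ,
        λ a → [ (λ e → ~⇒≢ (prev i) (sym e)) , (λ e → proj₁ (ends-apart i) e) ]′ (Hat.only h (p + i) (~-sym a))

    hat-rest-clique : ∀ {i x y y′} → Hat i x → Rest y → Rest y′ → x ~ y → x ~ y′ → y ≢ y′ → y ~ y′
    hat-rest-clique {i} h (_ , far) (_ , far′) xy xy′ ne = claw (Hat.adj₀ h) xy xy′ (Far-sym (far i)) (Far-sym (far′ i)) ne

    Link : V → V → V → Set
    Link x x′ v = v ≡ x ⊎ v ≡ x′ ⊎ Rest v

    -- An odd path through the rest between hats of different edges of the ring splits the ring into
    -- two arcs of equal parity: odd arcs give an odd prism, an even arc gives an odd hole.
    module Key {i d x x′ ps} (h : Hat i x) (h′ : Hat (d + i) x′) (1≤d : 1 ≤ d) (d<size : d < size) (path : InducedPath (x ∷ ps))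
               (ends : lastOf x ps ≡ x′) (odd : even? (length ps) ≡ false) (link-in : ∀ {v} → v ∈ˡ x ∷ ps → Link x x′ v) where
      private
        module h = Hat h
        module h′ = Hat h′

      link-off : ∀ {v} → Link x x′ v → ∀ j → v ≢ c j
      link-off (inj₁ refl) = h.off
      link-off (inj₂ (inj₁ refl)) = h′.off
      link-off (inj₂ (inj₂ (_ , far))) j = proj₁ (far j)

      -- The odd path, an even arc and the two edges between them add up to an odd hole.
      close-arc : ∀ {a as} → InducedPath (a ∷ as) → (∀ {v} → v ∈ˡ a ∷ as → On v) → x′ ~ a → x ~ lastOf a as →
                  (∀ {v} → v ∈ˡ a ∷ as → x ~ v → v ≡ lastOf a as) → (∀ {v} → v ∈ˡ a ∷ as → x′ ~ v → v ≡ a) →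
                  even? (length as) ≡ true → 2 ≤ length as → ⊥
      close-arc {a} {as} ip on x′a xl only only′ ev long = go ps path ends odd link-in
        where
        go : ∀ ps → InducedPath (x ∷ ps) → lastOf x ps ≡ x′ → even? (length ps) ≡ false → (∀ {v} → v ∈ˡ x ∷ ps → Link x x′ v) → ⊥
        go [] _ _ () _
        go (y ∷ qs) ip₀@(link xy fs ip′) e od ins = contradiction (trans (sym (cycle-even C)) (trans (cong even? (length-++ qs)) rest-odd)) λ ()
          where
          rest-odd : even? (length qs + suc (length as)) ≡ false
          rest-odd = trans (even?-+ (length qs) _ (Bool.not-injective od)) (cong not ev)
          cross : ∀ {v w} → v ∈ˡ y ∷ qs → w ∈ˡ a ∷ as → v ≢ w × (v ~ w → v ≡ lastOf y qs × w ≡ a)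
          cross {v} {w} m m′ with on m′
          ... | k , refl = link-off (ins (there m)) k , adj (ins (there m))
            where
            adj : Link x x′ v → v ~ c k → v ≡ lastOf y qs × c k ≡ a
            adj (inj₁ refl) e = contradiction refl (tail-far ip₀ m)
            adj (inj₂ (inj₁ q)) a = trans q (sym e) , only′ m′ (subst (_~ c k) q a)
            adj (inj₂ (inj₂ (_ , far))) e = contradiction e (proj₂ (far k))
          C : Cycle
          C = record
            { hub = x ; start = y ; rest = qs ++ a ∷ as ; path = append ip′ ip (subst (_~ a) (sym e) x′a) cross
            ; long = subst (2 ≤_) (sym (length-++ qs)) (≤-trans (≤-trans long (n≤1+n _)) (m≤n+m _ (length qs)))
            ; closeˡ = xy ; closeʳ = subst (x ~_) (sym (lastOf-++ y qs a as)) xl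
            ; avoid = λ m → avoid (∈-++⁻ (y ∷ qs) m) }
            where
            avoid : ∀ {v} → v ∈ˡ y ∷ qs ⊎ v ∈ˡ a ∷ as → x ≢ v × (x ~ v → v ≡ y ⊎ v ≡ lastOf y (qs ++ a ∷ as))
            avoid (inj₁ (here refl)) = ~⇒≢ xy , λ _ → inj₁ refl
            avoid (inj₁ (there m)) = tail-far ip₀ (there m) , λ a → ⊥-elim (proj₂ (All.lookup fs m) a)
            avoid (inj₂ m) with on m
            ... | k , refl = h.off k , λ b → inj₂ (trans (only m b) (sym (lastOf-++ y qs a as)))

      odd-arc : even? d ≡ false → ⊥
      odd-arc od = go d refl od
        where
        go : ∀ d′ → d ≡ d′ → even? d′ ≡ false → ⊥
        go 0 _ ()
        go 2 _ ()
        -- The two ring edges share `c (1 + i)`. The near arc is this single vertex and with a path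
        -- of length one would give just a triangle, so the far arc, from `c (2 + i)` round to
        -- `c i`, is taken.
        go 1 refl _ = close-arc {c (2 + i)} {upTail (2 + i) k} (up-path (2 + i) k (≤-reflexive 2+k))
          (λ m → let j , _ , e = up-∈ (2 + i) k m in _ , e) h′.adj₁
          (subst (x ~_) (sym last≡) h.adj₀) only only′
          (subst (λ l → even? l ≡ true) (sym (up-length (2 + i) k)) (trans (sym (Bool.not-involutive _)) (trans (cong even? 2+k) size-even)))
          (subst (2 ≤_) (sym (up-length (2 + i) k)) (m+n≤o⇒m≤o∸n 2 size≥4))
          where
          k = size ∸ 2
          2+k : 2 + k ≡ size
          2+k = m+[n∸m]≡n (≤-trans (s≤s (s≤s z≤n)) size≥4)
          shuffle : ∀ k i → k + (2 + i) ≡ 2 + k + i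
          shuffle = solve-∀
          end : c (k + (2 + i)) ≡ c i
          end = trans (cong c (trans (shuffle k i) (cong (_+ i) 2+k))) (periodic i)
          last≡ : lastOf (c (2 + i)) (upTail (2 + i) k) ≡ c i
          last≡ = trans (up-last (2 + i) k) end
          only : ∀ {v} → v ∈ˡ c (2 + i) ∷ upTail (2 + i) k → x ~ v → v ≡ lastOf (c (2 + i)) (upTail (2 + i) k)
          only m a with up-∈ (2 + i) k m
          ... | j , hi , refl with h.only _ a
          ... | inj₁ e = trans e (sym last≡)
          ... | inj₂ e = contradiction (sym e) λ q → distinct (suc j) (1 + i) (s≤s z≤n) (≤-trans (s≤s (s≤s hi)) (≤-reflexive 2+k)) (trans q (cong c (+-suc j (1 + i))))
          only′ : ∀ {v} → v ∈ˡ c (2 + i) ∷ upTail (2 + i) k → x′ ~ v → v ≡ c (2 + i)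
          only′ m a with up-∈ (2 + i) k m
          ... | j , hi , refl with h′.only _ a
          ... | inj₂ e = e
          ... | inj₁ e = contradiction (sym e) λ q → distinct (suc j) (1 + i) (s≤s z≤n) (≤-trans (s≤s (s≤s hi)) (≤-reflexive 2+k)) (trans q (cong c (+-suc j (1 + i))))
        go (suc k@(suc (suc _))) refl od = close-arc {c (k + (1 + i))} {downTail (1 + i) k} (down-path (1 + i) k d<size)
          (λ m → let j , _ , e = down-∈ (1 + i) k m in _ , e) (subst (x′ ~_) (sym head≡) h′.adj₀)
          (subst (x ~_) (sym (down-last (1 + i) k)) h.adj₁) only only′
          (subst (λ l → even? l ≡ true) (sym (down-length (1 + i) k)) (Bool.not-injective od))
          (subst (2 ≤_) (sym (down-length (1 + i) k)) (s≤s (s≤s z≤n)))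
          where
          head≡ : c (k + (1 + i)) ≡ c (suc k + i)
          head≡ = cong c (+-suc k i)
          only : ∀ {v} → v ∈ˡ c (k + (1 + i)) ∷ downTail (1 + i) k → x ~ v → v ≡ lastOf (c (k + (1 + i))) (downTail (1 + i) k)
          only m a with down-∈ (1 + i) k m
          ... | j , hi , refl with h.only _ a
          ... | inj₂ e = trans e (sym (down-last (1 + i) k))
          ... | inj₁ e = contradiction (sym e) λ q → distinct (suc j) i (s≤s z≤n) (≤-trans (s≤s (s≤s hi)) d<size) (trans q (cong c (+-suc j i)))
          only′ : ∀ {v} → v ∈ˡ c (k + (1 + i)) ∷ downTail (1 + i) k → x′ ~ v → v ≡ c (k + (1 + i))
          only′ m a with down-∈ (1 + i) k m
          ... | j , hi , refl with h′.only _ a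
          ... | inj₁ e = trans e (sym head≡)
          ... | inj₂ e = contradiction e λ q → distinct (suc k ∸ j) (j + (1 + i)) (m<n⇒0<n∸m (s≤s hi)) (≤-<-trans (m∸n≤m (suc k) j) d<size)
                  (trans q (cong c (trans (sym (+-suc (suc k) i)) (trans (cong (_+ (1 + i)) (sym (m∸n+n≡m (m≤n⇒m≤1+n hi)))) (+-assoc (suc k ∸ j) j (1 + i))))))

      -- The triangles of the prism are x, c (1 + i), c i and x′, c (d + i), c (1 + d + i). The
      -- second arc is listed downwards so that all three paths run from the first triangle to the
      -- second.
      even-arc : even? d ≡ true → ⊥
      even-arc ed = no-odd-prism P₀ P₁ P₂ (odd⇒¬2∣ (length ps) odd)
          (odd⇒¬2∣ _ (subst (λ l → even? l ≡ false) (sym (up-length (1 + i) k)) k-odd))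
          (odd⇒¬2∣ _ (subst (λ l → even? l ≡ false) (sym (down-length b m)) m-odd))
          sep₀₁ sep₀₂ sep₁₂
        where
        k = d ∸ 1
        1+k : 1 + k ≡ d
        1+k = m+[n∸m]≡n 1≤d
        k-odd : even? k ≡ false
        k-odd = Bool.not-injective (trans (cong even? 1+k) ed)
        m = size ∸ suc d
        m+d : m + suc d ≡ size
        m+d = m∸n+n≡m d<size
        m-odd : even? m ≡ false
        m-odd = Bool.not-injective (trans (sym (trans (cong even? (sym (trans (cong suc (+-comm d m)) (trans (sym (+-suc m d)) m+d)))) (cong not (even?-+ d m ed)))) size-even)
        b = 1 + d + i
        P₀ = toPath path
        arc₁ : InducedPath (c (1 + i) ∷ upTail (1 + i) k)
        arc₁ = up-path (1 + i) k (subst (_≤ size) (sym (cong suc 1+k)) d<size)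
        P₁ = toPath arc₁
        arc₂ : InducedPath (c (m + b) ∷ downTail b m)
        arc₂ = down-path b m (≤-trans (≤-reflexive (+-comm 2 m)) (≤-trans (+-monoʳ-≤ m (s≤s 1≤d)) (≤-reflexive m+d)))
        P₂ = toPath arc₂
        last₁ : last G P₁ ≡ c (d + i)
        last₁ = trans (toPath-last arc₁) (trans (up-last (1 + i) k) (cong c (trans (+-suc k i) (cong (_+ i) 1+k))))
        last₂ : last G P₂ ≡ c b
        last₂ = trans (toPath-last arc₂) (down-last b m)
        last₀ : last G P₀ ≡ x′
        last₀ = trans (toPath-last path) ends
        m+b : m + b ≡ size + i
        m+b = trans (sym (+-assoc m (suc d) i)) (cong (_+ i) m+d)
        first₂ : c (m + b) ≡ c i
        first₂ = trans (cong c m+b) (periodic i)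
        pos₁ : ∀ {v} → _∈P_ G v P₁ → ∃[ j ] j ≤ k × v ≡ c (suc j + i)
        pos₁ v∈ with up-∈ (1 + i) k (toPath-∈ arc₁ v∈)
        ... | j , hi , e = j , hi , trans e (cong c (+-suc j i))
        pos₂ : ∀ {v} → _∈P_ G v P₂ → ∃[ l ] l ≤ m × v ≡ c (l + b)
        pos₂ v∈ = down-∈ b m (toPath-∈ arc₂ v∈)
        off-link : ∀ {v} → _∈P_ G v P₀ → Link x x′ v
        off-link v∈ = link-in (toPath-∈ path v∈)
        sep₀₁ : Separated P₀ P₁
        sep₀₁ u v u∈ v∈ with pos₁ v∈
        ... | j , hi , refl = link-off (off-link u∈) _ , to (off-link u∈) , from
          where
          to : Link x x′ u → u ~ c (suc j + i) → AtEnds P₀ P₁ u (c (suc j + i))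
          to (inj₁ refl) a with h.only _ a
          ... | inj₂ e = inj₁ (refl , e)
          ... | inj₁ e = contradiction (sym e) (distinct (suc j) i (s≤s z≤n) (≤-trans (s≤s (s≤s hi)) (subst (_≤ size) (sym (cong suc 1+k)) d<size)))
          to (inj₂ (inj₁ refl)) a with h′.only _ a
          ... | inj₁ e = inj₂ (sym last₀ , trans e (sym last₁))
          ... | inj₂ e = contradiction e (differ j hi)
            where
            differ : ∀ j → j ≤ k → c (suc j + i) ≢ c (1 + (d + i))
            differ j hi e = distinct (suc d ∸ suc j) (suc j + i) (m<n⇒0<n∸m (s≤s j<d)) (≤-<-trans (m∸n≤m d j) d<size)
              (trans e (cong c (trans (cong (_+ i) (sym (m∸n+n≡m (s≤s (<⇒≤ j<d))))) (+-assoc (d ∸ j) (suc j) i))))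
              where
              j<d : j < d
              j<d = ≤-trans (s≤s hi) (≤-reflexive 1+k)
          to (inj₂ (inj₂ (_ , far))) a = contradiction a (proj₂ (far _))
          from : AtEnds P₀ P₁ u (c (suc j + i)) → u ~ c (suc j + i)
          from (inj₁ (refl , e)) = subst (x ~_) (sym e) h.adj₁
          from (inj₂ (e , e′)) = subst₂ _~_ (sym (trans e last₀)) (sym (trans e′ last₁)) h′.adj₀
        sep₀₂ : Separated P₀ P₂
        sep₀₂ u v u∈ v∈ with pos₂ v∈
        ... | l , hi , refl = link-off (off-link u∈) _ , to (off-link u∈) , from
          where
          to : Link x x′ u → u ~ c (l + b) → AtEnds P₀ P₂ u (c (l + b))
          to (inj₁ refl) a with h.only _ a
          ... | inj₁ e = inj₁ (refl , trans e (sym first₂))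
          ... | inj₂ e = contradiction (sym e) λ q → distinct (l + d) (1 + i) (≤-trans 1≤d (m≤n+m d l)) (≤-trans (≤-trans (≤-reflexive (sym (+-suc l d))) (+-monoˡ-≤ (suc d) hi)) (≤-reflexive m+d))
                  (trans q (cong c (shuffle l d i)))
            where
            shuffle : ∀ l d i → l + (1 + d + i) ≡ l + d + (1 + i)
            shuffle = solve-∀
          to (inj₂ (inj₁ refl)) a with h′.only _ a
          ... | inj₂ e = inj₂ (sym last₀ , trans e (sym last₂))
          ... | inj₁ e = contradiction (sym e) λ q → distinct (suc l) (d + i) (s≤s z≤n) (≤-trans (≤-trans (≤-reflexive (+-comm 2 l)) (+-mono-≤ hi (s≤s 1≤d))) (≤-reflexive m+d))
                  (trans q (cong c (+-suc l (d + i))))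
          to (inj₂ (inj₂ (_ , far))) a = contradiction a (proj₂ (far _))
          from : AtEnds P₀ P₂ u (c (l + b)) → u ~ c (l + b)
          from (inj₁ (refl , e)) = subst (x ~_) (sym (trans e first₂)) h.adj₀
          from (inj₂ (e , e′)) = subst₂ _~_ (sym (trans e last₀)) (sym (trans e′ last₂)) h′.adj₁
        sep₁₂ : Separated P₁ P₂
        sep₁₂ u v u∈ v∈ with pos₁ u∈ | pos₂ v∈
        ... | j , hj , refl | l , hl , refl = (λ e → distinct D (suc j + i) D≥1 D<size (trans e step≡)) , to , from
          where
          j<d : j < d
          j<d = ≤-trans (s≤s hj) (≤-reflexive 1+k)
          -- The number of ring steps from the vertex on the first arc to the one on the second. For
          -- adjacent vertices `gap` leaves `1` and `size - 1`, which are the ring edges of the two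
          -- triangles.
          D = l + (d ∸ j)
          D≥1 : 1 ≤ D
          D≥1 = ≤-trans (m<n⇒0<n∸m j<d) (m≤n+m _ l)
          D<size : D < size
          D<size = ≤-trans (≤-reflexive (sym (+-suc l (d ∸ j)))) (≤-trans (+-mono-≤ hl (s≤s (m∸n≤m d j))) (≤-reflexive m+d))
          step≡ : c (l + b) ≡ c (D + (suc j + i))
          step≡ = cong c (trans (cong (λ z → l + (suc z + i)) (sym (m∸n+n≡m (<⇒≤ j<d)))) (shuffle l (d ∸ j) j i))
            where
            shuffle : ∀ l e j i → l + (suc (e + j) + i) ≡ l + e + (suc j + i)
            shuffle = solve-∀
          to : c (suc j + i) ~ c (l + b) → AtEnds P₁ P₂ (c (suc j + i)) (c (l + b))
          to a with gap D (suc j + i) D<size (subst (c (suc j + i) ~_) step≡ a)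
          ... | inj₁ one = inj₂ (trans (cong (λ z → c (z + i)) sj≡d) (sym last₁) , trans (cong (λ z → c (z + b)) l≡0) (sym last₂))
            where
            l≡0 : l ≡ 0
            l≡0 = n≤0⇒n≡0 (+-cancelʳ-≤ 1 l 0 (≤-trans (+-monoʳ-≤ l (m<n⇒0<n∸m j<d)) (≤-reflexive one)))
            sj≡d : suc j ≡ d
            sj≡d = trans (cong (_+ j) (sym (trans (sym (cong (_+ (d ∸ j)) l≡0)) one))) (m∸n+n≡m (<⇒≤ j<d))
          ... | inj₂ sD = inj₁ (cong (λ z → c (suc z + i)) j≡0 , cong (λ z → c (z + b)) l≡m)
            where
            total : l + suc (d ∸ j) ≡ m + suc d
            total = trans (+-suc l (d ∸ j)) (trans sD (sym m+d))
            l≡m : l ≡ m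
            l≡m = ≤-antisym hl (+-cancelʳ-≤ (suc d) m l (≤-trans (≤-reflexive (sym total)) (+-monoʳ-≤ l (s≤s (m∸n≤m d j)))))
            j≡0 : j ≡ 0
            j≡0 = trans (sym (m∸[m∸n]≡n (<⇒≤ j<d))) (trans (cong (d ∸_) (suc-injective (+-cancelˡ-≡ m _ _ (trans (cong (_+ suc (d ∸ j)) (sym l≡m)) total)))) (n∸n≡0 d))
          from : AtEnds P₁ P₂ (c (suc j + i)) (c (l + b)) → c (suc j + i) ~ c (l + b)
          from (inj₁ (e , e′)) = subst₂ _~_ (sym e) (sym (trans e′ first₂)) (~-sym (next i))
          from (inj₂ (e , e′)) = subst₂ _~_ (sym (trans e last₁)) (sym (trans e′ last₂)) (next (d + i))

      key : ⊥
      key with even? d Bool.≟ true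
      ... | yes e = even-arc e
      ... | no ne = odd-arc (¬even⇒odd {d} ne)

    no-eye-mask : ∀ {i x y} (H : Hole G) → (∀ {v} → _∈H_ G v H → Rest v ⊎ Hat i v) → Hat i x → Hat i y → _∈H_ G x H → _∈H_ G y H → x ~ y →
                  (∀ {v} → _∈H_ G v H → Hat i v → v ≡ x ⊎ v ≡ y) → ⊥
    no-eye-mask {i} {x} {y} H kinds hx hy x∈ y∈ xy only = proj₂ (proj₂ (proj₂ (proj₂ innocent))) record
      { C₁ = toHole 0 ; C₂ = H ; even₁ = even⇒2∣ _ size-even ; even₂ = even⇒2∣ _ (hole-even H)
      ; disj₁₂ = disjoint ; x₁ = c i ; y₁ = c (1 + i) ; x₁∈ = On-toHole 0 (i , refl) ; y₁∈ = On-toHole 0 (1 + i , refl) ; x₁y₁ = next i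
      ; x₂ = x ; y₂ = y ; x₂∈ = x∈ ; y₂∈ = y∈ ; x₂y₂ = xy
      ; edges = λ z₁ z₂ z₁∈ z₂∈ → to (toHole-On 0 z₁∈) (kinds z₂∈) z₂∈ , λ { (e , e′) → from e e′ } }
      where
      disjoint : ∀ v → _∈H_ G v (toHole 0) → ¬ (_∈H_ G v H)
      disjoint v v∈ v∈′ with toHole-On 0 v∈ | kinds v∈′
      ... | j , e | inj₁ (_ , far) = proj₁ (far j) e
      ... | j , e | inj₂ h = Hat.off h j e
      to : ∀ {z₁ z₂} → On z₁ → Rest z₂ ⊎ Hat i z₂ → _∈H_ G z₂ H → z₁ ~ z₂ → (z₁ ≡ c i ⊎ z₁ ≡ c (1 + i)) × (z₂ ≡ x ⊎ z₂ ≡ y)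
      to (j , refl) (inj₁ (_ , far)) _ a = contradiction (~-sym a) (proj₂ (far j))
      to (j , refl) (inj₂ h) z₂∈ a = Hat.only h j (~-sym a) , only z₂∈ h
      joined : ∀ {z₁ z₂} → z₁ ≡ c i ⊎ z₁ ≡ c (1 + i) → Hat i z₂ → z₁ ~ z₂
      joined (inj₁ refl) h = ~-sym (Hat.adj₀ h)
      joined (inj₂ refl) h = ~-sym (Hat.adj₁ h)
      from : ∀ {z₁ z₂} → z₁ ≡ c i ⊎ z₁ ≡ c (1 + i) → z₂ ≡ x ⊎ z₂ ≡ y → z₁ ~ z₂
      from e (inj₁ refl) = joined e hx
      from e (inj₂ refl) = joined e hy

    hats-at : ∀ {i d x} → 1 ≤ d → d < size → Hat i x → ¬ Hat (d + i) x
    hats-at {i} {d} 1≤d lt h h′ with Hat.only h (d + i) (Hat.adj₀ h′)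
    ... | inj₁ e = distinct d i 1≤d lt (sym e)
    ... | inj₂ e with Hat.only h (1 + (d + i)) (Hat.adj₁ h′)
    ... | inj₁ e′ = proj₁ (apart₂ i) (trans (sym e′) (same-index e 1))
    ... | inj₂ e′ = ~⇒≢ (next (d + i)) (trans e (sym e′))

    -- An edge is an odd path, so `Key` excludes adjacent hats of different ring edges.
    adjacent-hats : ∀ {i j x x′} → Hat i x → Hat j x′ → x ~ x′ → Hat i x′
    adjacent-hats {i} {j} {x} {x′} h h′ a with reindex i j
    ... | zero , _ , eq , _ = hat-move eq h′
    ... | suc d , lt , eq , _ = ⊥-elim (Key.key h (hat-move eq h′) (s≤s z≤n) lt (link a [] single) refl refl
            λ { (here refl) → inj₁ refl ; (there (here refl)) → inj₂ (inj₁ refl) })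

    record Straddling (M : V → Set) (i : ℕ) : Set where
      field
        maximal : MaxClique W M
        hats    : ∀ {v} → M v → ¬ Rest v → Hat i v
        {x₀}    : V
        x₀∈     : M x₀
        x₀-hat  : Hat i x₀

    -- A vertex of `M` outside the rest sees `y`, hence is off the ring but has a neighbour on it,
    -- and so is a hat; being adjacent, all these hats belong to one ring edge.
    straddling : ∀ {M y x} → MaxClique W M → M y → Rest y → M x → ¬ Rest x → ¬ ¬ (∃[ i ] Straddling M i)
    straddling {M} {y} {x} mc my ry mx ¬rx = do
      i , hx ← some-hat mx ¬rx
      all ← finite-choice {P = λ v → M v → ¬ Rest v → Hat i v} λ v → do
        yes (mv , ¬rv) ← lem (M v × ¬ Rest v)
          where no other → return λ mv ¬rv → contradiction (mv , ¬rv) other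
        j , hv ← some-hat mv ¬rv
        return λ _ _ → same-edge hx hv mv
      return (i , record { maximal = mc ; hats = λ {v} → all v ; x₀∈ = mx ; x₀-hat = hx })
      where
      open MaxClique mc
      some-hat : ∀ {v} → M v → ¬ Rest v → ¬ ¬ (∃[ i ] Hat i v)
      some-hat {v} mv ¬rv none = ¬rv (rest-stable (within mv) λ ¬r → ¬r (within mv , λ j →
        (λ { refl → proj₂ (proj₂ ry j) yv }) , λ a → none (hat-of-rest (within mv) ry (~-sym yv) a)))
        where
        yv : y ~ v
        yv = clique my mv λ { refl → ¬rv ry }
      same-edge : ∀ {i j v} → Hat i x → Hat j v → M v → Hat i v
      same-edge {v = v} hx hv mv with x ≟ v
      ... | yes refl = hx
      ... | no ne = adjacent-hats hx hv (clique mx mv ne)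

    -- By maximality of M the neighbour of e on the path misses some vertex of M; if that vertex lies
    -- in the rest, then claw-freeness makes every hat in M miss the neighbour as well.
    end-hat : ∀ {M i L e} → Straddling M i → All Rest L → e ∈ˡ L → M e → (∀ {w} → w ∈ˡ L → M w → w ≡ e) →
              (∀ {v w} → v ∈ˡ L → w ∈ˡ L → e ~ v → e ~ w → v ≡ w) → ¬ ¬ (∃[ x ] Hat i x × M x × x ~ e × (∀ {w} → w ∈ˡ L → x ~ w → w ≡ e))
    end-hat {M} {i} {L} {e} st rests e∈ me only unique = do
      yes (w , w∈ , ew) ← lem (∃[ w ] w ∈ˡ L × e ~ w)
        where no isolated → return (x₀ , x₀-hat , x₀∈ , hat~e x₀∈ x₀-hat , λ {w} w∈ xw → decidable-stable (w ≟ e) λ ne →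
                contradiction (w , w∈ , hat-rest-clique x₀-hat (rest e∈) (rest w∈) (hat~e x₀∈ x₀-hat) xw (≢-sym ne)) isolated)
      x , hx , mx , ¬xw ← witness w w∈ (λ mw → ~⇒≢ ew (sym (only w∈ mw)))
      return (x , hx , mx , hat~e mx hx , λ {v} v∈ xv → decidable-stable (v ≟ e) λ ne →
        ¬xw (subst (x ~_) (unique v∈ w∈ (hat-rest-clique hx (rest e∈) (rest v∈) (hat~e mx hx) xv (≢-sym ne)) ew) xv))
      where
      open Straddling st
      open MaxClique maximal using (within; clique)
      rest : ∀ {v} → v ∈ˡ L → Rest v
      rest = All.lookup rests
      hat~e : ∀ {x} → M x → Hat i x → x ~ e
      hat~e mx hx = clique mx me λ { refl → rest-hat (rest e∈) hx }
      witness : ∀ w → w ∈ˡ L → ¬ M w → ¬ ¬ (∃[ x ] Hat i x × M x × ¬ x ~ w)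
      witness w w∈ ¬mw = do
        yes (u , mu , u≢w , ¬uw) ← lem (∃[ u ] M u × u ≢ w × ¬ u ~ w)
          where no complete → contradiction (MaxClique.maximal maximal (proj₁ (rest w∈)) λ {u} mu ne → ~-sym (decidable-stable (u ~? w) λ ¬a → complete (u , mu , ne , ¬a))) ¬mw
        yes ru ← lem (Rest u)
          where no ¬ru → return (u , hats mu ¬ru , mu , ¬uw)
        return (x₀ , x₀-hat , x₀∈ , λ x₀w → ¬uw (hat-rest-clique x₀-hat ru (rest w∈) (clique x₀∈ mu λ { refl → rest-hat ru x₀-hat }) x₀w u≢w))

    -- `end-hat` prolongs the path by a hat at each end, so it stays odd. For different ring edges
    -- `Key` applies. Distinct hats of the same edge are adjacent and close a hole that forms an eye
    -- mask with the ring. A common hat would see both ends of the path, while it sees only one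
    -- vertex of it.
    hats-unlinked : ∀ {M M′ i i′} → Straddling M i → Straddling M′ i′ → ¬ OddLink Rest (λ v → M v × Rest v) (λ v → M′ v × Rest v)
    hats-unlinked {M} {M′} {i} {i′} st st′ record { u = u ; path = mkPath ps ip rests refl ; odd = odd ; source = mu , _ ; target = mv , _
                                                   ; only-source = only-source ; only-target = only-target } = run do
      x , hx , mx , xu , x-only ← end-hat st rests (here refl) mu (λ w∈ mw → only-source w∈ (mw , All.lookup rests w∈)) (first-nbr-unique ip)
      x′ , hx′ , mx′ , xv , x′-only ← end-hat st′ rests (last∈ u ps) mv (λ w∈ mw → only-target w∈ (mw , All.lookup rests w∈)) (last-nbr-unique ip)
      return (meet x x′ hx hx′ xu xv x-only x′-only)
      where
      v = lastOf u ps
      meet : ∀ x x′ → Hat i x → Hat i′ x′ → x ~ u → x′ ~ v → (∀ {w} → w ∈ˡ u ∷ ps → x ~ w → w ≡ u) → (∀ {w} → w ∈ˡ u ∷ ps → x′ ~ w → w ≡ v) → ⊥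
      meet x x′ hx hx′ xu xv x-only x′-only with reindex i i′
      ... | zero , _ , eq , _ = same-edge (x ≟ x′)
        where
        h′ = hat-move eq hx′
        same-edge : Dec (x ≡ x′) → ⊥
        same-edge (yes refl) = go ps ip rests odd x-only x′-only xv
          where
          go : ∀ ps → InducedPath (u ∷ ps) → All Rest (u ∷ ps) → even? (length ps) ≡ false → (∀ {w} → w ∈ˡ u ∷ ps → x ~ w → w ≡ u) →
               (∀ {w} → w ∈ˡ u ∷ ps → x ~ w → w ≡ lastOf u ps) → x ~ lastOf u ps → ⊥
          go [] _ _ () _ _ _
          go (y ∷ qs) ip _ _ x-only _ xv = tail-far ip (last∈ y qs) (sym (x-only (there (last∈ y qs)) xv))
        same-edge (no ne) = no-eye-mask (cycle-hole C) kinds hx h′ (fzero , refl) x′∈ (hats-adj hx h′ ne) only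
          where
          rest-length : length (ps ++ x′ ∷ []) ≡ suc (length ps)
          rest-length = trans (length-++ ps) (+-comm _ 1)
          nonempty : ∀ ps → even? (length ps) ≡ false → 1 ≤ length ps
          nonempty (_ ∷ _) _ = s≤s z≤n
          C : Cycle
          C = record
            { hub = x ; start = u ; rest = ps ++ x′ ∷ []
            ; path = snoc ip (~-sym xv) λ w∈ → (λ { refl → rest-hat (All.lookup rests w∈) h′ }) , λ a → x′-only w∈ (~-sym a)
            ; long = subst (2 ≤_) (sym rest-length) (s≤s (nonempty ps odd)) ; closeˡ = xu
            ; closeʳ = subst (x ~_) (sym (lastOf-++ u ps x′ [])) (hats-adj hx h′ ne)
            ; avoid = λ m → avoid (∈-++⁻ (u ∷ ps) m) }
            where
            avoid : ∀ {w} → w ∈ˡ u ∷ ps ⊎ w ∈ˡ x′ ∷ [] → x ≢ w × (x ~ w → w ≡ u ⊎ w ≡ lastOf u (ps ++ x′ ∷ []))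
            avoid (inj₁ w∈) = (λ { refl → rest-hat (All.lookup rests w∈) hx }) , λ a → inj₁ (x-only w∈ a)
            avoid (inj₂ (here refl)) = ne , λ _ → inj₂ (sym (lastOf-++ u ps x′ []))
          member : ∀ {w} → _∈H_ G w (cycle-hole C) → w ≡ x ⊎ w ≡ x′ ⊎ Rest w
          member w∈ with cycle-∈ C w∈
          ... | here e = inj₁ e
          ... | there m with ∈-++⁻ (u ∷ ps) m
          ... | inj₁ m′ = inj₂ (inj₂ (All.lookup rests m′))
          ... | inj₂ (here e) = inj₂ (inj₁ e)
          kinds : ∀ {w} → _∈H_ G w (cycle-hole C) → Rest w ⊎ Hat i w
          kinds w∈ with member w∈
          ... | inj₁ refl = inj₂ hx
          ... | inj₂ (inj₁ refl) = inj₂ h′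
          ... | inj₂ (inj₂ r) = inj₁ r
          only : ∀ {w} → _∈H_ G w (cycle-hole C) → Hat i w → w ≡ x ⊎ w ≡ x′
          only w∈ h with member w∈
          ... | inj₁ e = inj₁ e
          ... | inj₂ (inj₁ e) = inj₂ e
          ... | inj₂ (inj₂ r) = contradiction h (rest-hat r)
          x′∈ : _∈H_ G x′ (cycle-hole C)
          x′∈ = fsuc (at ps) , at-≡ u ps
            where
            at : ∀ qs → Fin (suc (length (qs ++ x′ ∷ [])))
            at [] = fsuc fzero
            at (_ ∷ qs) = fsuc (at qs)
            at-≡ : ∀ w qs → lookup (w ∷ qs ++ x′ ∷ []) (at qs) ≡ x′
            at-≡ w [] = refl
            at-≡ w (w′ ∷ qs) = at-≡ w′ qs
      ... | suc d , lt , eq , _ = Key.key hx h′ (s≤s z≤n) lt path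
            (lastOf-++ u ps x′ []) (cong not (trans (cong even? rest-length) (cong not odd))) kinds
        where
        h′ = hat-move eq hx′
        rest-length : length (ps ++ x′ ∷ []) ≡ suc (length ps)
        rest-length = trans (length-++ ps) (+-comm _ 1)
        x≢x′ : x ≢ x′
        x≢x′ refl = hats-at (s≤s z≤n) lt hx h′
        ¬xx′ : ¬ x ~ x′
        ¬xx′ a = hats-at (s≤s z≤n) lt (adjacent-hats hx h′ a) h′
        path : InducedPath (x ∷ u ∷ ps ++ x′ ∷ [])
        path = link xu (All.++⁺ (All.tabulate λ w∈ → (λ { refl → rest-hat (All.lookup rests (there w∈)) hx })
                                 , λ a → tail-far ip w∈ (sym (x-only (there w∈) a))) ((x≢x′ , ¬xx′) ∷ []))
                 (snoc ip (~-sym xv) λ w∈ → (λ { refl → rest-hat (All.lookup rests w∈) h′ }) , λ a → x′-only w∈ (~-sym a))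
        kinds : ∀ {w} → w ∈ˡ x ∷ u ∷ ps ++ x′ ∷ [] → Link x x′ w
        kinds (here e) = inj₁ e
        kinds (there m) with ∈-++⁻ (u ∷ ps) m
        ... | inj₁ m′ = inj₂ (inj₂ (All.lookup rests m′))
        ... | inj₂ (here e) = inj₂ (inj₁ e)

    clown : ∀ {i x} → Hat i x → Clown G
    clown {i} {x} h = record
      { C = toHole i ; evenC = even⇒2∣ _ size-even ; hat = x ; hat∉ = λ { (j , e) → off _ (sym e) }
      ; hatAdj = λ j → to j , from j }
      where
      open Hat h
      to : ∀ (j : Fin size) → x ~ c (toℕ j + i) → toℕ j ≡ 0 ⊎ toℕ j ≡ 1
      to j a = go (toℕ j) (Fin.toℕ<n j) (only _ a)
        where
        go : ∀ j → j < size → c (j + i) ≡ c i ⊎ c (j + i) ≡ c (1 + i) → j ≡ 0 ⊎ j ≡ 1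
        go zero _ _ = inj₁ refl
        go (suc zero) _ _ = inj₂ refl
        go (suc (suc j)) lt (inj₁ e) = contradiction (sym e) (distinct (2 + j) i (s≤s z≤n) lt)
        go (suc (suc j)) lt (inj₂ e) = contradiction (trans (sym e) (cong (c ∘ suc) (sym (+-suc j i)))) (distinct (1 + j) (1 + i) (s≤s z≤n) (<⇒≤ lt))
      from : ∀ (j : Fin size) → toℕ j ≡ 0 ⊎ toℕ j ≡ 1 → x ~ c (toℕ j + i)
      from j (inj₁ e) = subst (λ k → x ~ c (k + i)) (sym e) adj₀
      from j (inj₂ e) = subst (λ k → x ~ c (k + i)) (sym e) adj₁

    clown-in : ∀ {i x} (h : Hat i x) → ∀ v → _∈H_ G v (Clown.C (clown h)) → W v
    clown-in {i} h v v∈ with toHole-On i v∈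
    ... | j , refl = ring⊆W j

    rest-clear : ∀ {i x w} (h : Hat i x) → Rest w → ¬ (_∈H_ G w (Clown.C (clown h))) × (∀ z → _∈H_ G z (Clown.C (clown h)) → ¬ w ~ z)
    rest-clear {i} h (_ , far) = (λ w∈ → let j , e = toHole-On i w∈ in proj₁ (far j) e) ,
      λ z z∈ a → let j , e = toHole-On i z∈ in proj₂ (far j) (subst (_ ~_) e a)

    -- A vertex on the ring has two non-adjacent neighbours, so it is not simplicial. A simplicial
    -- vertex next to the ring is a hat, and then the path of length zero is an even path to the hat
    -- of a clown.
    safe⇒rest : ∀ {z} → SafeIn W z → Rest z
    safe⇒rest {z} s = inside , λ i → off i , λ a → not-hat (hat-of inside off (λ j k zj zk ne → simplicial _ _ (ring⊆W j) (ring⊆W k) zj zk ne) a)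
      where
      open SafeIn s
      off : ∀ i → z ≢ c i
      off i refl = proj₂ (ends-apart i) (simplicial _ _ (ring⊆W _) (ring⊆W _) (prev i) (next i) (proj₁ (ends-apart i)))
      not-hat : ¬ (∃[ i ] Hat i z)
      not-hat (i , h) = odd (clown h) (toPath {z} {[]} single) (clown-in h) (λ { v (fzero , refl) → inside }) refl refl
        (λ { w (fzero , refl) ne → contradiction refl ne }) (even⇒2∣ 0 refl)

    -- One more edge, to a hat in `M`, makes the odd path an even path from `z` to the hat of a
    -- clown on the ring.
    safe-unlinked : ∀ {M i z} → SafeIn W z → Straddling M i → ¬ OddLink Rest (_≡ z) (λ v → M v × Rest v)
    safe-unlinked {M} {i} {z} s st record { path = mkPath ps ip rests refl ; odd = odd ; source = refl ; target = mv , _ ; only-target = only-target } = run do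
      x , hx , mx , xv , x-only ← end-hat st rests (last∈ z ps) mv (λ w∈ mw → only-target w∈ (mw , All.lookup rests w∈)) (last-nbr-unique ip)
      return (absurd x hx xv x-only)
      where
      absurd : ∀ x → Hat i x → x ~ lastOf z ps → (∀ {w} → w ∈ˡ z ∷ ps → x ~ w → w ≡ lastOf z ps) → ⊥
      absurd x hx xv x-only = SafeIn.odd s (clown hx) P (clown-in hx) in-W refl (trans (toPath-last path) (lastOf-++ z ps x []))
        (λ w w∈ ne → rest-clear hx (rest (∈-++⁻ (z ∷ ps) (toPath-∈ path w∈)) ne))
        (even⇒2∣ _ (trans (cong even? (trans (length-++ ps) (+-comm _ 1))) (cong not odd)))
        where
        path : InducedPath (z ∷ ps ++ x ∷ [])
        path = snoc ip (~-sym xv) λ w∈ → (λ { refl → rest-hat (All.lookup rests w∈) hx }) , λ a → x-only w∈ (~-sym a)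
        P = toPath path
        rest : ∀ {w} → w ∈ˡ z ∷ ps ⊎ w ∈ˡ x ∷ [] → w ≢ x → Rest w
        rest (inj₁ m) _ = All.lookup rests m
        rest (inj₂ (here e)) ne = contradiction e ne
        in-W : ∀ v → _∈P_ G v P → W v
        in-W v v∈ with v ≟ x
        ... | yes refl = Hat.inside hx
        ... | no ne = proj₁ (rest (∈-++⁻ (z ∷ ps) (toPath-∈ path v∈)) ne)

    -- In this set the marker `c i` sees exactly the hats taken from `M`, and `c (1 + i)` is
    -- missing.
    Marked : (V → Set) → ℕ → V → Set
    Marked M i v = Rest v ⊎ (M v × Hat i v) ⊎ v ≡ c i

    -- An even path from the marker to the hat of a clown would give a handcuff or an eye mask
    -- together with the ring.
    marker-safe : ∀ {M i} → Straddling M i → SafeIn (Marked M i) (c i)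
    marker-safe {M} {i} st = record { inside = inj₂ (inj₂ refl) ; simplicial = simp ; odd = odd }
      where
      nbr-hat : ∀ {u} → Marked M i u → c i ~ u → M u × Hat i u
      nbr-hat (inj₁ (_ , far)) a = contradiction (~-sym a) (proj₂ (far i))
      nbr-hat (inj₂ (inj₁ mh)) a = mh
      nbr-hat (inj₂ (inj₂ refl)) a = ⊥-elim (~-irr a)
      simp : SimplicialIn (Marked M i) (c i)
      simp u w mu mw iu iw ne = hats-adj (proj₂ (nbr-hat mu iu)) (proj₂ (nbr-hat mw iw)) ne
      odd : OddToHats (Marked M i) (c i)
      -- Here the marker itself is the hat, so its two neighbours on the hole of the clown are hats
      -- of the ring.
      odd D record { len = zero } D⊆ P⊆ start end clear _ =
        no-eye-mask C kinds (hat-nbr x∈ hat~x) (hat-nbr y∈ hat~y) x∈ y∈ x~y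
          λ v∈ h → hat-only v∈ (subst (_~ _) e (~-sym (Hat.adj₀ h)))
        where
        open Clown D
        open Attachment D
        e = trans (sym start) end
        hat-nbr : ∀ {v} → _∈H_ G v C → hat ~ v → Hat i v
        hat-nbr {v} v∈ a = proj₂ (nbr-hat (D⊆ _ v∈) (subst (_~ v) (sym e) a))
        kinds : ∀ {v} → _∈H_ G v C → Rest v ⊎ Hat i v
        kinds v∈ with D⊆ _ v∈
        ... | inj₁ r = inj₁ r
        ... | inj₂ (inj₁ (_ , h)) = inj₂ h
        ... | inj₂ (inj₂ refl) = contradiction (subst (λ w → _∈H_ G w C) e v∈) hat∉
      odd D record { len = suc zero } _ _ _ _ _ 2∣1 = contradiction (2∣⇒even 1 2∣1) λ ()
      -- Without the marker the path is odd and leads from a hat of the ring to the hat of the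
      -- clown: the middle of a handcuff.
      odd D P@(record { len = suc (suc l) ; vtx = path ; inj = inj ; adjP = adjP }) D⊆ P⊆ start end clear 2∣len =
        proj₁ (proj₂ (proj₂ (proj₂ innocent))) record
          { C₁ = toHole 0 ; C₂ = C ; even₁ = even⇒2∣ _ size-even ; even₂ = evenC ; P = Q
          ; oddP = odd⇒¬2∣ (suc l) (Bool.not-injective (2∣⇒even (2 + l) 2∣len))
          ; disj₁₂ = λ v v∈ v∈′ → let j , e = toHole-On 0 v∈ in proj₁ (proj₂ (hole-rest v∈′) j) e
          ; disj₁P = λ { v v∈ (j , refl) → let k , e = toHole-On 0 v∈ in off-ring j k e }
          ; disj₂P = disj₂P
          ; x₁ = c i ; y₁ = c (1 + i) ; x₁∈ = On-toHole 0 (i , refl) ; y₁∈ = On-toHole 0 (1 + i , refl) ; x₁y₁ = next i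
          ; x₂ = x ; y₂ = y ; x₂∈ = x∈ ; y₂∈ = y∈ ; x₂y₂ = x~y
          ; edges₁P = λ { z w z∈ (j , refl) → to₁ j (toHole-On 0 z∈) , λ { (e , e′) → from₁ e e′ } }
          ; edges₂P = λ { z w z∈ (j , refl) → to₂ j z∈ , λ { (e , e′) → from₂ e e′ } }
          ; edges₁₂ = λ z₁ z₂ z₁∈ z₂∈ a → let j , e = toHole-On 0 z₁∈ in proj₂ (proj₂ (hole-rest z₂∈) j) (~-sym (subst (_~ z₂) e a)) }
        where
        open Clown D
        open Attachment D
        Q : Path G
        Q = record { len = suc l ; vtx = path ∘ fsuc ; inj = λ e → Fin.suc-injective (inj e)
                   ; adjP = λ j k → (λ a → down (proj₁ (adjP (fsuc j) (fsuc k)) a)) , λ r → proj₂ (adjP (fsuc j) (fsuc k)) (up r) }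
          where
          down : ∀ {a b} → suc b ≡ suc (suc a) ⊎ suc a ≡ suc (suc b) → b ≡ suc a ⊎ a ≡ suc b
          down (inj₁ e) = inj₁ (suc-injective e)
          down (inj₂ e) = inj₂ (suc-injective e)
          up : ∀ {a b} → b ≡ suc a ⊎ a ≡ suc b → suc b ≡ suc (suc a) ⊎ suc a ≡ suc (suc b)
          up (inj₁ e) = inj₁ (cong suc e)
          up (inj₂ e) = inj₂ (cong suc e)
        start-clear : ¬ (_∈H_ G (c i) C) × (∀ z → _∈H_ G z C → ¬ c i ~ z)
        start-clear = clear (c i) (fzero , start) λ e → contradiction (inj (trans start (trans e (sym end)))) λ ()
        hole-rest : ∀ {v} → _∈H_ G v C → Rest v
        hole-rest v∈ with D⊆ _ v∈
        ... | inj₁ r = r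
        ... | inj₂ (inj₁ (_ , h)) = contradiction (~-sym (Hat.adj₀ h)) (proj₂ start-clear _ v∈)
        ... | inj₂ (inj₂ refl) = contradiction v∈ (proj₁ start-clear)
        kind : ∀ j → Rest (path (fsuc j)) ⊎ (Hat i (path (fsuc j)) × j ≡ fzero)
        kind j with P⊆ (path (fsuc j)) (fsuc j , refl)
        ... | inj₁ r = inj₁ r
        ... | inj₂ (inj₂ e) = contradiction (inj (trans start (sym e))) λ ()
        ... | inj₂ (inj₁ (_ , h)) with proj₁ (adjP fzero (fsuc j)) (subst (_~ path (fsuc j)) (sym start) (~-sym (Hat.adj₀ h)))
        ... | inj₁ e = inj₂ (h , Fin.toℕ-injective (suc-injective e))
        ... | inj₂ ()
        off-ring : ∀ j k → path (fsuc j) ≢ c k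
        off-ring j k e with kind j
        ... | inj₁ (_ , far) = proj₁ (far k) e
        ... | inj₂ (h , _) = Hat.off h k e
        first-hat : Hat i (path (fsuc fzero))
        first-hat = proj₂ (nbr-hat (P⊆ _ (fsuc fzero , refl)) (subst (_~ path (fsuc fzero)) start (proj₂ (adjP fzero (fsuc fzero)) (inj₁ refl))))
        disj₂P : ∀ v → _∈H_ G v C → ¬ (_∈P_ G v Q)
        disj₂P v v∈ (j , refl) with path (fsuc j) ≟ hat
        ... | yes e = hat∉ (subst (λ w → _∈H_ G w C) e v∈)
        ... | no ne = proj₁ (clear (path (fsuc j)) (fsuc j , refl) ne) v∈
        to₁ : ∀ {z} j → On z → path (fsuc j) ~ z → path (fsuc j) ≡ path (fsuc fzero) × (z ≡ c i ⊎ z ≡ c (1 + i))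
        to₁ j (k , refl) a with kind j
        ... | inj₁ (_ , far) = contradiction a (proj₂ (far k))
        ... | inj₂ (h , refl) = refl , Hat.only h k a
        from₁ : ∀ {z w} → w ≡ path (fsuc fzero) → z ≡ c i ⊎ z ≡ c (1 + i) → w ~ z
        from₁ refl (inj₁ refl) = Hat.adj₀ first-hat
        from₁ refl (inj₂ refl) = Hat.adj₁ first-hat
        to₂ : ∀ {z} j → _∈H_ G z C → path (fsuc j) ~ z → path (fsuc j) ≡ path (fsuc (fromℕ (suc l))) × (z ≡ x ⊎ z ≡ y)
        to₂ {z} j z∈ a with path (fsuc j) ≟ hat
        ... | no ne = contradiction a (proj₂ (clear (path (fsuc j)) (fsuc j , refl) ne) z z∈)
        ... | yes e = trans e (sym end) , hat-only z∈ (subst (_~ z) e a)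
        from₂ : ∀ {z w} → w ≡ path (fsuc (fromℕ (suc l))) → z ≡ x ⊎ z ≡ y → w ~ z
        from₂ e (inj₁ refl) = subst (_~ x) (sym (trans e end)) hat~x
        from₂ e (inj₂ refl) = subst (_~ y) (sym (trans e end)) hat~y

-- Subsets: enumeration, and passage from decidable predicates.

allSubsets : ∀ n → List (Subset n)
allSubsets zero    = [] ∷ []
allSubsets (suc n) = map (true ∷_) (allSubsets n) ++ map (false ∷_) (allSubsets n)

∈-allSubsets : ∀ {n} (M : Subset n) → M ∈ˡ allSubsets n
∈-allSubsets []            = here refl
∈-allSubsets (true ∷ M)  = ∈-++⁺ˡ (∈-map⁺ (true ∷_) (∈-allSubsets M))
∈-allSubsets (false ∷ M) = ∈-++⁺ʳ _ (∈-map⁺ (false ∷_) (∈-allSubsets M))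

module _ {n : ℕ} {P : Fin n → Set} (P? : ∀ v → Dec (P v)) where

  comprehension : Subset n
  comprehension = tabulate (does ∘ P?)

  comprehension⁺ : ∀ {v} → P v → v ∈ comprehension
  comprehension⁺ {v} pv = lookup⇒[]= v _ (trans (lookup∘tabulate (does ∘ P?) v) (dec-true (P? v) pv))

  comprehension⁻ : ∀ {v} → v ∈ comprehension → P v
  comprehension⁻ {v} v∈ = decidable-stable (P? v) λ ¬pv →
    contradiction (trans (sym (dec-false (P? v) ¬pv)) (trans (sym (lookup∘tabulate (does ∘ P?) v)) ([]=⇒lookup v∈))) λ ()

-- The induction on the vertex set.

module Solve {n : ℕ} (G : Graph n) (claw-free : ClawFree G) (innocent : Innocent G) where
  open Paths G
  open StableSets G
  open Simplicial G
  open Rings G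
  open Antiholes G innocent using (hole-even)
  open LongRings G claw-free innocent using (claw)
  open GoodRings G claw-free innocent
  open Hats G claw-free innocent

  safe-restrict : ∀ {W W′ : V → Set} {z} → (∀ {v} → W′ v → W v) → W′ z → SafeIn W z → SafeIn W′ z
  safe-restrict sub w′z s = record
    { inside = w′z
    ; simplicial = λ u w wu ww → simplicial u w (sub wu) (sub ww)
    ; odd = λ D P D⊆ P⊆ → odd D P (λ v → sub ∘ D⊆ v) (λ v → sub ∘ P⊆ v) }
    where open SafeIn s

  -- `Z` is a predicate with at most one member, so that one statement serves both the empty set and
  -- a single prescribed vertex.
  Solvable : (V → Set) → Set₁
  Solvable W = ∀ (Z : V → Set) → (∀ {u v} → Z u → Z v → u ≡ v) → (∀ {z} → Z z → SafeIn W z) →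
               ¬ ¬ (∃[ S ] Strong W S × (∀ z → Z z → S z))

  module _ {W : V → Set} (smaller : ∀ {W′ : V → Set} {u} → (∀ {v} → W′ v → W v) → W u → ¬ W′ u → Solvable W′) where

    delete : ∀ Z → (∀ {u v} → Z u → Z v → u ≡ v) → (∀ {z} → Z z → SafeIn W z) → ∀ {v} → W v → ¬ Z v → SimplicialIn W v →
             ¬ ¬ (∃[ S ] Strong W S × (∀ z → Z z → S z))
    delete Z unique safe {v} wv ¬zv simp = do
      S , σ , Z⊆S ← smaller {λ u → W u × u ≢ v} proj₁ wv (λ w → proj₂ w refl) Z unique
        λ zz → safe-restrict proj₁ (SafeIn.inside (safe zz) , λ { refl → ¬zv zz }) (safe zz)
      S′ , σ′ , S⊆S′ ← restore-simplicial wv simp σ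
      return (S′ , σ′ , λ z zz → S⊆S′ z (Z⊆S z zz))

    solve-chordal : ∀ {k} → Size W k → HoleFree W → Solvable W
    solve-chordal sz hf Z unique safe = do
      yes (z , zz) ← lem (∃ Z)
        where no ¬Z → do
                yes (p , wp) ← lem (∃ W)
                  where no ¬W → return (W , record
                          { within = id ; stable = λ wu → contradiction (_ , wu) ¬W
                          ; hits = λ mc → let v , kv = MaxClique.nonempty mc in return (v , MaxClique.within mc kv , kv) } , λ z zz → contradiction (z , zz) ¬Z)
                v , wv , simp ← simplicial-exists sz hf wp
                delete Z unique safe wv (λ zv → ¬Z (v , zv)) simp
      inj₁ (v , wv , v≢z , simp) ← simplicial-avoiding sz hf (SafeIn.inside (safe zz))
        where inj₂ only → return ((λ v → v ≡ z) , record
                { within = λ { refl → SafeIn.inside (safe zz) } ; stable = λ { refl refl → ~-irr }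
                ; hits = λ mc → let v , kv = MaxClique.nonempty mc in return (v , only (MaxClique.within mc kv) , kv) } , λ z′ zz′ → unique zz′ zz)
      delete Z unique safe wv (λ zv → v≢z (unique zv zz)) simp

    module _ (R : Ring) (ring⊆W : ∀ i → W (Ring.c R i)) where
      open RingProperties R
      open OnRing {W} R ring⊆W

      private
        -- Targets are subsets and not predicates, so that finitely many exchanges cover them all;
        -- `combine` converts a given clique.
        Target : Subset n → Set
        Target M = MaxClique W (_∈ M) × (∃[ y ] y ∈ M × Rest y) × (∃[ x ] x ∈ M × ¬ Rest x)

        K : Subset n → V → Set
        K M v = v ∈ M × Rest v

      targets-unlinked : ∀ {M M′} → Target M → Target M′ → ¬ OddLink Rest (K M) (K M′)
      targets-unlinked (mc , (y , my , ry) , (x , mx , ¬rx)) (mc′ , (y′ , my′ , ry′) , (x′ , mx′ , ¬rx′)) odd-link = run do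
        i , st ← straddling mc my ry mx ¬rx
        i′ , st′ ← straddling mc′ my′ ry′ mx′ ¬rx′
        return (hats-unlinked st st′ odd-link)

      hit-target : ∀ {M} → Target M → ¬ ¬ (∃[ S ] Strong Rest S × Meets S (K M))
      hit-target {M} (mc , (y , my , ry) , (x , mx , ¬rx)) = do
        i , st ← straddling mc my ry mx ¬rx
        S , σ , marked ← smaller {Marked (_∈ M) i} {c (1 + i)} (marked⊆W i) (ring⊆W (1 + i)) (unmarked i) (_≡ c i) (λ { refl refl → refl }) (λ { refl → marker-safe st })
        rest? ← finite-choice (λ v → lem (Rest v))
        trim rest? i st σ (marked (c i) refl)
        where
        marked⊆W : ∀ i {v} → Marked (_∈ M) i v → W v
        marked⊆W i (inj₁ (wv , _)) = wv
        marked⊆W i (inj₂ (inj₁ (_ , h))) = Hat.inside h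
        marked⊆W i (inj₂ (inj₂ refl)) = ring⊆W i
        unmarked : ∀ i → ¬ Marked (_∈ M) i (c (1 + i))
        unmarked i (inj₁ (_ , far)) = proj₁ (far (1 + i)) refl
        unmarked i (inj₂ (inj₁ (_ , h))) = Hat.off h (1 + i) refl
        unmarked i (inj₂ (inj₂ e)) = ~⇒≢ (next i) (sym e)
        trim : (∀ v → Dec (Rest v)) → ∀ i → Straddling (_∈ M) i → ∀ {S} → Strong (Marked (_∈ M) i) S → S (c i) →
               ¬ ¬ (∃[ S ] Strong Rest S × Meets S (K M))
        trim rest? i st {S} σ sc = return (S′ , record { within = proj₂ ; stable = λ u v → Strong.stable σ (proj₁ u) (proj₁ v) ; hits = hits′ } , meets)
          where
          S′ : V → Set
          S′ v = S v × Rest v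
          no-hat : ∀ {v} → S v → ¬ Hat i v
          no-hat sv h = Strong.stable σ sv sc (Hat.adj₀ h)
          in-rest : ∀ {v} → S v → v ≢ c i → Rest v
          in-rest sv ne with Strong.within σ sv
          ... | inj₁ r = r
          ... | inj₂ (inj₁ (_ , h)) = contradiction h (no-hat sv)
          ... | inj₂ (inj₂ e) = contradiction e ne
          meets : Meets S′ (K M)
          meets = do
            v , sv , mv ← Strong.hits σ record
              { within = classify ; clique = MaxClique.clique mc ; nonempty = MaxClique.nonempty mc
              ; maximal = λ mu → MaxClique.maximal mc (marked⊆W i mu) }
            let rv = in-rest sv λ { refl → proj₂ (proj₂ ry i) (MaxClique.clique mc my mv (proj₁ (proj₂ ry i))) }
            return (v , (sv , rv) , mv , rv)
            where
            classify : ∀ {v} → v ∈ M → Marked (_∈ M) i v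
            classify {v} mv with rest? v
            ... | yes r = inj₁ r
            ... | no ¬r = inj₂ (inj₁ (mv , Straddling.hats st mv ¬r))
          hits′ : ∀ {L} → MaxClique Rest L → Meets S′ L
          hits′ {L} ml = do
            v , sv , inj₁ lv ← Strong.hits σ extended
              where v , sv , inj₂ (_ , h , _) → contradiction h (no-hat sv)
            return (v , (sv , MaxClique.within ml lv) , lv)
            where
            -- A maximal clique of the rest need not be maximal in the marked set. Adding the hats
            -- of `M` that see all of it repairs this, and `S`, which contains the marker, cannot
            -- meet the enlarged clique in a hat.
            L⁺ : V → Set
            L⁺ v = L v ⊎ (v ∈ M × Hat i v × (∀ u → L u → v ~ u))
            clique⁺ : IsClique L⁺
            clique⁺ (inj₁ lu) (inj₁ lv) ne = MaxClique.clique ml lu lv ne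
            clique⁺ (inj₁ lu) (inj₂ (_ , _ , all)) ne = ~-sym (all _ lu)
            clique⁺ (inj₂ (_ , _ , all)) (inj₁ lv) ne = all _ lv
            clique⁺ (inj₂ (_ , h , _)) (inj₂ (_ , h′ , _)) ne = hats-adj h h′ ne
            maximal⁺ : ∀ {u} → Marked (_∈ M) i u → (∀ {v} → L⁺ v → v ≢ u → u ~ v) → L⁺ u
            maximal⁺ (inj₁ r) all = inj₁ (MaxClique.maximal ml r (all ∘ inj₁))
            maximal⁺ (inj₂ (inj₁ (mu , h))) all = inj₂ (mu , h , λ v lv → all (inj₁ lv) λ { refl → rest-hat (MaxClique.within ml lv) h })
            maximal⁺ (inj₂ (inj₂ refl)) all =
              let v , lv = MaxClique.nonempty ml ; _ , far = MaxClique.within ml lv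
              in contradiction (~-sym (all (inj₁ lv) (proj₁ (far i)))) (proj₂ (far i))
            extended : MaxClique (Marked (_∈ M) i) L⁺
            extended = record
              { within = λ { (inj₁ lv) → inj₁ (MaxClique.within ml lv) ; (inj₂ (mv , h , _)) → inj₂ (inj₁ (mv , h)) }
              ; clique = clique⁺ ; nonempty = let v , lv = MaxClique.nonempty ml in v , inj₁ lv ; maximal = maximal⁺ }

      Alternate : V → Set
      Alternate v = ∃[ i ] even? i ≡ true × v ≡ c i

      alternate-stable : ∀ {u v} → Alternate u → Alternate v → ¬ u ~ v
      alternate-stable (i , ei , refl) (j , ej , refl) a = parity-adj size-even a (trans ei (sym ej))

      -- A ring vertex of odd index has a successor of even index. A vertex next to the ring sees
      -- two consecutive ring vertices by `two-nbrs`, one of which has even index.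
      nearby : ∀ {v j} → v ≡ c j ⊎ v ~ c j → ¬ Alternate v → ¬ ¬ (∃[ s ] Alternate s × v ~ s)
      nearby {v} {j} close ¬alt = do
        no off ← lem (∃[ k ] v ≡ c k)
          where yes (k , refl) → return (c (1 + k) , (1 + k , cong not (¬even⇒odd {k} λ e → ¬alt (k , e , refl)) , refl) , next k)
        return (outside-ring (λ k e → off (k , e)) close)
        where
        p = size ∸ 1
        p-odd : even? p ≡ false
        p-odd = Bool.not-injective (trans (cong even? (m+[n∸m]≡n {1} (≤-trans (s≤s z≤n) size≥4))) size-even)
        outside-ring : (∀ k → v ≢ c k) → v ≡ c j ⊎ v ~ c j → ∃[ s ] Alternate s × v ~ s
        outside-ring off (inj₁ e) = contradiction e (off j)
        outside-ring off (inj₂ a) with even? j Bool.≟ true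
        ... | yes e = c j , (j , e , refl) , a
        ... | no ne with two-nbrs off a
        ... | inj₁ b = c (p + j) , (p + j , trans (even?-+-odd p j p-odd) (cong not (¬even⇒odd {j} ne)) , refl) , b
        ... | inj₂ b = c (1 + j) , (1 + j , cong not (¬even⇒odd {j} ne) , refl) , b

      -- Without induced P₄'s between alternate vertices of the ring their neighbourhoods in a clique
      -- form a chain, so one alternate vertex s dominates all of them.
      top-alternate : (∀ i j → even? i ≡ true → even? j ≡ true → c i ≢ c j → NoP4 W (c i) (c j)) → ∀ {L} → IsClique L → (∀ {v} → L v → W v) → ∀ vs →
                      ¬ ¬ (∃[ s ] Alternate s × (∀ v → v ∈ˡ vs → Alternate v → ∀ m → L m → m ~ v → m ~ s))
      top-alternate noP4 cl sub [] = return (c 0 , (0 , refl , refl) , λ _ ())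
      top-alternate noP4 {L} cl sub (v ∷ vs) = do
        s , alt-s , best ← top-alternate noP4 cl sub vs
        yes alt-v ← lem (Alternate v)
          where no ¬alt → return (s , alt-s , λ { _ (here refl) alt → contradiction alt ¬alt ; u (there u∈) → best u u∈ })
        yes (m , lm , ms , ¬mv) ← lem (∃[ m ] L m × m ~ s × ¬ m ~ v)
          where no none → return (v , alt-v , λ { _ (here refl) _ m lm mv → mv
                                                ; u (there u∈) alt m lm mu → decidable-stable (m ~? v) λ ¬mv → none (m , lm , best u u∈ alt m lm mu , ¬mv) })
        return (s , alt-s , λ { _ (here refl) _ m′ lm′ m′v → decidable-stable (m′ ~? s) λ ¬m′s → cross alt-s alt-v lm ms ¬mv lm′ m′v ¬m′s
                              ; u (there u∈) → best u u∈ })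
        where
        cross : ∀ {s v m m′} → Alternate s → Alternate v → L m → m ~ s → ¬ m ~ v → L m′ → m′ ~ v → ¬ m′ ~ s → ⊥
        cross {m = m} {m′} (i , ei , refl) (j , ej , refl) lm ms ¬mv lm′ m′v ¬m′s =
          noP4 i j ei ej (λ e → ¬mv (subst (m ~_) e ms)) (sub lm′) (sub lm) (~-sym ms) (cl lm lm′ λ { refl → ¬m′s ms }) m′v (¬m′s ∘ ~-sym) ¬mv

      -- If `L` contained no alternate vertex, each of its members would see one, hence would see
      -- the dominating `s`; then `s` belongs to `L` by maximality.
      alternate-hits : (∀ i j → even? i ≡ true → even? j ≡ true → c i ≢ c j → NoP4 W (c i) (c j)) → ∀ {L} → MaxClique W L → (∀ {v} → L v → ¬ Rest v) → Meets Alternate L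
      alternate-hits noP4 {L} ml no-rest = do
        no missed ← lem (∃[ v ] Alternate v × L v)
          where yes hit → return hit
        s , alt-s , best ← top-alternate noP4 clique within (allFin n)
        return (s , alt-s , maximal (alt-in alt-s) λ {m} lm _ → ~-sym (decidable-stable (m ~? s) λ ¬ms →
          touches lm λ (j , close) → nearby close (λ alt → missed (m , alt , lm)) λ (v , alt-v , mv) → ¬ms (best v (∈-allFin v) alt-v m lm mv)))
        where
        open MaxClique ml
        alt-in : ∀ {s} → Alternate s → W s
        alt-in (i , _ , refl) = ring⊆W i
        touches : ∀ {m} → L m → ¬ ¬ (∃[ j ] (m ≡ c j ⊎ m ~ c j))
        touches lm none = no-rest lm (within lm , λ j → (λ e → none (j , inj₁ e)) , (λ a → none (j , inj₂ a)))

      rest-solvable : Solvable Rest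
      rest-solvable = smaller proj₁ (ring⊆W 0) λ r → proj₁ (proj₂ r 0) refl

      -- The rest is anticomplete to the ring, so the union is stable. A maximal clique avoids the
      -- rest and is met by an alternate vertex, lies inside it and is maximal there, or is a
      -- target.
      combine : (∀ i j → even? i ≡ true → even? j ≡ true → c i ≢ c j → NoP4 W (c i) (c j)) →
                ∀ {Z S : V → Set} → Strong Rest S → (∀ {M} → M ∈ˡ allSubsets n → Target M → Meets S (K M)) → (∀ z → Z z → S z) →
                ∃[ S ] Strong W S × (∀ z → Z z → S z)
      combine noP4 {Z} {S} σ targets Z⊆S = (λ v → Alternate v ⊎ S v) , record
        { within = λ { (inj₁ (i , _ , refl)) → ring⊆W i ; (inj₂ sv) → proj₁ (Strong.within σ sv) }
        ; stable = stable′ ; hits = hits′ } , λ z zz → inj₂ (Z⊆S z zz)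
        where
        apart-from : ∀ {u v} → Alternate u → S v → ¬ v ~ u
        apart-from (i , _ , refl) sv = proj₂ (proj₂ (Strong.within σ sv) i)
        stable′ : ∀ {u v} → Alternate u ⊎ S u → Alternate v ⊎ S v → ¬ u ~ v
        stable′ (inj₁ au) (inj₁ av) = alternate-stable au av
        stable′ (inj₁ au) (inj₂ sv) a = apart-from au sv (~-sym a)
        stable′ (inj₂ su) (inj₁ av) = apart-from av su
        stable′ (inj₂ su) (inj₂ sv) = Strong.stable σ su sv
        hits′ : ∀ {L} → MaxClique W L → Meets (λ v → Alternate v ⊎ S v) L
        hits′ {L} ml = do
          yes (y , ly , ry) ← lem (∃[ y ] L y × Rest y)
            where no none → do v , alt , lv ← alternate-hits noP4 ml (λ lv rv → none (_ , lv , rv))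
                               return (v , inj₁ alt , lv)
          yes (x , lx , ¬rx) ← lem (∃[ x ] L x × ¬ Rest x)
            where no none → do v , sv , lv ← Strong.hits σ (inner none)
                               return (v , inj₂ sv , lv)
          L? ← finite-choice (λ v → lem (L v))
          let M = comprehension L?
              M⇒L = comprehension⁻ L?
              L⇒M = comprehension⁺ L?
          v , sv , mv , _ ← targets (∈-allSubsets M)
            ( record { within = within ∘ M⇒L ; clique = λ u v → clique (M⇒L u) (M⇒L v) ; nonempty = let v , lv = nonempty in v , L⇒M lv
                     ; maximal = λ wu all → L⇒M (maximal wu (all ∘ L⇒M)) }
            , (y , L⇒M ly , ry) , (x , L⇒M lx , ¬rx))
          return (v , inj₂ sv , M⇒L mv)
          where
          open MaxClique ml
          inner : ¬ (∃[ x ] L x × ¬ Rest x) → MaxClique Rest L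
          inner none = record
            { within = λ lv → rest-stable (within lv) λ ¬r → none (_ , lv , ¬r) ; clique = clique ; nonempty = nonempty
            ; maximal = λ ru → maximal (proj₁ ru) }

    solve-ring : GoodRing W → Solvable W
    solve-ring (R , ring⊆W , noP4) Z unique safe = do
      S₀ , σ₀ , _ ← rest-solvable R ring⊆W (λ _ → ⊥) (λ ()) (λ ())
      S₁ , σ₁ , hits₁ ← multi-exchange _ _ (λ ta (ku , _) (kv , _) → MaxClique.clique (proj₁ ta) ku kv)
        (targets-unlinked R ring⊆W) (S₀ , σ₀) (hit-target R ring⊆W) (allSubsets n)
      yes (z , zz) ← lem (∃ Z)
        where no ¬Z → return (combine R ring⊆W noP4 {Z} σ₁ hits₁ λ z zz → contradiction (z , zz) ¬Z)
      T , τ , Z⊆T ← rest-solvable R ring⊆W Z unique λ zz → safe-restrict proj₁ (safe⇒rest (safe zz)) (safe zz)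
      -- Viewed as the clique `{z}`, the prescribed vertex is brought in by one more exchange;
      -- `safe-unlinked` keeps every target met.
      S₂ , σ₂ , meets , keep ← exchange {K = λ v → v ≡ z} σ₁ τ (λ { refl refl ne → contradiction refl ne }) (return (z , Z⊆T z zz , refl))
      _ , sz , refl ← meets
      return (combine R ring⊆W noP4 {Z} σ₂
        (λ M∈ ta@(mc , (y , my , ry) , (x , mx , ¬rx)) → keep (λ (ku , _) (kv , _) → MaxClique.clique mc ku kv) (hits₁ M∈ ta)
          λ odd-link → straddling mc my ry mx ¬rx λ (_ , st) → safe-unlinked (safe zz) st odd-link)
        λ z′ zz′ → subst S₂ (unique zz zz′) sz)
      where open OnRing {W} R ring⊆W

  solvable : ∀ k {W} → Size W k → Solvable W
  solvable zero {W} sz Z unique safe = return (W , record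
    { within = id ; stable = λ wu → ⊥-elim (empty sz wu)
    ; hits = λ mc → ⊥-elim (empty sz (MaxClique.within mc (proj₂ (MaxClique.nonempty mc)))) } , λ z zz → SafeIn.inside (safe zz))
  solvable (suc k) {W} sz Z unique safe = do
    yes (H , H⊆W) ← lem (Σ (Hole G) λ H → ∀ {v} → _∈H_ G v H → W v)
      where no hole-free → solve-chordal smaller sz hole-free Z unique safe
    good ← good-ring H H⊆W
    solve-ring smaller good Z unique safe
    where
    smaller : ∀ {W′ : V → Set} {u} → (∀ {v} → W′ v → W v) → W u → ¬ W′ u → Solvable W′
    smaller sub wu ¬w′u = solvable k (shrink sz sub wu ¬w′u)

  strong-stable : ∀ {S : V → Set} (S? : ∀ v → Dec (S v)) → Strong (λ _ → ⊤) S → StrongStable G (comprehension S?)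
  strong-stable {S} S? σ = (λ u v u∈ v∈ → Strong.stable σ (comprehension⁻ S? u∈) (comprehension⁻ S? v∈)) , hit
    where
    M = comprehension S?
    hit : ∀ K → MaximalClique G K → ∃[ v ] (v ∈ K × v ∈ M)
    hit K (clique , nonempty , maximal) = decidable-stable (Fin.any? λ v → v ∈? K ×-dec v ∈? M) λ none →
      Strong.hits σ record
        { within = λ _ → _ ; clique = λ {u} {v} → clique u v ; nonempty = nonempty
        ; maximal = λ {u} _ all → maximal (K ∪ ⁅ u ⁆) (bigger u all) (p⊆p∪q ⁅ u ⁆) (x∈p∪q⁺ (inj₂ (x∈⁅x⁆ u))) }
        λ (v , sv , kv) → none (v , kv , comprehension⁺ S? sv)
      where
      bigger : ∀ u → (∀ {v} → v ∈ K → v ≢ u → u ~ v) → Clique G (K ∪ ⁅ u ⁆)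
      bigger u all x y x∈ y∈ ne with x∈p∪q⁻ K ⁅ u ⁆ x∈ | x∈p∪q⁻ K ⁅ u ⁆ y∈
      ... | inj₁ kx | inj₁ ky = clique x y kx ky ne
      ... | inj₁ kx | inj₂ y∈u with x∈⁅y⁆⇒x≡y u y∈u
      ... | refl = ~-sym (all kx ne)
      bigger u all x y x∈ y∈ ne | inj₂ x∈u | inj₁ ky with x∈⁅y⁆⇒x≡y u x∈u
      ... | refl = all ky (≢-sym ne)
      bigger u all x y x∈ y∈ ne | inj₂ x∈u | inj₂ y∈u =
        contradiction (trans (x∈⁅y⁆⇒x≡y u x∈u) (sym (x∈⁅y⁆⇒x≡y u y∈u))) ne

  solve : ∀ Z → Consistent G Z → (∀ v → v ∈ Z → Safe G v) → ¬ ¬ (Σ (Subset n) λ S → StrongStable G S × Z ⊆ S)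
  solve Z consistent safe = do
    S₀ , σ₀ , _ ← all-solvable (λ _ → ⊥) (λ ()) (λ ())
    -- The cliques to be met are the singletons of members of `Z`, since meeting `{z}` means
    -- containing `z`.
    S , σ , hits ← multi-exchange (_∈ Z) (λ z v → v ≡ z) (λ { _ refl refl ne → contradiction refl ne }) unlinked
      (S₀ , σ₀) through (allFin n)
    S? ← finite-choice (λ v → lem (S v))
    return (comprehension S? , strong-stable S? σ , λ {v} v∈ → comprehension⁺ S? (decidable-stable (S? v) λ ¬sv →
      hits (∈-allFin v) v∈ λ { (_ , sv , refl) → ¬sv sv }))
    where
    Any-vertex : V → Set
    Any-vertex _ = ⊤
    all-solvable : Solvable Any-vertex
    all-solvable = solvable n (allFin n , ≤-reflexive (length-tabulate id) , λ _ → ∈-allFin _)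
    through : ∀ {z} → z ∈ Z → ¬ ¬ (∃[ S ] Strong Any-vertex S × Meets S (_≡ z))
    through {z} z∈ = do
      S , σ , z∈S ← all-solvable (_≡ z) (λ { refl refl → refl }) λ { refl → record
        { inside = _ ; simplicial = λ u w _ _ zu zw ne → proj₁ (safe z z∈) u w zu zw ne
        ; odd = λ D P _ _ → proj₂ (safe z z∈) D P } }
      return (S , σ , return (z , z∈S z refl , refl))
    unlinked : ∀ {a b} → a ∈ Z → b ∈ Z → ¬ OddLink Any-vertex (_≡ a) (_≡ b)
    unlinked a∈ b∈ record { path = mkPath [] _ _ _ ; odd = () }
    unlinked {a} {b} a∈ b∈ record { path = mkPath ps@(y ∷ ys) ip _ refl ; odd = odd ; source = refl ; target = refl } =
      odd⇒¬2∣ (length ps) odd (consistent a _ a∈ b∈ (tail-far ip (last∈ y ys)) (toPath ip) refl (toPath-last ip))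


-- Decidability of the conclusion.

all-subsets? : ∀ {n} {P : Subset n → Set} → (∀ S → Dec (P S)) → Dec (∀ S → P S)
all-subsets? P? = map′ (λ none S → decidable-stable (P? S) λ ¬p → none (S , ¬p)) (λ all (S , ¬p) → ¬p (all S))
  (¬? (anySubset? (¬? ∘ P?)))

module _ {n : ℕ} (G : Graph n) where
  open Paths G using (_~?_)

  clique? : ∀ K → Dec (Clique G K)
  clique? K = Fin.all? λ u → Fin.all? λ v → u ∈? K →-dec (v ∈? K →-dec (¬? (u ≟ v) →-dec u ~? v))

  maximal-clique? : ∀ K → Dec (MaximalClique G K)
  maximal-clique? K = clique? K ×-dec (Fin.any? (_∈? K) ×-dec
    all-subsets? λ K′ → clique? K′ →-dec (K ⊆? K′ →-dec K′ ⊆? K))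

  strong-stable? : ∀ S → Dec (StrongStable G S)
  strong-stable? S = (Fin.all? λ u → Fin.all? λ v → u ∈? S →-dec (v ∈? S →-dec ¬? (u ~? v)))
    ×-dec all-subsets? λ K → maximal-clique? K →-dec Fin.any? λ v → v ∈? K ×-dec v ∈? S

theorem2p3 : {n : ℕ} (G : Graph n) → ClawFree G → Innocent G →
    (Z : Subset n) → Consistent G Z → (∀ v → v ∈ Z → Safe G v) →
    Σ (Subset n) (λ S → StrongStable G S × Z ⊆ S)
theorem2p3 G claw-free innocent Z consistent safe =
  decidable-stable (anySubset? λ S → strong-stable? G S ×-dec Z ⊆? S)
    (Solve.solve G claw-free innocent Z consistent safe)
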